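{- Let $i,k$ be integers with $0\le k\le i-1$. Consider the set of all invariant subspaces (in the sense of the context: the simultaneous eigenspaces $V_\chi$) of the preimages $S\subseteq E$ of all $(i-k)$-dimensional totally singular subspaces $\bar S$ of $\bar E$. This set is a packing of $N$ (distinct) planes in $G(2^i,2^k)$ with minimal distance $d=2^{(k-1)/2}$, where $$N=2^{i-k}\begin{bmatrix} i\\ k\end{bmatrix}\prod_{j=k}^{i-1}(2^j+1),\qquad \begin{bmatrix} i\\ k\end{bmatrix}=\frac{(2^i-1)(2^{i-1}-1)\cdots(2^{i-k+1}-1)}{(2^k-1)(2^{k-1}-1)\cdots(2-1)}$$ (a Gaussian binomial coefficient, equal to $1$ for $k=0$).
   Context: **Grassmannian packings.** $G(m,n)$ is the set of $n$-dimensional linear subspaces ("planes") of $\mathbb{R}^m$. The distance between $P,Q\in G(m,n)$ is $d(P,Q)=\sqrt{\sin^2\theta_1+\dots+\sin^2\theta_n}$, where $\theta_1,\dots,\theta_n$ are the principal angles between $P$ and $Q$; equivalently $d^2(P,Q)=n-\operatorname{trace}(\Pi_P\Pi_Q)$, where $\Pi_P,\Pi_Q$ are the orthogonal projection matrices onto $P,Q$. A packing of $N$ planes is a subset $\mathcal P=\{P_1,\dots,P_N\}\subset G(m,n)$ of $N$ planes; its minimal distance is $d(\mathcal P)=\min_{a\ne b}d(P_a,P_b)$. **The group $E$ and the orthogonal space $\bar E$.** Let $i\ge 1$, $U=\mathbb{F}_2^i$ with the usual dot product, and let $V=\mathbb{R}^{2^i}$ with orthonormal basis $(e_u)_{u\in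 U}$. For $a,b\in U$ define orthogonal transformations of $V$ by $X(a):e_u\mapsto e_{u+a}$ and $Y(b):e_u\mapsto(-1)^{b\cdot u}e_u$. Let $E=\{\pm X(a)Y(b):a,b\in U\}$, the group generated by all $X(a)$ and $Y(b)$; it has order $2^{2i+1}$ and center $\{\pm I\}$. Put $\bar E=E/\{\pm I\}$, an elementary abelian $2$-group of order $2^{2i}$, regarded as a $2i$-dimensional vector space over $\mathbb{F}_2$. Define the quadratic form $Q:\bar E\to\mathbb{F}_2$ by $Q(\bar g)=0$ if $g^2=I$ and $Q(\bar g)=1$ if $g^2=-I$, where $g\in E$ is any preimage of $\bar g$; thus $Q(\overline{X(a)Y(b)})=a\cdot b$. A subspace $\bar S\subseteq\bar E$ is totally singular if $Q(\bar g)=0$ for all $\bar g\in\bar S$. **Invariant subspaces.** If $\bar S\subseteq\bar E$ is a totally singular subspace of dimension $r$, its preimage $S\subseteq E$ (which contains $-I$) is an elementary abelian $2$-group of order $2^{r+1}$. The invariant subspaces of $S$ are the simultaneous eigenspaces $V_\chi=\{v\in V: gv=\chi(g)v\ \text{for all } g\in S\}$, where $\chi$ runs over the $2^r$ characters $\chi:S\to\{\pm1\}$ with $\chi(-I)=-1$. They are $2^r$ mutually orthogonal subspaces of $V$, each of dimension $2^{i-r}$. -}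

module Defs where

open import Level using (Level; 0ℓ; _⊔_) renaming (suc to lsuc)
open import Algebra.Apartness.Bundles using (HeytingField)
open import Algebra.Bundles using (CommutativeRing)
open import Algebra.Bundles.Raw using (RawRing)
open import Algebra.Module.Bundles.Raw using (RawLeftModule)
open import Algebra.Module.Construct.DirectProduct using (rawLeftModule)
import Algebra.Definitions.RawMonoid as RawMonoidOps
import Algebra.Properties.Ring as RingProperties
open import Data.Bool.Base using (Bool; true; false; _∧_; _xor_)
open import Data.Bool.Properties using (xor-∧-commutativeRing; xor-same; xor-assoc; ∧-distribˡ-xor; ∧-distribʳ-xor)
open import Data.Fin.Base using (Fin) renaming (_<_ to _<ᶠ_)
open import Data.Fin.Properties using (*↔×; 2↔Bool)
open import Data.List.Base using (applyUpTo)
import Data.List.Relation.Unary.All.Properties as All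
open import Data.Nat.Base as ℕ using (ℕ; zero; suc; _∸_; NonZero; >-nonZero)
import Data.Nat.Properties as ℕ
open import Data.Nat.DivMod using (_/_)
open import Data.Nat.ListAction using (product)
open import Data.Nat.ListAction.Properties using (product≢0)
open import Data.Product.Base using (Σ-syntax; ∃-syntax; _×_; _,_; proj₁; proj₂)
open import Data.Product.Function.NonDependent.Propositional using (_×-↔_)
open import Data.Sign.Base as Sign using (Sign)
import Data.Sign.Properties as Sign
open import Data.Sum.Base using (_⊎_; inj₁; inj₂)
open import Data.Vec.Base using (Vec; []; _∷_; replicate; zipWith; map)
open import Data.Vec.Properties using (zipWith-assoc)
open import Data.Vec.Functional using (Vector)
open import Function.Bundles using (_↔_; mk↔ₛ′; Inverse)
open import Function.Properties.Inverse using (↔-sym; ↔-trans)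
open import Relation.Binary.Core using (Rel)
open import Relation.Binary.PropositionalEquality as ≡ using (_≡_; refl; cong; cong₂)
open import Relation.Binary.Structures using (IsStrictPartialOrder)
import Algebra.Solver.CommutativeMonoid as CommutativeMonoidSolver
open import Relation.Nullary using (¬_)
open import Relation.Unary using (Pred; _∈_; _≐_)

private
  module Xor = CommutativeMonoidSolver
    (CommutativeRing.+-commutativeMonoid xor-∧-commutativeRing)
  module Signs = CommutativeMonoidSolver Sign.*-commutativeMonoid

------------------------------------------------------------------------
-- Linear algebra over a ring of scalars

module Linear {c ℓ m ℓm} (K : RawRing c ℓ)
              (M : RawLeftModule (RawRing.Carrier K) m ℓm) where

  open RawRing K using (Carrier; _≈_; 0#)
  open RawLeftModule M

  record IsSubspace {w} (W : Pred Carrierᴹ w) : Set (c ⊔ m ⊔ ℓm ⊔ w) where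
    field
      respects : ∀ {x y} → x ≈ᴹ y → x ∈ W → y ∈ W
      0-closed : 0ᴹ ∈ W
      +-closed : ∀ {x y} → x ∈ W → y ∈ W → x +ᴹ y ∈ W
      *-closed : ∀ t {x} → x ∈ W → t *ₗ x ∈ W

  lincomb : ∀ {n} → Vector Carrier n → Vector Carrierᴹ n → Carrierᴹ
  lincomb t b = RawMonoidOps.sum +ᴹ-rawMonoid (λ j → t j *ₗ b j)

  record IsBasis {w n} (W : Pred Carrierᴹ w) (b : Vector Carrierᴹ n)
                 : Set (c ⊔ ℓ ⊔ m ⊔ ℓm ⊔ w) where
    field
      members     : ∀ j → b j ∈ W
      independent : ∀ t → lincomb t b ≈ᴹ 0ᴹ → ∀ j → t j ≈ 0#
      spanning    : ∀ x → x ∈ W → ∃[ t ] x ≈ᴹ lincomb t b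

  HasDimension : ∀ {w} → Pred Carrierᴹ w → ℕ → Set _
  HasDimension W n = Σ[ b ∈ Vector Carrierᴹ n ] IsBasis W b

------------------------------------------------------------------------
-- The real numbers, as a Cauchy complete Archimedean ordered field.
-- The axioms hold for the constructive reals as well as for the
-- classical ones, where they determine ℝ up to isomorphism.

record OrderedField c ℓ₁ ℓ₂ ℓ₃ : Set (lsuc (c ⊔ ℓ₁ ⊔ ℓ₂ ⊔ ℓ₃)) where
  infix 4 _<_ _≤_
  field
    heytingField : HeytingField c ℓ₁ ℓ₂

  open HeytingField heytingField public

  field
    _<_                    : Rel Carrier ℓ₃
    <-isStrictPartialOrder : IsStrictPartialOrder _≈_ _<_
    #⇒<                    : ∀ {x y} → x # y → x < y ⊎ y < x
    <⇒#                    : ∀ {x y} → x < y → x # y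
    0<1                    : 0# < 1#
    +-monoˡ-<              : ∀ z {x y} → x < y → x + z < y + z
    *-pos                  : ∀ {x y} → 0# < x → 0# < y → 0# < x * y

  _≤_ : Rel Carrier ℓ₃
  x ≤ y = ¬ (y < x)

  commutativeRing : CommutativeRing c ℓ₁
  commutativeRing = record { isCommutativeRing = isCommutativeRing }

  open CommutativeRing commutativeRing public using (rawRing; ring)

  fromℕ : ℕ → Carrier
  fromℕ zero    = 0#
  fromℕ (suc n) = 1# + fromℕ n

  IsCauchy : (ℕ → Carrier) → Set ℓ₃
  IsCauchy s = ∀ k → ∃[ M ] (∀ m n → M ℕ.≤ m → M ℕ.≤ n →
    fromℕ (suc k) * (s m - s n) < 1#)

  ConvergesTo : (ℕ → Carrier) → Carrier → Set ℓ₃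
  ConvergesTo s l = ∀ k → ∃[ M ] (∀ n → M ℕ.≤ n →
    (fromℕ (suc k) * (s n - l) < 1#) × (fromℕ (suc k) * (l - s n) < 1#))

record RealField c ℓ₁ ℓ₂ ℓ₃ : Set (lsuc (c ⊔ ℓ₁ ⊔ ℓ₂ ⊔ ℓ₃)) where
  field
    orderedField : OrderedField c ℓ₁ ℓ₂ ℓ₃

  open OrderedField orderedField public

  field
    archimedean : ∀ x → ∃[ n ] x < fromℕ n
    complete    : ∀ s → IsCauchy s → ∃[ l ] ConvergesTo s l

    -- Square roots exist by completeness; they are part of the structure
    -- only in order to have a notation for them.  Nothing more is assumed of
    -- the root of a negative number (one may take √ (max x 0)).
    √        : Carrier → Carrier
    √-cong   : ∀ {x y} → x ≈ y → √ x ≈ √ y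
    √-nonneg : ∀ x → 0# ≤ √ x
    √-square : ∀ x → 0# ≤ x → √ x * √ x ≈ x

  _^_ : Carrier → ℕ → Carrier
  x ^ zero  = 1#
  x ^ suc n = x * (x ^ n)

  signed : Sign → Carrier → Carrier
  signed Sign.+ x = x
  signed Sign.- x = - x

  private
    open IsStrictPartialOrder <-isStrictPartialOrder
      using (<-respˡ-≈) renaming (trans to <-trans)
    module R = CommutativeRing commutativeRing

    0<2 : 0# < 1# + 1#
    0<2 = <-trans 0<1 (<-respˡ-≈ (R.+-identityˡ 1#) (+-monoˡ-< 1# 0<1))

    2-0≈2 : (1# + 1#) - 0# ≈ 1# + 1#
    2-0≈2 = R.trans (R.+-congˡ (RingProperties.-0#≈0# ring)) (R.+-identityʳ _)

    2-invertible : ∃[ h ] h * (1# + 1#) ≈ 1#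
    2-invertible with #⇒invertible (#-sym (<⇒# 0<2))
    ... | h , h*2≈1 , _ = h , R.trans (R.*-congˡ (R.sym 2-0≈2)) h*2≈1

  ½ : Carrier
  ½ = proj₁ 2-invertible

  ½*2≈1 : ½ * (1# + 1#) ≈ 1#
  ½*2≈1 = proj₂ 2-invertible

  -- 2 ^ ((k - 1) / 2)
  2^[_-1]/2 : ℕ → Carrier
  2^[ k -1]/2 = √ (½ * ((1# + 1#) ^ k))

------------------------------------------------------------------------
-- Grassmannian packings

module _ {c ℓ₁ ℓ₂ ℓ₃} (ℝ : RealField c ℓ₁ ℓ₂ ℓ₃) where

  open RealField ℝ

  Coordinates : ℕ → RawLeftModule Carrier c ℓ₁
  Coordinates m = record
    { Carrierᴹ = Vector Carrier m
    ; _≈ᴹ_     = λ v w → ∀ p → v p ≈ w p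
    ; _+ᴹ_     = λ v w p → v p + w p
    ; _*ₗ_     = λ t v p → t * v p
    ; 0ᴹ       = λ _ → 0#
    ; -ᴹ_      = λ v p → - v p
    }

  sum : ∀ {n} → Vector Carrier n → Carrier
  sum = RawMonoidOps.sum (RawRing.+-rawMonoid rawRing)

  ⟨_,_⟩ : ∀ {m} → Vector Carrier m → Vector Carrier m → Carrier
  ⟨ v , w ⟩ = sum (λ p → v p * w p)

  Subset : ℕ → Set (c ⊔ lsuc ℓ₁)
  Subset m = Pred (Vector Carrier m) ℓ₁

  G : (m n : ℕ) → Pred (Subset m) (c ⊔ ℓ₁)
  G m n W = IsSubspace W × HasDimension W n
    where open Linear rawRing (Coordinates m)

  -- The pairs over which ⟨ x , y ⟩ is maximised to get the cosine of the
  -- j-th principal angle, after the earlier principal vectors are chosen.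
  record Admissible {m n} (P Q : Subset m)
                    (p q : Vector (Vector Carrier m) n) (j : Fin n)
                    (x y : Vector Carrier m) : Set (c ⊔ ℓ₁) where
    field
      x∈P     : x ∈ P
      y∈Q     : y ∈ Q
      x-unit  : ⟨ x , x ⟩ ≈ 1#
      y-unit  : ⟨ y , y ⟩ ≈ 1#
      x-ortho : ∀ l → l <ᶠ j → ⟨ x , p l ⟩ ≈ 0#
      y-ortho : ∀ l → l <ᶠ j → ⟨ y , q l ⟩ ≈ 0#

  record ArePrincipalVectors {m n} (P Q : Subset m)
                             (p q : Vector (Vector Carrier m) n)
                             : Set (c ⊔ ℓ₁ ⊔ ℓ₃) where
    field
      admissible : ∀ j → Admissible P Q p q j (p j) (q j)
      maximal    : ∀ j x y → Admissible P Q p q j x y →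
                   ⟨ x , y ⟩ ≤ ⟨ p j , q j ⟩

  -- The angles enter only through cos θⱼ = ⟨ pⱼ , qⱼ ⟩, and
  -- sin² θⱼ = 1 - cos² θⱼ.  Principal vectors are not unique, but the
  -- principal angles are.
  IsDistance : ∀ {m} n (P Q : Subset m) → Carrier → Set (c ⊔ ℓ₁ ⊔ ℓ₃)
  IsDistance {m} n P Q δ =
    Σ[ p ∈ Vector (Vector Carrier m) n ] Σ[ q ∈ Vector (Vector Carrier m) n ]
      ArePrincipalVectors P Q p q ×
      (δ ≈ √ (sum (λ j → 1# - ⟨ p j , q j ⟩ * ⟨ p j , q j ⟩)))

  record IsPacking {a} (m n N : ℕ) (𝒫 : Pred (Subset m) a)
                   : Set (c ⊔ lsuc ℓ₁ ⊔ a) where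
    field
      planes     : ∀ W → W ∈ 𝒫 → W ∈ G m n
      enum       : Fin N → Subset m
      enum∈𝒫     : ∀ a → enum a ∈ 𝒫
      distinct   : ∀ a b → enum a ≐ enum b → a ≡ b
      exhaustive : ∀ W → W ∈ 𝒫 → ∃[ a ] W ≐ enum a

  record HasMinimalDistance {a} (m n : ℕ) (𝒫 : Pred (Subset m) a) (d : Carrier)
                            : Set (c ⊔ lsuc ℓ₁ ⊔ ℓ₃ ⊔ a) where
    field
      lowerBound : ∀ P Q → P ∈ 𝒫 → Q ∈ 𝒫 → ¬ P ≐ Q →
                   ∀ δ → IsDistance n P Q δ → d ≤ δ
      attained   : Σ[ P ∈ Subset m ] Σ[ Q ∈ Subset m ]
                   P ∈ 𝒫 × Q ∈ 𝒫 × ¬ P ≐ Q × IsDistance n P Q d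

------------------------------------------------------------------------
-- The 𝔽₂-space U = 𝔽₂ⁱ, with 𝔽₂ = (Bool, xor, ∧)

U : ℕ → Set
U i = Vec Bool i

infixl 6 _⊕_
_⊕_ : ∀ {i} → U i → U i → U i
_⊕_ = zipWith _xor_

𝟎 : ∀ {i} → U i
𝟎 = replicate _ false

infix 8 _·_
_·_ : ∀ {i} → U i → U i → Bool
[]      · []      = false
(x ∷ a) · (y ∷ b) = (x ∧ y) xor (a · b)

⊕-self : ∀ {i} (a : U i) → a ⊕ a ≡ 𝟎
⊕-self []      = refl
⊕-self (x ∷ a) = cong₂ _∷_ (xor-same x) (⊕-self a)

⊕-assoc : ∀ {i} (a b c : U i) → (a ⊕ b) ⊕ c ≡ a ⊕ (b ⊕ c)
⊕-assoc = zipWith-assoc xor-assoc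

private
  interchange : ∀ w x y z → (w xor x) xor (y xor z) ≡ (w xor y) xor (x xor z)
  interchange = Xor.solve 4
    (λ w x y z → ((w Xor.⊕ x) Xor.⊕ (y Xor.⊕ z)) Xor.⊜ ((w Xor.⊕ y) Xor.⊕ (x Xor.⊕ z))) refl

·-distribˡ-⊕ : ∀ {i} (a b c : U i) → a · (b ⊕ c) ≡ (a · b) xor (a · c)
·-distribˡ-⊕ []      []      []      = refl
·-distribˡ-⊕ (x ∷ a) (y ∷ b) (z ∷ c) = ≡.trans
  (cong₂ _xor_ (∧-distribˡ-xor x y z) (·-distribˡ-⊕ a b c))
  (interchange (x ∧ y) (x ∧ z) (a · b) (a · c))

·-distribʳ-⊕ : ∀ {i} (a b c : U i) → (b ⊕ c) · a ≡ (b · a) xor (c · a)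
·-distribʳ-⊕ []      []      []      = refl
·-distribʳ-⊕ (x ∷ a) (y ∷ b) (z ∷ c) = ≡.trans
  (cong₂ _xor_ (∧-distribʳ-xor x y z) (·-distribʳ-⊕ a b c))
  (interchange (y ∧ x) (z ∧ x) (b · a) (c · a))

𝔽₂ : RawRing 0ℓ 0ℓ
𝔽₂ = CommutativeRing.rawRing xor-∧-commutativeRing

U-module : ℕ → RawLeftModule Bool 0ℓ 0ℓ
U-module i = record
  { Carrierᴹ = U i
  ; _≈ᴹ_     = _≡_
  ; _+ᴹ_     = _⊕_
  ; _*ₗ_     = λ t → map (t ∧_)
  ; 0ᴹ       = 𝟎
  ; -ᴹ_      = λ a → a
  }

-- The numbering of the basis (e_u) of V = ℝ^(2^i).
U↔Fin : ∀ i → U i ↔ Fin (2 ℕ.^ i)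
U↔Fin zero    = mk↔ₛ′ (λ _ → Fin.zero) (λ _ → []) (λ { Fin.zero → refl ; (Fin.suc ()) }) (λ { [] → refl })
U↔Fin (suc i) = ↔-trans uncons (↔-trans (↔-sym 2↔Bool ×-↔ U↔Fin i) (↔-sym *↔×))
  where
  uncons : U (suc i) ↔ (Bool × U i)
  uncons = mk↔ₛ′ (λ { (x ∷ a) → x , a }) (λ (x , a) → x ∷ a)
                 (λ _ → refl) (λ { (x ∷ a) → refl })

index : ∀ {i} → U i → Fin (2 ℕ.^ i)
index = Inverse.to (U↔Fin _)

label : ∀ {i} → Fin (2 ℕ.^ i) → U i
label = Inverse.from (U↔Fin _)

label-index : ∀ {i} (u : U i) → label (index u) ≡ u
label-index u = Inverse.strictlyInverseʳ (U↔Fin _) u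

------------------------------------------------------------------------
-- The group E and the orthogonal space Ē

infix 9 -1^_
-1^_ : Bool → Sign
-1^ false = Sign.+
-1^ true  = Sign.-

-1^-xor : ∀ x y → -1^ (x xor y) ≡ -1^ x Sign.* -1^ y
-1^-xor false y     = refl
-1^-xor true  false = refl
-1^-xor true  true  = refl

exponent : Sign → Bool
exponent Sign.+ = false
exponent Sign.- = true

-- The triple (s , a , b) stands for the operator s X(a) Y(b), see act below.
record E (i : ℕ) : Set where
  constructor ⟪_,_,_⟫
  field
    sign : Sign
    a b  : U i

-I : ∀ {i} → E i
-I = ⟪ Sign.- , 𝟎 , 𝟎 ⟫

-- Y(b) X(a′) = (-1)^(b·a′) X(a′) Y(b); compare act-∙ below.
infixl 7 _∙_
_∙_ : ∀ {i} → E i → E i → E i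
⟪ s , a , b ⟫ ∙ ⟪ s′ , a′ , b′ ⟫ =
  ⟪ -1^ (b · a′) Sign.* (s Sign.* s′) , a ⊕ a′ , b ⊕ b′ ⟫

-- The quotient E / {±I}: bar identifies exactly g and -g.
Ē-module : ℕ → RawLeftModule Bool 0ℓ 0ℓ
Ē-module i = rawLeftModule (U-module i) (U-module i)

Ē : ℕ → Set
Ē i = RawLeftModule.Carrierᴹ (Ē-module i)

bar : ∀ {i} → E i → Ē i
bar ⟪ _ , a , b ⟫ = a , b

-- 0 if g² = I and 1 if g² = -I, for the preimage g = X(a)Y(b) of (a , b);
-- by square below, every preimage gives the same value.
Q : ∀ {i} → Ē i → Bool
Q (a , b) = exponent (E.sign (⟪ Sign.+ , a , b ⟫ ∙ ⟪ Sign.+ , a , b ⟫))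

square : ∀ {i} (g : E i) → g ∙ g ≡ ⟪ -1^ Q (bar g) , 𝟎 , 𝟎 ⟫
square ⟪ s , a , b ⟫ = ≡.trans
  (cong₂ (λ t c → ⟪ t , c , b ⊕ b ⟫) (signs s (b · a)) (⊕-self a))
  (cong (λ c → ⟪ -1^ Q (a , b) , 𝟎 , c ⟫) (⊕-self b))
  where
  signs : ∀ s x → -1^ x Sign.* (s Sign.* s) ≡ -1^ exponent (-1^ x Sign.* Sign.+)
  signs Sign.+ false = refl
  signs Sign.+ true  = refl
  signs Sign.- false = refl
  signs Sign.- true  = refl

TotallySingular : ∀ {i} → Pred (Ē i) 0ℓ → Set
TotallySingular S̄ = ∀ x → x ∈ S̄ → Q x ≡ false

preimage : ∀ {i} → Pred (Ē i) 0ℓ → Pred (E i) 0ℓ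
preimage S̄ g = bar g ∈ S̄

-- A character χ : S → {±1} with χ(-I) = -1.
record Character {i} (S : Pred (E i) 0ℓ) : Set where
  field
    χ     : ∀ g → g ∈ S → Sign
    homo  : ∀ g h (g∈S : g ∈ S) (h∈S : h ∈ S) (gh∈S : g ∙ h ∈ S) →
            χ (g ∙ h) gh∈S ≡ χ g g∈S Sign.* χ h h∈S
    χ[-I] : (-I∈S : -I ∈ S) → χ -I -I∈S ≡ Sign.-

------------------------------------------------------------------------
-- The action of E on V = ℝ^(2^i) and the invariant subspaces

module _ {c ℓ₁ ℓ₂ ℓ₃} (ℝ : RealField c ℓ₁ ℓ₂ ℓ₃) where

  open RealField ℝ

  private
    module R = CommutativeRing commutativeRing
    open import Relation.Binary.Reasoning.Setoid R.setoid

    signed-cong : ∀ s {x y} → x ≈ y → signed s x ≈ signed s y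
    signed-cong Sign.+ x≈y = x≈y
    signed-cong Sign.- x≈y = R.-‿cong x≈y

    signed-* : ∀ s t x → signed (s Sign.* t) x ≈ signed s (signed t x)
    signed-* Sign.+ t      x = R.refl
    signed-* Sign.- Sign.+ x = R.refl
    signed-* Sign.- Sign.- x = R.sym (RingProperties.-‿involutive ring x)

  V : ℕ → Set c
  V i = Vector Carrier (2 ℕ.^ i)

  -- X(a) : e_u ↦ e_(u+a), hence the coordinate of X(a)v at u is that of v
  -- at u - a = u + a.
  X : ∀ {i} → U i → V i → V i
  X a v p = v (index (label p ⊕ a))

  Y : ∀ {i} → U i → V i → V i
  Y b v p = signed (-1^ (b · label p)) (v p)

  act : ∀ {i} → E i → V i → V i
  act ⟪ s , a , b ⟫ v p = signed s (X a (Y b v) p)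

  act-∙ : ∀ {i} (g h : E i) v p → act (g ∙ h) v p ≈ act g (act h v) p
  act-∙ ⟪ s , a , b ⟫ ⟪ s′ , a′ , b′ ⟫ v p
    rewrite label-index (label p ⊕ (a ⊕ a′)) | label-index (label p ⊕ a)
          | label-index ((label p ⊕ a) ⊕ a′) | ⊕-assoc (label p) a a′ = R.sym (begin
    signed s (signed (-1^ β) (signed s′ (signed (-1^ γ) x)))
      ≈⟨ signed-cong s (signed-cong (-1^ β) (signed-* s′ (-1^ γ) x)) ⟨
    signed s (signed (-1^ β) (signed (s′ Sign.* -1^ γ) x))
      ≈⟨ signed-cong s (signed-* (-1^ β) (s′ Sign.* -1^ γ) x) ⟨
    signed s (signed (-1^ β Sign.* (s′ Sign.* -1^ γ)) x)
      ≈⟨ signed-* s (-1^ β Sign.* (s′ Sign.* -1^ γ)) x ⟨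
    signed (s Sign.* (-1^ β Sign.* (s′ Sign.* -1^ γ))) x
      ≡⟨ cong (λ t → signed t x) signs ⟨
    signed ((-1^ (b · a′) Sign.* (s Sign.* s′)) Sign.* -1^ ((b ⊕ b′) · w)) x
      ≈⟨ signed-* (-1^ (b · a′) Sign.* (s Sign.* s′)) (-1^ ((b ⊕ b′) · w)) x ⟩
    signed (-1^ (b · a′) Sign.* (s Sign.* s′)) (signed (-1^ ((b ⊕ b′) · w)) x) ∎)
    where
    w = label p ⊕ (a ⊕ a′)
    x = v (index w)
    β = b · (label p ⊕ a)
    γ = b′ · w

    b·w : b · w ≡ β xor (b · a′)
    b·w = ≡.trans (cong (b ·_) (≡.sym (⊕-assoc (label p) a a′)))
                  (·-distribˡ-⊕ b (label p ⊕ a) a′)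

    signs : (-1^ (b · a′) Sign.* (s Sign.* s′)) Sign.* -1^ ((b ⊕ b′) · w)
            ≡ s Sign.* (-1^ β Sign.* (s′ Sign.* -1^ γ))
    signs = let A = -1^ (b · a′) in ≡.trans
      (cong ((A Sign.* (s Sign.* s′)) Sign.*_)
        (≡.trans (cong -1^_ (≡.trans (·-distribʳ-⊕ w b b′) (cong (_xor γ) b·w)))
          (≡.trans (-1^-xor (β xor (b · a′)) γ) (cong (Sign._* -1^ γ) (-1^-xor β (b · a′))))))
      (≡.trans
        (Signs.solve 5 (λ A s s′ B C →
          ((A Signs.⊕ (s Signs.⊕ s′)) Signs.⊕ ((B Signs.⊕ A) Signs.⊕ C)) Signs.⊜
          ((A Signs.⊕ A) Signs.⊕ (s Signs.⊕ (B Signs.⊕ (s′ Signs.⊕ C))))) ≡.refl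
          A s s′ (-1^ β) (-1^ γ))
        (cong (Sign._* (s Sign.* (-1^ β Sign.* (s′ Sign.* -1^ γ)))) (Sign.s*s≡+ A)))

  eigenspace : ∀ {i} {S : Pred (E i) 0ℓ} → Character S → Subset ℝ (2 ℕ.^ i)
  eigenspace χ v = ∀ g g∈S p → act g v p ≈ signed (Character.χ χ g g∈S) (v p)

  -- The set of all invariant subspaces of the preimages of all
  -- r-dimensional totally singular subspaces of Ē.
  InvariantSubspace : (i r : ℕ) → Pred (Subset ℝ (2 ℕ.^ i)) (lsuc 0ℓ ⊔ c ⊔ ℓ₁)
  InvariantSubspace i r W =
    Σ[ S̄ ∈ Pred (Ē i) 0ℓ ]
      IsSubspace S̄ × HasDimension S̄ r × TotallySingular S̄ ×
      Σ[ χ ∈ Character (preimage S̄) ] W ≐ eigenspace χ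
    where open Linear 𝔽₂ (Ē-module i)

------------------------------------------------------------------------
-- The number of planes

factors : ℕ → ℕ → ℕ
factors i k = product (applyUpTo (λ j → 2 ℕ.^ (i ∸ j) ∸ 1) k)

factors-nonZero : ∀ k → NonZero (factors k k)
factors-nonZero k = product≢0 (All.applyUpTo⁺₁ _ k λ {j} j<k →
  >-nonZero (ℕ.m<n⇒0<n∸m (ℕ.^-monoʳ-< 2 (ℕ.s≤s (ℕ.s≤s ℕ.z≤n)) (ℕ.m<n⇒0<n∸m j<k))))

-- The division is exact.
gaussianBinomial : ℕ → ℕ → ℕ
gaussianBinomial i k = _/_ (factors i k) (factors k k) {{factors-nonZero k}}

packingSize : ℕ → ℕ → ℕ
packingSize i k = 2 ℕ.^ (i ∸ k) ℕ.* gaussianBinomial i k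
  ℕ.* product (applyUpTo (λ t → 2 ℕ.^ (k ℕ.+ t) ℕ.+ 1) (i ∸ k))

module Submission where

open import Defs
open import Algebra.Bundles using (CommutativeRing)
import Algebra.Properties.Ring as RingProperties
import Algebra.Properties.Semiring.Sum as SemiringSum
import Algebra.Solver.Ring.NaturalCoefficients.Default as NaturalSolver
open import Data.Bool.Base using (Bool; true; false; not; _∧_; _xor_; if_then_else_)
open import Data.Bool.Properties using (xor-same; xor-comm; xor-assoc; xor-identityʳ; ∧-comm; ∧-zeroʳ) renaming (_≟_ to _≟ᵇ_)
open import Data.Bool.Solver using (module xor-∧-Solver)
open import Data.Empty using (⊥; ⊥-elim)
open import Data.Fin.Base using (Fin; zero; suc; _↑ˡ_; _↑ʳ_) renaming (_<_ to _<ᶠ_)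
open import Data.Fin.Permutation using (Permutation; permutation; _⟨$⟩ʳ_)
import Data.Fin.Properties as Fin
open import Data.Fin.Properties using (+↔⊎; *↔×; 1↔⊤)
open import Data.List.Base using (applyUpTo)
open import Data.Nat.Base as ℕ using (ℕ; zero; suc; s≤s; z≤n)
open import Data.Nat.DivMod using (m*n/n≡m; /-congˡ)
open import Data.Nat.ListAction using (product)
import Data.Nat.Properties as ℕ
open import Data.Nat.Solver using (module +-*-Solver)
open import Data.Product.Base using (∃; ∃₂; _×_; _,_; proj₁; proj₂)
open import Data.Product.Function.NonDependent.Propositional using (_×-↔_)
open import Data.Product.Properties using () renaming (≡-dec to ×-≡-dec)
open import Data.Sign.Base as Sign using (Sign)
import Data.Sign.Properties as Sign
open import Data.Sum.Base using (_⊎_; inj₁; inj₂; [_,_]′)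
open import Data.Sum.Function.Propositional using (_⊎-↔_)
open import Data.Vec.Base using ([]; _∷_; map; tabulate; lookup)
open import Data.Vec.Functional using (Vector)
open import Data.Vec.Properties using
  ( ≡-dec; zipWith-comm; zipWith-identityˡ; zipWith-identityʳ; map-id; map-const
  ; lookup∘tabulate; tabulate∘lookup; tabulate-cong; lookup-replicate )
open import Function.Base using (_∘_; case_of_)
open import Function.Bundles using (_↔_; mk↔ₛ′; Inverse)
open import Function.Properties.Inverse using (↔-sym; ↔-trans)
open import Level using (0ℓ)
open import Relation.Binary.Definitions using (tri<; tri≈; tri>)
open import Relation.Binary.PropositionalEquality as ≡ using (_≡_; _≢_; refl; sym; trans; cong; cong₂; subst; module ≡-Reasoning)
open import Relation.Binary.Structures using (IsStrictPartialOrder)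
open import Relation.Nullary using (¬_; Dec; yes; no)
open import Relation.Nullary.Decidable using (map′; ¬?; decidable-stable; _⊎-dec_)
open import Relation.Unary using (Pred; Decidable; _≐_; _∈_)

-- Ē (i - 1) is e⊥/e for the singular vector e = Y(1,0,…,0), so the totally
-- singular subspaces S of Ē i, and likewise the eigenspaces, can be described by
-- recursion on i: if e ∈ S, the eigenspace lies in one half of V; if e ∉ S ⊆ e⊥, it
-- is the direct sum of two eigenspaces of the image T of S in e⊥/e; if S ⊈ e⊥, it
-- is the graph of an operator ± X(a)Y(b) on an eigenspace of T.  Counting the
-- choices gives the Gaussian Pascal rule, hence N, and the three constructions
-- carry an orthonormal basis along.
--
-- For the distances, the operators X(a)Y(b) are mutually orthogonal for the
-- Hilbert-Schmidt product.  Hence for any orthonormal family (p_j) of 2^k vectors of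
-- the eigenspace P of (S , χ), the matrix Σ p_j p_jᵀ is the projection
-- 2^(-r) Σ χ(s) s, and Σ ⟨ p_j , g p_j ⟩ = 0 for every g outside S.  If
-- g = ± 1 on a second plane with orthonormal family (q_j), then
-- ⟨ p_j , q_j ⟩² ≤ |(p_j ± g p_j) / 2|² = (1 ± ⟨ p_j , g p_j ⟩) / 2, and so
-- Σ cos² θ_j ≤ 2^(k-1).  Planes with the same S and different χ are orthogonal.

-- The scalars satisfy constructive axioms and a subspace is a bare predicate, so ranks and
-- orthogonal complements are not at hand. On the side of Ē, normal forms replace them: codes are
-- counted by a bijection with `Fin`, not by dividing group orders, and the case distinction on e is
-- decided by searching the finitely many combinations of a basis. On the real side no dimensions
-- are compared: two matrices A, B with ⟨A,A⟩ = ⟨A,B⟩ = ⟨B,B⟩ are equal, and this yields the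
-- projection from any orthonormal family of 2^k members, because 2^i = 2^r 2^k. Completeness of the
-- family follows from the same equation.
--
-- The weights in the count come from the freedom in lifting T. A linear form on T can be chosen in
-- 2^r ways. The part w of a vector outside e⊥ may be any coset of T, with no condition relating it
-- to T: its coordinate along e is then forced by singularity, and the coordinates of the lifts of T
-- are forced by orthogonality. A subspace of rank r in Ē i has 2^(2i-r) = 2^(i+k) cosets.

-- Arithmetic of U and of the quadratic space Ē.

⊕-comm : ∀ {i} (a b : U i) → a ⊕ b ≡ b ⊕ a
⊕-comm = zipWith-comm xor-comm

⊕-identityˡ : ∀ {i} (a : U i) → 𝟎 ⊕ a ≡ a
⊕-identityˡ = zipWith-identityˡ (λ _ → refl)

⊕-identityʳ : ∀ {i} (a : U i) → a ⊕ 𝟎 ≡ a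
⊕-identityʳ = zipWith-identityʳ xor-identityʳ

⊕-cancel : ∀ {i} (a b : U i) → a ⊕ (a ⊕ b) ≡ b
⊕-cancel a b = trans (sym (⊕-assoc a a b)) (trans (cong (_⊕ b) (⊕-self a)) (⊕-identityˡ b))

·-comm : ∀ {i} (a b : U i) → a · b ≡ b · a
·-comm []      []      = refl
·-comm (x ∷ a) (y ∷ b) = cong₂ _xor_ (∧-comm x y) (·-comm a b)

·-zeroˡ : ∀ {i} (a : U i) → 𝟎 · a ≡ false
·-zeroˡ []      = refl
·-zeroˡ (x ∷ a) = ·-zeroˡ a

·-zeroʳ : ∀ {i} (a : U i) → a · 𝟎 ≡ false
·-zeroʳ a = trans (·-comm a 𝟎) (·-zeroˡ a)

infixl 6 _⊞_
_⊞_ : ∀ {i} → Ē i → Ē i → Ē i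
(a , b) ⊞ (a′ , b′) = a ⊕ a′ , b ⊕ b′

𝟘 : ∀ {i} → Ē i
𝟘 = 𝟎 , 𝟎

⊞-assoc : ∀ {i} (x y z : Ē i) → (x ⊞ y) ⊞ z ≡ x ⊞ (y ⊞ z)
⊞-assoc (a , b) (a′ , b′) (a″ , b″) = cong₂ _,_ (⊕-assoc a a′ a″) (⊕-assoc b b′ b″)

⊞-comm : ∀ {i} (x y : Ē i) → x ⊞ y ≡ y ⊞ x
⊞-comm (a , b) (a′ , b′) = cong₂ _,_ (⊕-comm a a′) (⊕-comm b b′)

⊞-identityˡ : ∀ {i} (x : Ē i) → 𝟘 ⊞ x ≡ x
⊞-identityˡ (a , b) = cong₂ _,_ (⊕-identityˡ a) (⊕-identityˡ b)

⊞-identityʳ : ∀ {i} (x : Ē i) → x ⊞ 𝟘 ≡ x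
⊞-identityʳ x = trans (⊞-comm x 𝟘) (⊞-identityˡ x)

⊞-self : ∀ {i} (x : Ē i) → x ⊞ x ≡ 𝟘
⊞-self (a , b) = cong₂ _,_ (⊕-self a) (⊕-self b)

⊞-cancel : ∀ {i} (x y : Ē i) → x ⊞ (x ⊞ y) ≡ y
⊞-cancel (a , b) (a′ , b′) = cong₂ _,_ (⊕-cancel a a′) (⊕-cancel b b′)

⊞-interchange : ∀ {i} (w x y z : Ē i) → (w ⊞ x) ⊞ (y ⊞ z) ≡ (w ⊞ y) ⊞ (x ⊞ z)
⊞-interchange w x y z = begin
  (w ⊞ x) ⊞ (y ⊞ z)  ≡⟨ ⊞-assoc w x (y ⊞ z) ⟩
  w ⊞ (x ⊞ (y ⊞ z))  ≡⟨ cong (w ⊞_) (⊞-assoc x y z) ⟨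
  w ⊞ ((x ⊞ y) ⊞ z)  ≡⟨ cong (λ t → w ⊞ (t ⊞ z)) (⊞-comm x y) ⟩
  w ⊞ ((y ⊞ x) ⊞ z)  ≡⟨ cong (w ⊞_) (⊞-assoc y x z) ⟩
  w ⊞ (y ⊞ (x ⊞ z))  ≡⟨ ⊞-assoc w y (x ⊞ z) ⟨
  (w ⊞ y) ⊞ (x ⊞ z)  ∎
  where open ≡-Reasoning

-- The form `Q` without its detour through signs, so that identities become polynomial identities
-- over 𝔽₂.
q : ∀ {i} → Ē i → Bool
q (a , b) = b · a

-- The polar form of `q`. It is `true` exactly when the two operators anticommute.
ω : ∀ {i} → Ē i → Ē i → Bool
ω (a , b) (a′ , b′) = (b · a′) xor (b′ · a)

Q≡q : ∀ {i} (x : Ē i) → Q x ≡ q x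
Q≡q (a , b) with b · a
... | false = refl
... | true  = refl

private
  ·-bilinear : ∀ {i} (a a′ b b′ : U i) →
    (b ⊕ b′) · (a ⊕ a′) ≡ ((b · a) xor (b · a′)) xor ((b′ · a) xor (b′ · a′))
  ·-bilinear a a′ b b′ = trans (·-distribʳ-⊕ (a ⊕ a′) b b′)
    (cong₂ _xor_ (·-distribˡ-⊕ b a a′) (·-distribˡ-⊕ b′ a a′))

q-⊞ : ∀ {i} (x y : Ē i) → q (x ⊞ y) ≡ (q x xor q y) xor ω x y
q-⊞ (a , b) (a′ , b′) = trans (·-bilinear a a′ b b′)
  (solve 4 (λ p r s t → (p :+ r) :+ (s :+ t) := (p :+ t) :+ (r :+ s)) refl
    (b · a) (b · a′) (b′ · a) (b′ · a′))
  where open xor-∧-Solver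

ω-⊞ : ∀ {i} (w x y : Ē i) → ω w (x ⊞ y) ≡ ω w x xor ω w y
ω-⊞ (a , b) (a₁ , b₁) (a₂ , b₂) = trans
  (cong₂ _xor_ (·-distribˡ-⊕ b a₁ a₂) (·-distribʳ-⊕ a b₁ b₂))
  (solve 4 (λ p r s t → (p :+ r) :+ (s :+ t) := (p :+ s) :+ (r :+ t)) refl
    (b · a₁) (b · a₂) (b₁ · a) (b₂ · a))
  where open xor-∧-Solver

ω-𝟘 : ∀ {i} (w : Ē i) → ω w 𝟘 ≡ false
ω-𝟘 (a , b) = cong₂ _xor_ (·-zeroʳ b) (·-zeroˡ a)

-- Relative to e = `cons false true 𝟘`, the first bit is the pairing with e, so `false` means
-- membership in e⊥, and the second bit is the coordinate along e, called the height below.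
cons : ∀ {i} → Bool → Bool → Ē i → Ē (suc i)
cons x y (a , b) = x ∷ a , y ∷ b

cons-injective : ∀ {i x x′ y y′} {z z′ : Ē i} → cons x y z ≡ cons x′ y′ z′ → x ≡ x′ × y ≡ y′ × z ≡ z′
cons-injective refl = refl , refl , refl

cons-cong : ∀ {i x x′ y y′} {z z′ : Ē i} → x ≡ x′ → y ≡ y′ → z ≡ z′ → cons x y z ≡ cons x′ y′ z′
cons-cong refl refl refl = refl

-- Codes of totally singular subspaces.

-- Normal forms of the r-dimensional totally singular subspaces S of Ē i, by
-- the position of S relative to the singular vector e = Y(1,0,…,0): either
-- e ∈ S, or e ∉ S ⊆ e⊥, or S ⊈ e⊥.  In each case S is determined by its image
-- T in e⊥/e ≅ Ē (i - 1) together with, in the second case, a linear form on T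
-- and, in the third case, an element w of a complement of T.
data Code : ℕ → ℕ → ℕ → Set where
  []    : Code 0 0 0
  axis  : ∀ {i r k} → Code i r k → Code (suc i) (suc r) k
  twist : ∀ {i r k} → U r → Code i r k → Code (suc i) r (suc k)
  tilt  : ∀ {i r k} → U i → U k → Code i r k → Code (suc i) (suc r) k

-- Representatives of the cosets of the span. The quotient has dimension 2i - r = i + k, whence the
-- two arguments. For `axis` the vector e clears the second bit, for `tilt` the lift of w clears the
-- first, so these bits stay `false`.
complement : ∀ {i r k} → Code i r k → U i → U k → Ē i
complement []           []      []      = 𝟘
complement (axis c)     (x ∷ m) n       = cons x false (complement c m n)
complement (twist _ c)  (x ∷ m) (y ∷ n) = cons x y (complement c m n)
complement (tilt _ _ c) (y ∷ m) n       = cons false y (complement c m n)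

-- In the `tilt` clauses the heights are forced: `q w` makes the lift of w singular, and `ω w s`
-- makes the lift of an element s of T orthogonal to it.
span : ∀ {i r k} → Code i r k → U r → Ē i
span []           []          = 𝟘
span (axis c)     (τ ∷ t)     = cons false τ (span c t)
span (twist f c)  t           = cons false (f · t) (span c t)
span (tilt m n c) (false ∷ t) = cons false (ω (complement c m n) (span c t)) (span c t)
span (tilt m n c) (true ∷ t)  =
  let w = complement c m n in cons true (q w xor ω w (span c t)) (w ⊞ span c t)

-- The sign that makes gen below a homomorphism U r → E i.
σ : ∀ {i r k} → Code i r k → U r → Bool
σ []           []          = false
σ (axis c)     (τ ∷ t)     = σ c t
σ (twist _ c)  t           = σ c t
σ (tilt m n c) (false ∷ t) = σ c t
σ (tilt m n c) (true ∷ t)  = (proj₂ (complement c m n) · proj₁ (span c t)) xor σ c t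

gen : ∀ {i r k} → Code i r k → U r → E i
gen c t = ⟪ -1^ σ c t , proj₁ (span c t) , proj₂ (span c t) ⟫

span-⊕ : ∀ {i r k} (c : Code i r k) t t′ → span c (t ⊕ t′) ≡ span c t ⊞ span c t′
span-⊕ []           []          []           = refl
span-⊕ (axis c)     (τ ∷ t)     (τ′ ∷ t′)    = cong (cons false (τ xor τ′)) (span-⊕ c t t′)
span-⊕ (twist f c)  t           t′           =
  cons-cong refl (·-distribˡ-⊕ f t t′) (span-⊕ c t t′)
span-⊕ (tilt m n c) (τ ∷ t)     (τ′ ∷ t′)    = go τ τ′
  where
  w = complement c m n
  s = span c t
  s′ = span c t′
  S = span-⊕ c t t′
  Ω : ω w (span c (t ⊕ t′)) ≡ ω w s xor ω w s′
  Ω = trans (cong (ω w) S) (ω-⊞ w s s′)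
  open xor-∧-Solver
  go : ∀ τ τ′ → span (tilt m n c) ((τ ∷ t) ⊕ (τ′ ∷ t′))
              ≡ span (tilt m n c) (τ ∷ t) ⊞ span (tilt m n c) (τ′ ∷ t′)
  go false false = cons-cong refl Ω S
  go false true  = cons-cong refl
    (trans (cong (q w xor_) Ω)
      (solve 3 (λ Q x y → Q :+ (x :+ y) := x :+ (Q :+ y)) refl (q w) (ω w s) (ω w s′)))
    (trans (cong (w ⊞_) S) (trans (sym (⊞-assoc w s s′))
      (trans (cong (_⊞ s′) (⊞-comm w s)) (⊞-assoc s w s′))))
  go true false  = cons-cong refl
    (trans (cong (q w xor_) Ω) (sym (xor-assoc (q w) (ω w s) (ω w s′))))
    (trans (cong (w ⊞_) S) (sym (⊞-assoc w s s′)))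
  go true true   = cons-cong refl
    (trans Ω (solve 3 (λ Q x y → x :+ y := (Q :+ x) :+ (Q :+ y)) refl (q w) (ω w s) (ω w s′)))
    (trans S (trans (sym (trans (cong (_⊞ (s ⊞ s′)) (⊞-self w)) (⊞-identityˡ _)))
      (⊞-interchange w w s s′)))

-- The product b · a′ is the cocycle of the multiplication `_∙_`, and σ trivialises it on the span.
-- In the `tilt` clause of σ, the extra summand is the cocycle of multiplying the lift of w by the
-- lift of an element of T.
σ-⊕ : ∀ {i r k} (c : Code i r k) t t′ →
      σ c (t ⊕ t′) ≡ (proj₂ (span c t) · proj₁ (span c t′)) xor (σ c t xor σ c t′)
σ-⊕ []           []       []        = refl
σ-⊕ (axis c)     (τ ∷ t)  (τ′ ∷ t′) = trans (σ-⊕ c t t′)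
  (cong (λ z → (z xor _) xor (σ c t xor σ c t′)) (sym (∧-zeroʳ τ)))
σ-⊕ (twist f c)  t        t′        = trans (σ-⊕ c t t′)
  (cong (λ z → (z xor _) xor (σ c t xor σ c t′)) (sym (∧-zeroʳ (f · t))))
σ-⊕ (tilt m n c) (τ ∷ t)  (τ′ ∷ t′) = go τ τ′
  where
  w = complement c m n
  wa = proj₁ w
  wb = proj₂ w
  a = proj₁ (span c t)
  b = proj₂ (span c t)
  a′ = proj₁ (span c t′)
  b′ = proj₂ (span c t′)
  H = σ-⊕ c t t′
  P : wb · proj₁ (span c (t ⊕ t′)) ≡ (wb · a) xor (wb · a′)
  P = trans (cong (λ z → wb · proj₁ z) (span-⊕ c t t′)) (·-distribˡ-⊕ wb a a′)
  open xor-∧-Solver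
  go : ∀ τ τ′ → σ (tilt m n c) ((τ ∷ t) ⊕ (τ′ ∷ t′))
              ≡ (proj₂ (span (tilt m n c) (τ ∷ t)) · proj₁ (span (tilt m n c) (τ′ ∷ t′)))
                xor (σ (tilt m n c) (τ ∷ t) xor σ (tilt m n c) (τ′ ∷ t′))
  go false false = trans H
    (cong (λ z → (z xor (b · a′)) xor (σ c t xor σ c t′)) (sym (∧-zeroʳ (ω w (span c t)))))
  go false true  = trans (cong₂ _xor_ P H) (sym (trans
    (cong (λ z → ((ω w (span c t) ∧ true) xor z) xor (σ c t xor ((wb · a′) xor σ c t′)))
      (·-distribˡ-⊕ b wa a′))
    (solve 6 (λ wba bwa bwa' ba' s s' →
        (((wba :+ bwa) :* con true) :+ (bwa :+ ba')) :+ (s :+ (bwa' :+ s'))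
        := (wba :+ bwa') :+ (ba' :+ (s :+ s'))) refl
      (wb · a) (b · wa) (wb · a′) (b · a′) (σ c t) (σ c t′))))
  go true false  = trans (cong₂ _xor_ P H) (sym (trans
    (cong₂ (λ y z → (y xor z) xor (((wb · a) xor σ c t) xor σ c t′))
      (∧-zeroʳ (q w xor ω w (span c t))) (·-distribʳ-⊕ a′ wb b))
    (solve 5 (λ wba wba' ba' s s' →
        (wba' :+ ba') :+ ((wba :+ s) :+ s') := (wba :+ wba') :+ (ba' :+ (s :+ s'))) refl
      (wb · a) (wb · a′) (b · a′) (σ c t) (σ c t′))))
  go true true   = trans H (sym (trans
    (cong (λ z → (((q w xor ω w (span c t)) ∧ true) xor z)
                 xor (((wb · a) xor σ c t) xor ((wb · a′) xor σ c t′)))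
      (·-bilinear wa a′ wb b))
    (solve 7 (λ Q wba bwa wba' ba' s s' →
        (((Q :+ (wba :+ bwa)) :* con true) :+ ((Q :+ wba') :+ (bwa :+ ba')))
          :+ ((wba :+ s) :+ (wba' :+ s'))
        := ba' :+ (s :+ s')) refl
      (wb · wa) (wb · a) (b · wa) (wb · a′) (b · a′) (σ c t) (σ c t′))))

gen-∙ : ∀ {i r k} (c : Code i r k) t t′ → gen c t ∙ gen c t′ ≡ gen c (t ⊕ t′)
gen-∙ c t t′ rewrite σ-⊕ c t t′ | span-⊕ c t t′
  | -1^-xor (proj₂ (span c t) · proj₁ (span c t′)) (σ c t xor σ c t′) | -1^-xor (σ c t) (σ c t′) = refl

span-𝟎 : ∀ {i r k} (c : Code i r k) → span c 𝟎 ≡ 𝟘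
span-𝟎 []           = refl
span-𝟎 (axis c)     = cong (cons false false) (span-𝟎 c)
span-𝟎 (twist f c)  = cons-cong refl (·-zeroʳ f) (span-𝟎 c)
span-𝟎 (tilt m n c) =
  cons-cong refl (trans (cong (ω (complement c m n)) (span-𝟎 c)) (ω-𝟘 (complement c m n))) (span-𝟎 c)

σ-𝟎 : ∀ {i r k} (c : Code i r k) → σ c 𝟎 ≡ false
σ-𝟎 []           = refl
σ-𝟎 (axis c)     = σ-𝟎 c
σ-𝟎 (twist f c)  = σ-𝟎 c
σ-𝟎 (tilt m n c) = σ-𝟎 c

-- Take equal arguments in `σ-⊕`: the two signs cancel, and what remains says that a generator
-- squares to the identity because t ⊕ t = 𝟎.
span-singular : ∀ {i r k} (c : Code i r k) t → q (span c t) ≡ false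
span-singular c t = begin
  q (span c t)                               ≡⟨ solve 2 (λ x s → x := x :+ (s :+ s)) refl (q (span c t)) (σ c t) ⟩
  q (span c t) xor (σ c t xor σ c t)         ≡⟨ σ-⊕ c t t ⟨
  σ c (t ⊕ t)                                ≡⟨ cong (σ c) (⊕-self t) ⟩
  σ c 𝟎                                      ≡⟨ σ-𝟎 c ⟩
  false                                      ∎
  where
  open ≡-Reasoning
  open xor-∧-Solver using (solve; _:=_; _:+_)

span-injective : ∀ {i r k} (c : Code i r k) {t t′} → span c t ≡ span c t′ → t ≡ t′
span-injective []           {[]}        {[]}         e = refl
span-injective (axis c)     {τ ∷ t}     {τ′ ∷ t′}    e =
  let _ , e₁ , e₂ = cons-injective e in cong₂ _∷_ e₁ (span-injective c e₂)
span-injective (twist f c)  {t}         {t′}         e =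
  span-injective c (proj₂ (proj₂ (cons-injective e)))
span-injective (tilt m n c) {false ∷ t} {false ∷ t′} e =
  cong (false ∷_) (span-injective c (proj₂ (proj₂ (cons-injective e))))
span-injective (tilt m n c) {false ∷ t} {true ∷ t′}  ()
span-injective (tilt m n c) {true ∷ t}  {false ∷ t′} ()
span-injective (tilt m n c) {true ∷ t}  {true ∷ t′}  e =
  let w = complement c m n in cong (true ∷_) (span-injective c (begin
    span c t               ≡⟨ ⊞-cancel w (span c t) ⟨
    w ⊞ (w ⊞ span c t)     ≡⟨ cong (w ⊞_) (proj₂ (proj₂ (cons-injective e))) ⟩
    w ⊞ (w ⊞ span c t′)    ≡⟨ ⊞-cancel w (span c t′) ⟩
    span c t′              ∎))
  where open ≡-Reasoning

span≡𝟘⇒≡𝟎 : ∀ {i r k} (c : Code i r k) {t} → 𝟘 ≡ span c t → t ≡ 𝟎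
span≡𝟘⇒≡𝟎 c e = span-injective c (trans (sym e) (sym (span-𝟎 c)))

xor≡false⇒≡ : ∀ x y → x xor y ≡ false → x ≡ y
xor≡false⇒≡ false false _ = refl
xor≡false⇒≡ true  true  _ = refl

-- Together with `decompose` this makes `complement` a transversal of the span, so that the
-- parameters of `tilt` correspond exactly to the cosets of T.
complement-unique : ∀ {i r k} (c : Code i r k) {m m′ n n′} t →
  complement c m n ⊞ complement c m′ n′ ≡ span c t → m ≡ m′ × n ≡ n′
complement-unique [] {[]} {[]} {[]} {[]} t e = refl , refl
complement-unique (axis c) {x ∷ m} {x′ ∷ m′} (τ ∷ t) e =
  let e₁ , _ , e₂ = cons-injective e
      em , en = complement-unique c t e₂
  in cong₂ _∷_ (xor≡false⇒≡ x x′ e₁) em , en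
complement-unique (twist f c) {x ∷ m} {x′ ∷ m′} {y ∷ n} {y′ ∷ n′} t e
  with e₁ , e₂ , e₃ ← cons-injective e
  with refl , refl ← complement-unique c t e₃
  with refl ← span≡𝟘⇒≡𝟎 c (trans (sym (⊞-self (complement c m n))) e₃) =
  cong₂ _∷_ (xor≡false⇒≡ x x′ e₁) refl , cong₂ _∷_ (xor≡false⇒≡ y y′ (trans e₂ (·-zeroʳ f))) refl
complement-unique (tilt m₀ n₀ c) {y ∷ m} {y′ ∷ m′} {n} (false ∷ t) e
  with _ , e₂ , e₃ ← cons-injective e
  with refl , refl ← complement-unique c t e₃ =
  cong₂ _∷_ (xor≡false⇒≡ y y′ (trans e₂ (trans
    (cong (ω (complement c m₀ n₀)) (trans (sym e₃) (⊞-self (complement c m n)))) (ω-𝟘 (complement c m₀ n₀))))) refl , refl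

decompose : ∀ {i r k} (c : Code i r k) x → ∃₂ λ m n → ∃ λ t → x ≡ complement c m n ⊞ span c t
decompose [] ([] , []) = [] , [] , [] , refl
decompose (axis c) (x ∷ a , y ∷ b) =
  let m , n , t , e = decompose c (a , b)
  in x ∷ m , n , y ∷ t , cons-cong (sym (xor-identityʳ x)) refl e
decompose (twist f c) (x ∷ a , y ∷ b) =
  let m , n , t , e = decompose c (a , b)
  in x ∷ m , (y xor (f · t)) ∷ n , t , cons-cong (sym (xor-identityʳ x))
       (solve 2 (λ y z → y := (y :+ z) :+ z) refl y (f · t)) e
  where open xor-∧-Solver
decompose (tilt m₀ n₀ c) (false ∷ a , y ∷ b) =
  let m , n , t , e = decompose c (a , b)
      z = ω (complement c m₀ n₀) (span c t)
  in (y xor z) ∷ m , n , false ∷ t , cons-cong refl (solve 2 (λ y z → y := (y :+ z) :+ z) refl y z) e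
  where open xor-∧-Solver
-- Adding the lift of w clears the first bit, so the vector left to decompose is w ⊞ (a , b).
decompose (tilt m₀ n₀ c) (true ∷ a , y ∷ b) =
  let w = complement c m₀ n₀
      m , n , t , e = decompose c (w ⊞ (a , b))
      z = q w xor ω w (span c t)
  in (y xor z) ∷ m , n , true ∷ t , cons-cong refl (solve 2 (λ y z → y := (y :+ z) :+ z) refl y z)
       (begin
         a , b                                     ≡⟨ ⊞-cancel w (a , b) ⟨
         w ⊞ (w ⊞ (a , b))                         ≡⟨ cong (w ⊞_) e ⟩
         w ⊞ (complement c m n ⊞ span c t)         ≡⟨ ⊞-assoc w _ _ ⟨
         (w ⊞ complement c m n) ⊞ span c t         ≡⟨ cong (_⊞ span c t) (⊞-comm w _) ⟩
         (complement c m n ⊞ w) ⊞ span c t         ≡⟨ ⊞-assoc _ w _ ⟩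
         complement c m n ⊞ (w ⊞ span c t)         ∎)
  where
  open ≡-Reasoning
  open xor-∧-Solver using (solve; _:=_; _:+_)

-- Uniqueness of the code of a subspace.

infix 4 _⊑_
_⊑_ : ∀ {i r r′ k k′} → Code i r k → Code i r′ k′ → Set
c ⊑ c′ = ∀ t → ∃ λ t′ → span c t ≡ span c′ t′

private
  e∉twist : ∀ {i r k} (f : U r) (c : Code i r k) t → cons false true 𝟘 ≢ span (twist f c) t
  e∉twist f c t e with _ , e₂ , e₃ ← cons-injective e with refl ← span≡𝟘⇒≡𝟎 c e₃ =
    case trans e₂ (·-zeroʳ f) of λ ()

  e∉tilt : ∀ {i r k} m n (c : Code i r k) t → cons false true 𝟘 ≢ span (tilt m n c) t
  e∉tilt m n c (false ∷ t) e with _ , e₂ , e₃ ← cons-injective e =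
    case trans e₂ (trans (cong (ω (complement c m n)) (sym e₃)) (ω-𝟘 (complement c m n))) of λ ()

  e∈axis : ∀ {i r k} (c : Code i r k) → cons false true 𝟘 ≡ span (axis c) (true ∷ 𝟎)
  e∈axis c = cons-cong refl refl (sym (span-𝟎 c))

  tilt⋢twist : ∀ {i r k r′ k′} m n (c : Code i r k) f (c′ : Code i r′ k′) → ¬ tilt m n c ⊑ twist f c′
  tilt⋢twist m n c f c′ ⊑ = case proj₂ (⊑ (true ∷ 𝟎)) of λ ()

  tilt-⊑ : ∀ {i r k} m n (c : Code i r k) m′ n′ (c′ : Code i r k) → tilt m n c ⊑ tilt m′ n′ c′ → c ⊑ c′
  tilt-⊑ m n c m′ n′ c′ l t with l (false ∷ t)
  ... | (false ∷ t′) , e = t′ , proj₂ (proj₂ (cons-injective e))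
  ... | (true ∷ t′)  , ()

  tilt-≡ : ∀ {i r k} m n (c : Code i r k) m′ n′ →
           (∃ λ t′ → span (tilt m n c) (true ∷ 𝟎) ≡ span (tilt m′ n′ c) t′) → m ≡ m′ × n ≡ n′
  tilt-≡ m n c m′ n′ ((true ∷ t′) , e) = complement-unique c t′ (begin
    w ⊞ w′                         ≡⟨ cong (_⊞ w′) (⊞-identityʳ w) ⟨
    (w ⊞ 𝟘) ⊞ w′                   ≡⟨ cong (λ z → (w ⊞ z) ⊞ w′) (span-𝟎 c) ⟨
    (w ⊞ span c 𝟎) ⊞ w′            ≡⟨ cong (_⊞ w′) (proj₂ (proj₂ (cons-injective e))) ⟩
    (w′ ⊞ span c t′) ⊞ w′          ≡⟨ ⊞-comm _ w′ ⟩
    w′ ⊞ (w′ ⊞ span c t′)          ≡⟨ ⊞-cancel w′ _ ⟩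
    span c t′                      ∎)
    where
    open ≡-Reasoning
    w = complement c m n
    w′ = complement c m′ n′

·-ext : ∀ {i} (f f′ : U i) → (∀ t → f · t ≡ f′ · t) → f ≡ f′
·-ext []      []        h = refl
·-ext (x ∷ f) (x′ ∷ f′) h = cong₂ _∷_
  (trans (sym (x·1 x f)) (trans (h (true ∷ 𝟎)) (x·1 x′ f′)))
  (·-ext f f′ (λ t → trans (sym (0·t x f t)) (trans (h (false ∷ t)) (0·t x′ f′ t))))
  where
  x·1 : ∀ {i} x (f : U i) → (x ∷ f) · (true ∷ 𝟎) ≡ x
  x·1 x f = trans (cong₂ _xor_ (∧-comm x true) (·-zeroʳ f)) (xor-identityʳ x)
  0·t : ∀ {i} x (f : U i) t → (x ∷ f) · (false ∷ t) ≡ f · t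
  0·t x f t = cong (_xor (f · t)) (∧-zeroʳ x)

-- Membership of e separates `axis` from the other constructors, and a vector outside e⊥ separates
-- `tilt` from `twist`. For equal constructors both inclusions descend to T; then the heights
-- recover the linear form, and the lifts of w and w′ differ by an element over T, which recovers w.
code-unique : ∀ {i r k} (c c′ : Code i r k) → c ⊑ c′ → c′ ⊑ c → c ≡ c′
code-unique []          []            _ _  = refl
code-unique (axis c)    (axis c′)     l l′ = cong axis (code-unique c c′ (rec c c′ l) (rec c′ c l′))
  where
  rec : ∀ {i r k} (c c′ : Code i r k) → axis c ⊑ axis c′ → c ⊑ c′
  rec c c′ l t with l (false ∷ t)
  ... | (_ ∷ t′) , e = t′ , proj₂ (proj₂ (cons-injective e))
code-unique (axis c)    (twist f c′)  l _  = ⊥-elim (e∉twist f c′ _ (trans (e∈axis c) (proj₂ (l (true ∷ 𝟎)))))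
code-unique (axis c)    (tilt m n c′) l _  = ⊥-elim (e∉tilt m n c′ _ (trans (e∈axis c) (proj₂ (l (true ∷ 𝟎)))))
code-unique (twist f c) (axis c′)     _ l′ = ⊥-elim (e∉twist f c _ (trans (e∈axis c′) (proj₂ (l′ (true ∷ 𝟎)))))
code-unique (twist f c) (tilt m n c′) _ l′ = ⊥-elim (tilt⋢twist m n c′ f c l′)
code-unique (tilt m n c) (axis c′)    _ l′ = ⊥-elim (e∉tilt m n c _ (trans (e∈axis c′) (proj₂ (l′ (true ∷ 𝟎)))))
code-unique (tilt m n c) (twist f c′) l _  = ⊥-elim (tilt⋢twist m n c f c′ l)
code-unique (twist f c) (twist f′ c′) l l′
  with refl ← code-unique c c′ (λ t → proj₁ (l t) , proj₂ (proj₂ (cons-injective (proj₂ (l t)))))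
                               (λ t → proj₁ (l′ t) , proj₂ (proj₂ (cons-injective (proj₂ (l′ t))))) =
  cong (λ g → twist g c) (·-ext f f′ λ t →
    let t′ , e = l t ; _ , e₂ , e₃ = cons-injective e
    in trans e₂ (cong (f′ ·_) (sym (span-injective c e₃))))
code-unique (tilt m n c) (tilt m′ n′ c′) l l′
  with refl ← code-unique c c′ (tilt-⊑ m n c m′ n′ c′ l) (tilt-⊑ m′ n′ c′ m n c l′)
  with refl , refl ← tilt-≡ m n c m′ n′ (l (true ∷ 𝟎)) = refl

-- Existence of a code for every totally singular subspace.

dec-∃ : ∀ {i p} {P : Pred (U i) p} → Decidable P → Dec (∃ P)
dec-∃ {zero}  P? = map′ (λ p → [] , p) (λ { ([] , p) → p }) (P? [])
dec-∃ {suc i} P? = map′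
  (λ { (inj₁ (t , p)) → false ∷ t , p ; (inj₂ (t , p)) → true ∷ t , p })
  (λ { (false ∷ t , p) → inj₁ (t , p) ; (true ∷ t , p) → inj₂ (t , p) })
  (dec-∃ (λ t → P? (false ∷ t)) ⊎-dec dec-∃ (λ t → P? (true ∷ t)))

dec-∃Ē : ∀ {i p} {P : Pred (Ē i) p} → Decidable P → Dec (∃ P)
dec-∃Ē P? = map′ (λ (a , b , p) → (a , b) , p) (λ ((a , b) , p) → a , b , p)
  (dec-∃ λ a → dec-∃ λ b → P? (a , b))

additive⇒· : ∀ {r} (h : U r → Bool) → (∀ t t′ → h (t ⊕ t′) ≡ h t xor h t′) →
             ∃ λ f → ∀ t → h t ≡ f · t
additive⇒· {zero}  h add = [] , λ { [] → trans (add [] []) (xor-same (h [])) }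
additive⇒· {suc r} h add with additive⇒· (λ t → h (false ∷ t)) (λ t t′ → add (false ∷ t) (false ∷ t′))
... | f , eq = h (true ∷ 𝟎) ∷ f , λ
  { (false ∷ t) → trans (eq t) (cong (_xor (f · t)) (sym (∧-zeroʳ (h (true ∷ 𝟎)))))
  ; (true ∷ t)  → trans (cong (h ∘ (true ∷_)) (sym (⊕-identityˡ t))) (trans (add (true ∷ 𝟎) (false ∷ t))
      (cong₂ _xor_ (sym (∧-comm (h (true ∷ 𝟎)) true)) (eq t))) }

-- Decidability is part of the record because `encode` branches on membership of e and on the
-- existence of a vector outside e⊥.
record Isotropic {i} (S : Pred (Ē i) 0ℓ) : Set where
  field
    dec      : Decidable S
    0-closed : S 𝟘
    +-closed : ∀ {x y} → S x → S y → S (x ⊞ y)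
    singular : ∀ {x} → S x → q x ≡ false

record Encoding {i} (S : Pred (Ē i) 0ℓ) : Set where
  constructor encoding
  field
    {rank defect} : ℕ
    code          : Code i rank defect
    sound         : ∀ t → S (span code t)
    complete      : ∀ {x} → S x → ∃ λ t → x ≡ span code t

encode : ∀ {i} {S : Pred (Ē i) 0ℓ} → Isotropic S → Encoding S
encode {zero}  {S} iso = encoding [] (λ { [] → 0-closed }) (λ { {[] , []} _ → [] , refl })
  where open Isotropic iso
encode {suc i} {S} iso with Isotropic.dec iso (cons false true 𝟘)
... | yes e∈S = encoding (axis code) sound′ complete′
  where
  open Isotropic iso
  flip : ∀ {x y z} → S (cons x y z) → S (cons x (true xor y) z)
  flip {x} {y} {z} p = subst S (cons-cong refl refl (⊞-identityˡ z)) (+-closed e∈S p)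
  T-isotropic : Isotropic (λ z → S (cons false false z))
  T-isotropic = record
    { dec = λ z → dec (cons false false z) ; 0-closed = 0-closed ; +-closed = +-closed ; singular = singular }
  open Encoding (encode T-isotropic)
  sound′ : ∀ t → S (span (axis code) t)
  sound′ (false ∷ t) = sound t
  sound′ (true ∷ t)  = flip (sound t)
  complete′ : ∀ {x} → S x → ∃ λ t → x ≡ span (axis code) t
  complete′ {false ∷ a , false ∷ b} p = let t , e = complete p in false ∷ t , cons-cong refl refl e
  complete′ {false ∷ a , true ∷ b}  p = let t , e = complete (flip p) in true ∷ t , cons-cong refl refl e
  -- Adding e to a vector outside e⊥ changes the value of `q`, so S contains no such vector.
  complete′ {true ∷ a , false ∷ b}  p = case trans (sym (cong (true xor_) (singular p))) (singular (flip p)) of λ ()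
  complete′ {true ∷ a , true ∷ b}   p = case trans (sym (cong (true xor_) (singular (flip p)))) (singular p) of λ ()
... | no e∉S = branch (dec-∃Ē (λ z → dec (cons true false z) ⊎-dec dec (cons true true z)))
  where
  open Isotropic iso
  T : Pred (Ē i) 0ℓ
  T z = S (cons false false z) ⊎ S (cons false true z)

  T⁺ : ∀ y {z} → S (cons false y z) → T z
  T⁺ false p = inj₁ p
  T⁺ true  p = inj₂ p

  T⁻ : ∀ {z} → T z → ∃ λ y → S (cons false y z)
  T⁻ (inj₁ p) = false , p
  T⁻ (inj₂ p) = true , p

  q-T : ∀ y {z} → S (cons false y z) → q z ≡ false
  q-T y {z} p = trans (cong (_xor q z) (sym (∧-zeroʳ y))) (singular p)

  -- Two different heights over one z would differ by e, which is not in S. Hence S ∩ e⊥ projects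
  -- injectively onto T.
  height-unique : ∀ y y′ {z} → S (cons false y z) → S (cons false y′ z) → y ≡ y′
  height-unique y y′ {z} p p′ with y xor y′ in eq | subst S (cons-cong refl refl (⊞-self z)) (+-closed p p′)
  ... | false | _ = xor≡false⇒≡ y y′ eq
  ... | true  | e = ⊥-elim (e∉S e)

  T-isotropic : Isotropic T
  T-isotropic = record
    { dec      = λ z → dec (cons false false z) ⊎-dec dec (cons false true z)
    ; 0-closed = inj₁ 0-closed
    ; +-closed = λ s t → let y , p = T⁻ s ; y′ , p′ = T⁻ t in T⁺ (y xor y′) (+-closed p p′)
    ; singular = λ s → let y , p = T⁻ s in q-T y p
    }
  open Encoding (encode T-isotropic)

  branch : Dec (∃ λ z → S (cons true false z) ⊎ S (cons true true z)) → Encoding S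
  branch (no none) = encoding (twist f code) sound′ complete′
    where
    h : U _ → Bool
    h t = proj₁ (T⁻ (sound t))
    h∈S : ∀ t → S (cons false (h t) (span code t))
    h∈S t = proj₂ (T⁻ (sound t))
    form = additive⇒· h λ t t′ → height-unique (h (t ⊕ t′)) (h t xor h t′) (h∈S (t ⊕ t′))
      (subst S (cons-cong refl refl (sym (span-⊕ code t t′))) (+-closed (h∈S t) (h∈S t′)))
    f = proj₁ form
    sound′ : ∀ t → S (span (twist f code) t)
    sound′ t = subst S (cons-cong refl (proj₂ form t) refl) (h∈S t)
    complete′ : ∀ {x} → S x → ∃ λ t → x ≡ span (twist f code) t
    complete′ {true ∷ a , false ∷ b} p = ⊥-elim (none (_ , inj₁ p))
    complete′ {true ∷ a , true ∷ b}  p = ⊥-elim (none (_ , inj₂ p))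
    complete′ {false ∷ a , y ∷ b}    p with complete (T⁺ y p)
    ... | t , refl = t , cons-cong refl (trans (height-unique y (h t) p (h∈S t)) (proj₂ form t)) refl
  branch (yes (z , z∈)) with decompose code z
  ... | m , n , t₀ , z≡ = encoding (tilt m n code) sound′ complete′
    where
    w : Ē i
    w = complement code m n
    -- The vector found lies over z, not over the representative w of its coset; adding a lift of
    -- the T-part of z moves it to w.
    tilted : ∃ λ y → S (cons true y w)
    tilted = combine ([ (false ,_) , (true ,_) ]′ z∈)
      where
      combine : (∃ λ y → S (cons true y z)) → ∃ λ y → S (cons true y w)
      combine (y , p) = let y′ , p′ = T⁻ (sound t₀) in y′ xor y , subst S (cons-cong refl refl (begin
        span code t₀ ⊞ z                    ≡⟨ cong (span code t₀ ⊞_) (trans z≡ (⊞-comm w _)) ⟩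
        span code t₀ ⊞ (span code t₀ ⊞ w)   ≡⟨ ⊞-cancel (span code t₀) w ⟩
        w                                   ∎)) (+-closed p′ p)
        where open ≡-Reasoning
    w∈S : S (cons true (q w) w)
    w∈S with y , p ← tilted = subst S (cons-cong refl (xor≡false⇒≡ y (q w)
      (trans (cong (_xor q w) (∧-comm true y)) (singular p))) refl) p
    -- By polarisation, singularity of the lift of w, of `cons false y s` and of their sum makes the
    -- two vectors orthogonal, and this fixes y.
    slope : ∀ y {s} → S (cons false y s) → y ≡ ω w s
    slope y {s} p = xor≡false⇒≡ y (ω w s) (begin
      y xor ω w s
        ≡⟨ solve 4 (λ Q y s o → y :+ o := ((Q :+ y) :* con true) :+ ((Q :+ s) :+ o) :+ s) refl (q w) y (q s) (ω w s) ⟩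
      (((q w xor y) ∧ true) xor ((q w xor q s) xor ω w s)) xor q s
        ≡⟨ cong (λ u → (((q w xor y) ∧ true) xor u) xor q s) (q-⊞ w s) ⟨
      q (cons true (q w) w ⊞ cons false y s) xor q s
        ≡⟨ cong₂ _xor_ (singular (+-closed w∈S p)) (q-T y p) ⟩
      false ∎)
      where
      open ≡-Reasoning
      open xor-∧-Solver
    sound₀ : ∀ t → S (cons false (ω w (span code t)) (span code t))
    sound₀ t with y , p ← T⁻ (sound t) = subst S (cons-cong refl (slope y p) refl) p
    sound′ : ∀ t → S (span (tilt m n code) t)
    sound′ (false ∷ t) = sound₀ t
    sound′ (true ∷ t)  = +-closed w∈S (sound₀ t)
    complete′ : ∀ {x} → S x → ∃ λ t → x ≡ span (tilt m n code) t
    complete′ {false ∷ a , y ∷ b} p with complete (T⁺ y p)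
    ... | t , refl = false ∷ t , cons-cong refl (slope y p) refl
    complete′ {true ∷ a , y ∷ b}  p with complete (T⁺ (q w xor y) (+-closed w∈S p))
    ... | t , e = true ∷ t , (begin
      cons true y (a , b)
        ≡⟨ ⊞-cancel (cons true (q w) w) (cons true y (a , b)) ⟨
      cons true (q w) w ⊞ cons false (q w xor y) (w ⊞ (a , b))
        ≡⟨ cong (cons true (q w) w ⊞_) (cons-cong refl (trans (slope _ (+-closed w∈S p)) (cong (ω w) e)) e) ⟩
      span (tilt m n code) (true ∷ t) ∎)
      where open ≡-Reasoning

-- The number of codes and the Gaussian product formula.

module Counting where

  open import Data.Nat.Base using (_+_; _*_; _^_; _∸_)

  count : ℕ → ℕ → ℕ → ℕ
  count zero    zero    zero    = 1
  count zero    zero    (suc k) = 0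
  count zero    (suc r) k       = 0
  count (suc i) zero    zero    = 0
  count (suc i) zero    (suc k) = 2 ^ 0 * count i 0 k
  count (suc i) (suc r) zero    = count i r 0 + (2 ^ i * 2 ^ 0) * count i r 0
  count (suc i) (suc r) (suc k) =
    (count i r (suc k) + (2 ^ i * 2 ^ suc k) * count i r (suc k)) + 2 ^ suc r * count i (suc r) k

  private
    Fin↔U : ∀ i → Fin (2 ^ i) ↔ U i
    Fin↔U i = ↔-sym (U↔Fin i)

    Axial : ℕ → ℕ → ℕ → Set
    Axial i r k = Code i r k ⊎ ((U i × U k) × Code i r k)

    axial : ∀ {i r k n} → Fin n ↔ Code i r k → Fin (n + (2 ^ i * 2 ^ k) * n) ↔ Axial i r k
    axial {i} {r} {k} {n} e = ↔-trans (+↔⊎ {n})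
      (e ⊎-↔ ↔-trans *↔× (↔-trans *↔× (Fin↔U i ×-↔ Fin↔U k) ×-↔ e))

    twisted : ∀ {i r k n} → Fin n ↔ Code i r k → Fin (2 ^ r * n) ↔ (U r × Code i r k)
    twisted {r = r} e = ↔-trans *↔× (Fin↔U r ×-↔ e)

  Fin↔Code : ∀ i r k → Fin (count i r k) ↔ Code i r k
  Fin↔Code zero    zero    zero    = ↔-trans 1↔⊤ (mk↔ₛ′ (λ _ → []) (λ _ → _) (λ { [] → refl }) (λ _ → refl))
  Fin↔Code zero    zero    (suc k) = mk↔ₛ′ (λ ()) (λ ()) (λ ()) (λ ())
  Fin↔Code zero    (suc r) k       = mk↔ₛ′ (λ ()) (λ ()) (λ ()) (λ ())
  Fin↔Code (suc i) zero    zero    = mk↔ₛ′ (λ ()) (λ ()) (λ ()) (λ ())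
  Fin↔Code (suc i) zero    (suc k) = ↔-trans (twisted (Fin↔Code i 0 k))
    (mk↔ₛ′ (λ (f , c) → twist f c) (λ { (twist f c) → f , c }) (λ { (twist f c) → refl }) (λ { (f , c) → refl }))
  Fin↔Code (suc i) (suc r) zero    = ↔-trans (axial (Fin↔Code i r 0)) (mk↔ₛ′
    (λ { (inj₁ c) → axis c ; (inj₂ ((m , n) , c)) → tilt m n c })
    (λ { (axis c) → inj₁ c ; (tilt m n c) → inj₂ ((m , n) , c) })
    (λ { (axis c) → refl ; (tilt m n c) → refl })
    (λ { (inj₁ c) → refl ; (inj₂ ((m , n) , c)) → refl }))
  Fin↔Code (suc i) (suc r) (suc k) = ↔-trans +↔⊎ (↔-trans
    (axial (Fin↔Code i r (suc k)) ⊎-↔ twisted (Fin↔Code i (suc r) k)) (mk↔ₛ′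
    (λ { (inj₁ (inj₁ c)) → axis c ; (inj₁ (inj₂ ((m , n) , c))) → tilt m n c ; (inj₂ (f , c)) → twist f c })
    (λ { (axis c) → inj₁ (inj₁ c) ; (tilt m n c) → inj₁ (inj₂ ((m , n) , c)) ; (twist f c) → inj₂ (f , c) })
    (λ { (axis c) → refl ; (tilt m n c) → refl ; (twist f c) → refl })
    (λ { (inj₁ (inj₁ c)) → refl ; (inj₁ (inj₂ ((m , n) , c))) → refl ; (inj₂ (f , c)) → refl })))

  -- The Gaussian binomial of r + k over k. Indexing by r and k makes the Pascal rule a structural
  -- recursion without subtraction.
  gaussian : ℕ → ℕ → ℕ
  gaussian zero    k       = 1
  gaussian (suc r) zero    = 1
  gaussian (suc r) (suc k) = gaussian r (suc k) + 2 ^ suc r * gaussian (suc r) k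

  private
    M : ℕ → ℕ
    M n = 2 ^ n ∸ 1

    suc-M : ∀ n → suc (M n) ≡ 2 ^ n
    suc-M n = ℕ.m+[n∸m]≡n (ℕ.m^n>0 2 n)

    M-+ : ∀ a b → M a + 2 ^ a * M b ≡ M (a + b)
    M-+ a b = ℕ.suc-injective (begin
      suc (M a) + 2 ^ a * M b    ≡⟨ cong (_+ 2 ^ a * M b) (suc-M a) ⟩
      2 ^ a + 2 ^ a * M b        ≡⟨ ℕ.*-suc (2 ^ a) (M b) ⟨
      2 ^ a * suc (M b)          ≡⟨ cong (2 ^ a *_) (suc-M b) ⟩
      2 ^ a * 2 ^ b              ≡⟨ ℕ.^-distribˡ-+-* 2 a b ⟨
      2 ^ (a + b)                ≡⟨ suc-M (a + b) ⟨
      suc (M (a + b))            ∎)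
      where open ≡-Reasoning

    infix 10 _!₂
    _!₂ : ℕ → ℕ
    n !₂ = factors n n

  -- In the inductive step both Pascal summands reduce to the same factorial, with coefficients
  -- 2^(r+1) - 1 and 2^(r+1) (2^(k+1) - 1), whose sum is 2^(r+k+2) - 1.
  gaussian-factorials : ∀ r k → gaussian r k * (r !₂ * k !₂) ≡ (r + k) !₂
  gaussian-factorials zero    k       = trans (ℕ.*-identityˡ _) (ℕ.*-identityˡ _)
  gaussian-factorials (suc r) zero    = trans (ℕ.*-identityˡ _) (trans (ℕ.*-identityʳ _) (cong _!₂ (sym (ℕ.+-identityʳ (suc r)))))
  gaussian-factorials (suc r) (suc k) = begin
    (g + e * g′) * ((M (suc r) * r !₂) * (M (suc k) * k !₂))
      ≡⟨ solve 7 (λ g e g′ mr fr mk fk → (g :+ e :* g′) :* ((mr :* fr) :* (mk :* fk))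
           := (g :* (fr :* (mk :* fk))) :* mr :+ (e :* mk) :* (g′ :* ((mr :* fr) :* fk))) refl
           g e g′ (M (suc r)) (r !₂) (M (suc k)) (k !₂) ⟩
    (g * (r !₂ * suc k !₂)) * M (suc r) + (e * M (suc k)) * (g′ * (suc r !₂ * k !₂))
      ≡⟨ cong₂ (λ x y → x * M (suc r) + (e * M (suc k)) * y) (gaussian-factorials r (suc k))
           (trans (gaussian-factorials (suc r) k) (cong _!₂ (sym (ℕ.+-suc r k)))) ⟩
    N * M (suc r) + (e * M (suc k)) * N
      ≡⟨ solve 3 (λ n x y → n :* x :+ y :* n := (x :+ y) :* n) refl N (M (suc r)) (e * M (suc k)) ⟩
    (M (suc r) + e * M (suc k)) * N
      ≡⟨ cong (_* N) (M-+ (suc r) (suc k)) ⟩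
    (suc r + suc k) !₂ ∎
    where
    open ≡-Reasoning
    open +-*-Solver
    g = gaussian r (suc k)
    g′ = gaussian (suc r) k
    e = 2 ^ suc r
    N = (r + suc k) !₂

  private
    -- After multiplication by r !₂ and k !₂ both sides become the factorial of r + k + 1.
    absorption : ∀ r k → gaussian r (suc k) * M (suc k) ≡ gaussian (suc r) k * M (suc r)
    absorption r k = ℕ.*-cancelʳ-≡ _ _ (r !₂ * k !₂) {{ℕ.m*n≢0 (r !₂) (k !₂) {{factors-nonZero r}} {{factors-nonZero k}}}} (begin
      (gaussian r (suc k) * M (suc k)) * (r !₂ * k !₂)
        ≡⟨ solve 4 (λ g m a b → (g :* m) :* (a :* b) := g :* (a :* (m :* b))) refl (gaussian r (suc k)) (M (suc k)) (r !₂) (k !₂) ⟩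
      gaussian r (suc k) * (r !₂ * suc k !₂)
        ≡⟨ gaussian-factorials r (suc k) ⟩
      (r + suc k) !₂
        ≡⟨ cong _!₂ (ℕ.+-suc r k) ⟩
      (suc r + k) !₂
        ≡⟨ gaussian-factorials (suc r) k ⟨
      gaussian (suc r) k * (suc r !₂ * k !₂)
        ≡⟨ solve 4 (λ g m a b → g :* ((m :* a) :* b) := (g :* m) :* (a :* b)) refl (gaussian (suc r) k) (M (suc r)) (r !₂) (k !₂) ⟩
      (gaussian (suc r) k * M (suc r)) * (r !₂ * k !₂) ∎)
      where
      open ≡-Reasoning
      open +-*-Solver

    factors-!₂ : ∀ r k → factors (r + k) k * r !₂ ≡ (r + k) !₂
    factors-!₂ r zero    = trans (ℕ.*-identityˡ _) (cong _!₂ (sym (ℕ.+-identityʳ r)))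
    factors-!₂ r (suc k) rewrite ℕ.+-suc r k =
      trans (ℕ.*-assoc (M (suc (r + k))) (factors (r + k) k) (r !₂)) (cong (M (suc (r + k)) *_) (factors-!₂ r k))

  gaussianBinomial≡gaussian : ∀ r k → gaussianBinomial (r + k) k ≡ gaussian r k
  gaussianBinomial≡gaussian r k = trans
    (/-congˡ {{factors-nonZero k}} (ℕ.*-cancelʳ-≡ _ _ (r !₂) {{factors-nonZero r}} (begin
      factors (r + k) k * r !₂            ≡⟨ factors-!₂ r k ⟩
      (r + k) !₂                          ≡⟨ gaussian-factorials r k ⟨
      gaussian r k * (r !₂ * k !₂)        ≡⟨ solve 3 (λ g a b → g :* (a :* b) := (g :* b) :* a) refl (gaussian r k) (r !₂) (k !₂) ⟩
      (gaussian r k * k !₂) * r !₂        ∎)))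
    (m*n/n≡m (gaussian r k) (k !₂) {{factors-nonZero k}})
    where
    open ≡-Reasoning
    open +-*-Solver

  private
    ∏ : ℕ → ℕ → ℕ
    ∏ k zero    = 1
    ∏ k (suc r) = (2 ^ k + 1) * ∏ (suc k) r

    ∏-snoc : ∀ k r → ∏ k (suc r) ≡ ∏ k r * (2 ^ (k + r) + 1)
    ∏-snoc k zero    rewrite ℕ.+-identityʳ k = ℕ.*-comm (2 ^ k + 1) 1
    ∏-snoc k (suc r) rewrite ℕ.+-suc k r = begin
      (2 ^ k + 1) * ∏ (suc k) (suc r)                       ≡⟨ cong ((2 ^ k + 1) *_) (∏-snoc (suc k) r) ⟩
      (2 ^ k + 1) * (∏ (suc k) r * (2 ^ suc (k + r) + 1))   ≡⟨ ℕ.*-assoc (2 ^ k + 1) _ _ ⟨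
      (2 ^ k + 1) * ∏ (suc k) r * (2 ^ suc (k + r) + 1)     ∎
      where open ≡-Reasoning

    product-applyUpTo-cong : ∀ {f g : ℕ → ℕ} → (∀ t → f t ≡ g t) → ∀ r →
      product (applyUpTo f r) ≡ product (applyUpTo g r)
    product-applyUpTo-cong e zero    = refl
    product-applyUpTo-cong e (suc r) = cong₂ _*_ (e 0) (product-applyUpTo-cong (λ t → e (suc t)) r)

    product-∏ : ∀ k r → product (applyUpTo (λ t → 2 ^ (k + t) + 1) r) ≡ ∏ k r
    product-∏ k zero    = refl
    product-∏ k (suc r) = cong₂ _*_ (cong (λ m → 2 ^ m + 1) (ℕ.+-identityʳ k)) (trans
      (product-applyUpTo-cong (λ t → cong (λ m → 2 ^ m + 1) (ℕ.+-suc k t)) r) (product-∏ (suc k) r))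

    gaussian-0 : ∀ r → gaussian r 0 ≡ 1
    gaussian-0 zero    = refl
    gaussian-0 (suc r) = refl

  -- The recurrence of `count` is not the Pascal rule times a common factor: its two products start
  -- at different exponents. `absorption` exchanges a part of the first binomial for the second, and
  -- then 2^(r+k+1) + 1 splits off as the last factor of the longer product.
  count≡ : ∀ r k → count (r + k) r k ≡ gaussian r k * ∏ k r
  count≡ zero    zero    = refl
  count≡ zero    (suc k) = trans (ℕ.*-identityˡ _) (count≡ zero k)
  count≡ (suc r) zero    = begin
    n + (2 ^ (r + 0) * 1) * n
      ≡⟨ cong₂ (λ x y → x + (2 ^ y * 1) * x) (trans (count≡ r 0) (cong (_* ∏ 0 r) (gaussian-0 r))) (ℕ.+-identityʳ r) ⟩
    1 * ∏ 0 r + (2 ^ r * 1) * (1 * ∏ 0 r)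
      ≡⟨ solve 2 (λ p e → con 1 :* p :+ (e :* con 1) :* (con 1 :* p) := con 1 :* (p :* (e :+ con 1))) refl (∏ 0 r) (2 ^ r) ⟩
    1 * (∏ 0 r * (2 ^ r + 1))
      ≡⟨ cong (1 *_) (∏-snoc 0 r) ⟨
    1 * ∏ 0 (suc r) ∎
    where
    open ≡-Reasoning
    open +-*-Solver
    n = count (r + 0) r 0
  count≡ (suc r) (suc k) = begin
    (count (r + suc k) r (suc k) + (2 ^ (r + suc k) * 2 ^ suc k) * count (r + suc k) r (suc k))
      + e * count (r + suc k) (suc r) k
      ≡⟨ cong₂ (λ x y → (x + (2 ^ (r + suc k) * 2 ^ suc k) * x) + e * y) (count≡ r (suc k))
           (trans (cong (λ i → count i (suc r) k) (ℕ.+-suc r k)) (count≡ (suc r) k)) ⟩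
    (g * p + (2 ^ (r + suc k) * d) * (g * p)) + e * (g′ * ((2 ^ k + 1) * p))
      ≡⟨ cong (λ x → (g * p + (x * d) * (g * p)) + e * (g′ * ((2 ^ k + 1) * p))) e*2^k ⟩
    (g * p + ((e * 2 ^ k) * d) * (g * p)) + e * (g′ * ((2 ^ k + 1) * p))
      -- Writing 2^(k+1) as 1 + (2^(k+1) - 1) exposes the factor that `absorption` consumes.
      ≡⟨ cong (λ d → (g * p + ((e * 2 ^ k) * d) * (g * p)) + e * (g′ * ((2 ^ k + 1) * p))) (suc-M (suc k)) ⟨
    (g * p + ((e * 2 ^ k) * suc (M (suc k))) * (g * p)) + e * (g′ * ((2 ^ k + 1) * p))
      ≡⟨ solve 6 (λ g g′ p e c m → (g :* p :+ ((e :* c) :* (con 1 :+ m)) :* (g :* p)) :+ e :* (g′ :* ((c :+ con 1) :* p))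
           := (g :* p :+ (e :* c) :* (g :* p)) :+ ((e :* c) :* p) :* (g :* m) :+ e :* (g′ :* ((c :+ con 1) :* p))) refl
           g g′ p e (2 ^ k) (M (suc k)) ⟩
    (g * p + (e * 2 ^ k) * (g * p)) + ((e * 2 ^ k) * p) * (g * M (suc k)) + e * (g′ * ((2 ^ k + 1) * p))
      ≡⟨ cong (λ x → (g * p + (e * 2 ^ k) * (g * p)) + ((e * 2 ^ k) * p) * x + e * (g′ * ((2 ^ k + 1) * p))) (absorption r k) ⟩
    (g * p + (e * 2 ^ k) * (g * p)) + ((e * 2 ^ k) * p) * (g′ * M (suc r)) + e * (g′ * ((2 ^ k + 1) * p))
      ≡⟨ solve 6 (λ g g′ p e c m → (g :* p :+ (e :* c) :* (g :* p)) :+ ((e :* c) :* p) :* (g′ :* m) :+ e :* (g′ :* ((c :+ con 1) :* p))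
           := (g :* p :+ (e :* c) :* (g :* p)) :+ (e :* c) :* (g′ :* p) :* (con 1 :+ m) :+ e :* (g′ :* p)) refl
           g g′ p e (2 ^ k) (M (suc r)) ⟩
    (g * p + (e * 2 ^ k) * (g * p)) + (e * 2 ^ k) * (g′ * p) * suc (M (suc r)) + e * (g′ * p)
      ≡⟨ cong (λ x → (g * p + (e * 2 ^ k) * (g * p)) + (e * 2 ^ k) * (g′ * p) * x + e * (g′ * p)) (suc-M (suc r)) ⟩
    (g * p + (e * 2 ^ k) * (g * p)) + (e * 2 ^ k) * (g′ * p) * e + e * (g′ * p)
      ≡⟨ solve 5 (λ g g′ p e c → (g :* p :+ (e :* c) :* (g :* p)) :+ (e :* c) :* (g′ :* p) :* e :+ e :* (g′ :* p)
           := (g :+ e :* g′) :* (p :* (e :* c :+ con 1))) refl g g′ p e (2 ^ k) ⟩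
    (g + e * g′) * (p * (e * 2 ^ k + 1))
      ≡⟨ cong (λ x → (g + e * g′) * (p * (x + 1))) (trans (sym e*2^k) (cong (2 ^_) (ℕ.+-comm r (suc k)))) ⟩
    (g + e * g′) * (p * (2 ^ (suc k + r) + 1))
      ≡⟨ cong ((g + e * g′) *_) (∏-snoc (suc k) r) ⟨
    (g + e * g′) * ∏ (suc k) (suc r) ∎
    where
    open ≡-Reasoning
    open +-*-Solver
    g = gaussian r (suc k)
    g′ = gaussian (suc r) k
    p = ∏ (suc k) r
    e = 2 ^ suc r
    d = 2 ^ suc k
    e*2^k : 2 ^ (r + suc k) ≡ e * 2 ^ k
    e*2^k = trans (cong (2 ^_) (ℕ.+-suc r k)) (ℕ.^-distribˡ-+-* 2 (suc r) k)

  packingSize≡ : ∀ r k → packingSize (r + k) k ≡ 2 ^ r * count (r + k) r k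
  packingSize≡ r k rewrite ℕ.m+n∸n≡m r k = begin
    2 ^ r * gaussianBinomial (r + k) k * product (applyUpTo (λ t → 2 ^ (k + t) + 1) r)
      ≡⟨ cong₂ (λ x y → 2 ^ r * x * y) (gaussianBinomial≡gaussian r k) (product-∏ k r) ⟩
    2 ^ r * gaussian r k * ∏ k r    ≡⟨ ℕ.*-assoc (2 ^ r) _ _ ⟩
    2 ^ r * (gaussian r k * ∏ k r)  ≡⟨ cong (2 ^ r *_) (count≡ r k) ⟨
    2 ^ r * count (r + k) r k       ∎
    where open ≡-Reasoning

open Counting

-- Translations of the labels and further facts on U and Ē.

index-label : ∀ i (p : Fin (2 ℕ.^ i)) → index {i} (label p) ≡ p
index-label i p = Inverse.strictlyInverseˡ (U↔Fin i) p

label-injective : ∀ {i} {p q : Fin (2 ℕ.^ i)} → label {i} p ≡ label q → p ≡ q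
label-injective {i} {p} {q} e = ≡.trans (≡.sym (index-label i p)) (≡.trans (cong index e) (index-label i q))

infix 4 _≟U_
_≟U_ : ∀ {i} (a b : U i) → Dec (a ≡ b)
_≟U_ = ≡-dec _≟ᵇ_

≢𝟎⇒∃·≡true : ∀ {i} (d : U i) → d ≢ 𝟎 → ∃ λ e → d · e ≡ true
≢𝟎⇒∃·≡true []          d≢𝟎 = ⊥-elim (d≢𝟎 refl)
≢𝟎⇒∃·≡true (true ∷ d)  d≢𝟎 = true ∷ 𝟎 , cong not (·-zeroʳ d)
≢𝟎⇒∃·≡true (false ∷ d) d≢𝟎 with e , eq ← ≢𝟎⇒∃·≡true d (d≢𝟎 ∘ cong (false ∷_)) = false ∷ e , eq

⊕≡𝟎⇒≡ : ∀ {i} (a b : U i) → a ⊕ b ≡ 𝟎 → a ≡ b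
⊕≡𝟎⇒≡ a b e = ≡.sym (≡.trans (≡.sym (⊕-cancel a b)) (≡.trans (cong (a ⊕_) e) (⊕-identityʳ a)))

shift : ∀ {i} → U i → Fin (2 ℕ.^ i) → Fin (2 ℕ.^ i)
shift a p = index (label p ⊕ a)

label-shift : ∀ {i} (a : U i) p → label (shift a p) ≡ label p ⊕ a
label-shift a p = label-index (label p ⊕ a)

shift-involutive : ∀ {i} (a : U i) p → shift a (shift a p) ≡ p
shift-involutive {i} a p = ≡.trans (cong (λ u → index (u ⊕ a)) (label-shift a p))
  (≡.trans (cong index (≡.trans (⊕-assoc (label p) a a) (≡.trans (cong (label p ⊕_) (⊕-self a)) (⊕-identityʳ (label p)))))
    (index-label i p))

shift-injective : ∀ {i} (a b : U i) p → shift a p ≡ shift b p → a ≡ b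
shift-injective a b p e = ≡.trans (≡.sym (⊕-cancel (label p) a))
  (≡.trans (cong (label p ⊕_) (≡.trans (≡.sym (label-shift a p)) (≡.trans (cong label e) (label-shift b p))))
    (⊕-cancel (label p) b))

shift-𝟎 : ∀ i (p : Fin (2 ℕ.^ i)) → shift {i} 𝟎 p ≡ p
shift-𝟎 i p = ≡.trans (cong index (⊕-identityʳ (label {i} p))) (index-label i p)

shift-permutation : ∀ {i} → U i → Permutation (2 ℕ.^ i) (2 ℕ.^ i)
shift-permutation a = permutation (shift a) (shift a) (shift-involutive a) (shift-involutive a)

rank+defect : ∀ {i r k} → Code i r k → i ≡ r ℕ.+ k
rank+defect []                   = refl
rank+defect (axis c)             = cong suc (rank+defect c)
rank+defect (twist {r = r} f c)  = ≡.trans (cong suc (rank+defect c)) (≡.sym (ℕ.+-suc r _))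
rank+defect (tilt m n c)         = cong suc (rank+defect c)

ω-comm : ∀ {i} (x y : Ē i) → ω x y ≡ ω y x
ω-comm (a , b) (a′ , b′) = xor-comm (b · a′) (b′ · a)

s≡-1^exponent : ∀ s → s ≡ -1^ exponent s
s≡-1^exponent Sign.+ = refl
s≡-1^exponent Sign.- = refl

infix 4 _≟Ē_
_≟Ē_ : ∀ {i} (x y : Ē i) → Dec (x ≡ y)
_≟Ē_ = ×-≡-dec _≟U_ _≟U_

-- From bases and characters to codes and linear forms.

scale : ∀ {i} → Bool → Ē i → Ē i
scale t (a , b) = map (t ∧_) a , map (t ∧_) b

scale-true : ∀ {i} (x : Ē i) → scale true x ≡ x
scale-true (a , b) = cong₂ _,_ (map-id a) (map-id b)

scale-false : ∀ {i} (x : Ē i) → scale false x ≡ 𝟘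
scale-false (a , b) = cong₂ _,_ (map-const a false) (map-const b false)

scale-xor : ∀ {i} s t (x : Ē i) → scale (s xor t) x ≡ scale s x ⊞ scale t x
scale-xor false t     x = sym (trans (cong (_⊞ scale t x) (scale-false x)) (⊞-identityˡ _))
scale-xor true  false x = sym (trans (cong (scale true x ⊞_) (scale-false x)) (⊞-identityʳ _))
scale-xor true  true  x = trans (scale-false x) (sym (⊞-self _))

module Combinations (i : ℕ) where

  open Linear 𝔽₂ (Ē-module i) public

  lincomb-cong : ∀ {n} {s t : Vector Bool n} (b : Vector (Ē i) n) → (∀ j → s j ≡ t j) → lincomb s b ≡ lincomb t b
  lincomb-cong {zero}  b e = refl
  lincomb-cong {suc n} b e = cong₂ _⊞_ (cong (λ t → scale t (b zero)) (e zero)) (lincomb-cong (b ∘ suc) (e ∘ suc))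

  lincomb-xor : ∀ {n} (s t : Vector Bool n) (b : Vector (Ē i) n) →
                lincomb (λ j → s j xor t j) b ≡ lincomb s b ⊞ lincomb t b
  lincomb-xor {zero}  s t b = sym (⊞-self 𝟘)
  lincomb-xor {suc n} s t b = trans
    (cong₂ _⊞_ (scale-xor (s zero) (t zero) (b zero)) (lincomb-xor (s ∘ suc) (t ∘ suc) (b ∘ suc)))
    (⊞-interchange (scale (s zero) (b zero)) _ _ _)

  lincomb-closed : ∀ {S : Pred (Ē i) 0ℓ} → IsSubspace S → ∀ {n} {b : Vector (Ē i) n} →
                   (∀ j → S (b j)) → ∀ t → S (lincomb t b)
  lincomb-closed sub {zero}  b∈ t = IsSubspace.0-closed sub
  lincomb-closed sub {suc n} b∈ t = IsSubspace.+-closed sub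
    (IsSubspace.*-closed sub (t zero) (b∈ zero)) (lincomb-closed sub (b∈ ∘ suc) (t ∘ suc))

unitVector : ∀ {r} → Fin r → U r
unitVector zero    = true ∷ 𝟎
unitVector (suc j) = false ∷ unitVector j

module _ {i : ℕ} where
  open Combinations i

  lincomb-additive : ∀ {r} (h : U r → Ē i) → h 𝟎 ≡ 𝟘 → (∀ t t′ → h (t ⊕ t′) ≡ h t ⊞ h t′) →
                     ∀ t → lincomb t (h ∘ unitVector) ≡ h (tabulate t)
  lincomb-additive {zero}  h h0 h+ t = sym h0
  lincomb-additive {suc r} h h0 h+ t = trans
    (cong (scale (t zero) (h (true ∷ 𝟎)) ⊞_)
      (lincomb-additive (h ∘ (false ∷_)) h0 (λ s s′ → h+ (false ∷ s) (false ∷ s′)) (t ∘ suc)))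
    (first (t zero))
    where
    u = tabulate (t ∘ suc)
    first : ∀ τ → scale τ (h (true ∷ 𝟎)) ⊞ h (false ∷ u) ≡ h (τ ∷ u)
    first false = trans (cong (_⊞ h (false ∷ u)) (scale-false (h (true ∷ 𝟎)))) (⊞-identityˡ _)
    first true  = trans (cong (_⊞ h (false ∷ u)) (scale-true (h (true ∷ 𝟎))))
      (trans (sym (h+ (true ∷ 𝟎) (false ∷ u))) (cong (λ v → h (true ∷ v)) (⊕-identityˡ u)))

-- Counting the 2^r elements replaces the exchange lemma; `rank≡` applies it in both directions.
U-injection⇒≤ : ∀ {r r′} (f : U r → U r′) → (∀ {t t′} → f t ≡ f t′ → t ≡ t′) → r ℕ.≤ r′
U-injection⇒≤ {r} {r′} f inj = ℕ.≮⇒≥ λ r′<r → ℕ.<⇒≱ (ℕ.^-monoʳ-< 2 (s≤s (s≤s z≤n)) r′<r)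
  (Fin.injective⇒≤ {f = index ∘ f ∘ label} (label-injective ∘ inj ∘ index-injective))
  where
  index-injective : ∀ {u u′ : U r′} → index u ≡ index u′ → u ≡ u′
  index-injective {u} {u′} e = trans (sym (label-index u)) (trans (cong label e) (label-index u′))

Image : ∀ {i r k} → Code i r k → Pred (Ē i) 0ℓ
Image c x = ∃ λ t → x ≡ span c t

image-dec : ∀ {i r k} (c : Code i r k) x → Dec (Image c x)
image-dec c x = dec-∃ (λ t → x ≟Ē span c t)

module _ {i r : ℕ} {S : Pred (Ē i) 0ℓ} where
  open Combinations i

  isotropic : IsSubspace S → HasDimension S r → TotallySingular S → Isotropic S
  isotropic sub (b , isBasis) singular = record
    { dec      = λ x → map′
        (λ (t , e) → subst S (sym e) (lincomb-closed sub (IsBasis.members isBasis) (lookup t)))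
        (λ x∈S → let t , e₁ , e₂ = IsBasis.spanning isBasis x x∈S in
           tabulate t , trans (cong₂ _,_ e₁ e₂) (lincomb-cong b (λ j → sym (lookup∘tabulate t j))))
        (dec-∃ {r} (λ t → x ≟Ē lincomb (lookup t) b))
    ; 0-closed = IsSubspace.0-closed sub
    ; +-closed = IsSubspace.+-closed sub
    ; singular = λ {x} x∈S → trans (sym (Q≡q x)) (singular x x∈S)
    }

  rank≡ : IsSubspace S → HasDimension S r → (e : Encoding S) → Encoding.rank e ≡ r
  rank≡ sub (b , isBasis) (encoding c sound complete) = ℕ.≤-antisym
    (U-injection⇒≤ (λ t → tabulate (coefficients t)) λ {t} {t′} e → span-injective c (trans (spans t)
      (trans (lincomb-cong b (tabulate-injective e)) (sym (spans t′)))))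
    (U-injection⇒≤ (λ t → proj₁ (coordinates t)) λ {t} {t′} e → independent-injective t t′
      (trans (proj₂ (coordinates t)) (trans (cong (span c) e) (sym (proj₂ (coordinates t′))))))
    where
    coefficients : ∀ t → Vector Bool r
    coefficients t = proj₁ (IsBasis.spanning isBasis (span c t) (sound t))
    spans : ∀ t → span c t ≡ lincomb (coefficients t) b
    spans t = let _ , e₁ , e₂ = IsBasis.spanning isBasis (span c t) (sound t) in cong₂ _,_ e₁ e₂
    tabulate-injective : ∀ {s t : Vector Bool r} → tabulate s ≡ tabulate t → ∀ j → s j ≡ t j
    tabulate-injective {s} {t} e j =
      trans (sym (lookup∘tabulate s j)) (trans (cong (λ u → lookup u j) e) (lookup∘tabulate t j))
    coordinates : (t : U r) → ∃ λ t′ → lincomb (lookup t) b ≡ span c t′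
    coordinates t = complete (lincomb-closed sub (IsBasis.members isBasis) (lookup t))
    independent-injective : ∀ (t t′ : U r) → lincomb (lookup t) b ≡ lincomb (lookup t′) b → t ≡ t′
    independent-injective t t′ e = trans (sym (tabulate∘lookup t)) (trans
      (tabulate-cong (λ j → xor≡false⇒≡ _ _ (IsBasis.independent isBasis (λ j → lookup t j xor lookup t′ j)
        (cong proj₁ vanishes , cong proj₂ vanishes) j)))
      (tabulate∘lookup t′))
      where
      vanishes : lincomb (λ j → lookup t j xor lookup t′ j) b ≡ 𝟘
      vanishes = trans (lincomb-xor (lookup t) (lookup t′) b) (trans (cong (_⊞ lincomb (lookup t′) b) e) (⊞-self _))

module _ {i r k : ℕ} (c : Code i r k) where
  open Combinations i

  image-isSubspace : IsSubspace (Image c)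
  image-isSubspace = record
    { respects = λ { (refl , refl) x∈ → x∈ }
    ; 0-closed = 𝟎 , sym (span-𝟎 c)
    ; +-closed = λ (t , e) (t′ , e′) → t ⊕ t′ , trans (cong₂ _⊞_ e e′) (sym (span-⊕ c t t′))
    ; *-closed = λ { false {x} _ → 𝟎 , trans (scale-false x) (sym (span-𝟎 c))
                   ; true  {x} (t , e) → t , trans (scale-true x) e }
    }

  image-hasDimension : HasDimension (Image c) r
  image-hasDimension = span c ∘ unitVector , record
    { members     = λ j → unitVector j , refl
    ; independent = λ t (e₁ , e₂) j → trans (sym (lookup∘tabulate t j)) (trans
        (cong (λ u → lookup u j) (span≡𝟘⇒≡𝟎 c (trans (sym (cong₂ _,_ e₁ e₂)) (lincomb-span t)))) (lookup-replicate j false))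
    ; spanning    = λ x (t , e) → let e′ = spans x t e in lookup t , cong proj₁ e′ , cong proj₂ e′
    }
    where
    lincomb-span : ∀ t → lincomb t (span c ∘ unitVector) ≡ span c (tabulate t)
    lincomb-span = lincomb-additive (span c) (span-𝟎 c) (span-⊕ c)
    spans : ∀ x t → x ≡ span c t → x ≡ lincomb (lookup t) (span c ∘ unitVector)
    spans x t e = trans e (trans (cong (span c) (sym (tabulate∘lookup t))) (sym (lincomb-span (lookup t))))

  image-totallySingular : TotallySingular (Image c)
  image-totallySingular x (t , e) = trans (Q≡q x) (trans (cong q e) (span-singular c t))

  module _ (f : U r) where

    private
      value : E i → U r → Sign
      value g t = E.sign g Sign.* -1^ (σ c t xor (f · t))

    -- An element g over `span c t` differs from `gen c t` by the sign `E.sign g` times (-1)^(σ c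
    -- t), while f prescribes the value on `gen c t` itself.
    image-character : Character (preimage (Image c))
    image-character = record
      { χ     = λ g (t , _) → value g t
      ; homo  = homo
      ; χ[-I] = λ (t , e) → trans (cong (λ t → Sign.- Sign.* -1^ (σ c t xor (f · t))) (span≡𝟘⇒≡𝟎 c e))
          (cong₂ (λ x y → Sign.- Sign.* -1^ (x xor y)) (σ-𝟎 c) (·-zeroʳ f))
      }
      where
      homo : ∀ g h (g∈ : Image c (bar g)) (h∈ : Image c (bar h)) (gh∈ : Image c (bar (g ∙ h))) →
             value (g ∙ h) (proj₁ gh∈) ≡ value g (proj₁ g∈) Sign.* value h (proj₁ h∈)
      homo ⟪ s , _ , _ ⟫ ⟪ s′ , _ , _ ⟫ (t , refl) (t′ , refl) (t″ , e)
        with refl ← span-injective c (trans (span-⊕ c t t′) e)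
        rewrite s≡-1^exponent s | s≡-1^exponent s′ | σ-⊕ c t t′ | ·-distribˡ-⊕ f t t′
        = begin
        (-1^ β Sign.* (-1^ x Sign.* -1^ x′)) Sign.* -1^ ((β xor (σ c t xor σ c t′)) xor ((f · t) xor (f · t′)))
          ≡⟨ cong (λ y → (-1^ β Sign.* y) Sign.* _) (-1^-xor x x′) ⟨
        (-1^ β Sign.* -1^ (x xor x′)) Sign.* _
          ≡⟨ cong (Sign._* _) (-1^-xor β (x xor x′)) ⟨
        -1^ (β xor (x xor x′)) Sign.* -1^ ((β xor (σ c t xor σ c t′)) xor ((f · t) xor (f · t′)))
          ≡⟨ -1^-xor (β xor (x xor x′)) _ ⟨
        -1^ ((β xor (x xor x′)) xor ((β xor (σ c t xor σ c t′)) xor ((f · t) xor (f · t′))))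
          ≡⟨ cong -1^_ (solve 7 (λ β x x′ s s′ F F′ →
               (β :+ (x :+ x′)) :+ ((β :+ (s :+ s′)) :+ (F :+ F′)) := (x :+ (s :+ F)) :+ (x′ :+ (s′ :+ F′)))
               refl β x x′ (σ c t) (σ c t′) (f · t) (f · t′)) ⟩
        -1^ ((x xor (σ c t xor (f · t))) xor (x′ xor (σ c t′ xor (f · t′))))
          ≡⟨ trans (-1^-xor (x xor _) (x′ xor _)) (cong₂ Sign._*_ (-1^-xor x _) (-1^-xor x′ _)) ⟩
        (-1^ x Sign.* -1^ (σ c t xor (f · t))) Sign.* (-1^ x′ Sign.* -1^ (σ c t′ xor (f · t′))) ∎
        where
        open ≡.≡-Reasoning
        open xor-∧-Solver
        x = exponent s
        x′ = exponent s′
        β = proj₂ (span c t) · proj₁ (span c t′)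

module _ {i r k : ℕ} {S : Pred (Ē i) 0ℓ} (c : Code i r k) (S⊇ : ∀ t → S (span c t))
         (S⊆ : ∀ {x} → S x → Image c x) (χ : Character (preimage S)) where

  open Character χ using (homo; χ[-I]) renaming (χ to value)

  private
    0∈S : S 𝟘
    0∈S = subst S (span-𝟎 c) (S⊇ 𝟎)

    -- A character receives the membership proof as an argument. Multiplying by the identity with
    -- one fixed proof for the product, and cancelling the value at the identity, shows that the
    -- proof does not matter.
    value-cong : ∀ {g h} → g ≡ h → (g∈S : S (bar g)) (h∈S : S (bar h)) → value g g∈S ≡ value h h∈S
    value-cong {g} {h} refl g∈S h∈S = Sign.*-cancelʳ-≡ (value 1E 0∈S) (value g g∈S) (value h h∈S)
      (trans (sym (homo g 1E g∈S 0∈S g1∈S)) (homo h 1E h∈S 0∈S g1∈S))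
      where
      1E : E i
      1E = ⟪ Sign.+ , 𝟎 , 𝟎 ⟫
      g1∈S : S (bar (g ∙ 1E))
      g1∈S = subst S (sym (⊞-identityʳ (bar g))) g∈S

    h : U r → Bool
    h t = exponent (value (gen c t) (S⊇ t))

    exponent-* : ∀ s s′ → exponent (s Sign.* s′) ≡ exponent s xor exponent s′
    exponent-* Sign.+ s′     = refl
    exponent-* Sign.- Sign.+ = refl
    exponent-* Sign.- Sign.- = refl

    sign-cases : ∀ s s′ → s ≡ s′ ⊎ s ≡ Sign.opposite s′
    sign-cases Sign.+ Sign.+ = inj₁ refl
    sign-cases Sign.+ Sign.- = inj₂ refl
    sign-cases Sign.- Sign.+ = inj₂ refl
    sign-cases Sign.- Sign.- = inj₁ refl

    form : ∃ λ f → ∀ t → h t ≡ f · t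
    form = additive⇒· h λ t t′ → trans
      (cong exponent (trans (value-cong (sym (gen-∙ c t t′)) (S⊇ (t ⊕ t′)) (gg∈S t t′))
        (homo (gen c t) (gen c t′) (S⊇ t) (S⊇ t′) (gg∈S t t′))))
      (exponent-* (value (gen c t) (S⊇ t)) (value (gen c t′) (S⊇ t′)))
      where
      gg∈S : ∀ t t′ → S (bar (gen c t ∙ gen c t′))
      gg∈S t t′ = subst S (span-⊕ c t t′) (S⊇ (t ⊕ t′))

  characterForm : U r
  characterForm = proj₁ form

  -- An element over `span c t` is `gen c t` or its product with -I, where the value changes sign.
  -- So every character takes the values of an `image-character`.
  character≡ : ∀ s t (g∈S : S (span c t)) →
    value ⟪ s , proj₁ (span c t) , proj₂ (span c t) ⟫ g∈S ≡ s Sign.* -1^ (σ c t xor (characterForm · t))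
  character≡ s t g∈S = [ (λ { refl → base }) , (λ { refl → opposite-≡ (-1^ σ c t) base }) ]′ (sign-cases s (-1^ σ c t))
    where
    x = characterForm · t
    a = proj₁ (span c t)
    b = proj₂ (span c t)

    base : value (gen c t) g∈S ≡ -1^ σ c t Sign.* -1^ (σ c t xor x)
    base = begin
      value (gen c t) g∈S                    ≡⟨ value-cong refl g∈S (S⊇ t) ⟩
      value (gen c t) (S⊇ t)                 ≡⟨ s≡-1^exponent _ ⟩
      -1^ h t                                ≡⟨ cong -1^_ (proj₂ form t) ⟩
      -1^ x                                  ≡⟨ cong -1^_ (solve 2 (λ s x → x := s :+ (s :+ x)) refl (σ c t) x) ⟩
      -1^ (σ c t xor (σ c t xor x))          ≡⟨ -1^-xor (σ c t) _ ⟩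
      -1^ σ c t Sign.* -1^ (σ c t xor x)     ∎
      where
      open ≡.≡-Reasoning
      open xor-∧-Solver using (solve; _:=_; _:+_)

    opposite-≡ : ∀ s → value ⟪ s , a , b ⟫ g∈S ≡ s Sign.* -1^ (σ c t xor x) →
                 value ⟪ Sign.opposite s , a , b ⟫ g∈S ≡ Sign.opposite s Sign.* -1^ (σ c t xor x)
    opposite-≡ s e = begin
      value ⟪ Sign.opposite s , a , b ⟫ g∈S           ≡⟨ value-cong g≡ g∈S -g∈S ⟩
      value (-I ∙ ⟪ s , a , b ⟫) -g∈S                 ≡⟨ homo -I ⟪ s , a , b ⟫ 0∈S g∈S -g∈S ⟩
      value -I 0∈S Sign.* value ⟪ s , a , b ⟫ g∈S     ≡⟨ cong₂ Sign._*_ (χ[-I] 0∈S) e ⟩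
      Sign.- Sign.* (s Sign.* -1^ (σ c t xor x))      ≡⟨ Sign.*-assoc Sign.- s _ ⟨
      Sign.opposite s Sign.* -1^ (σ c t xor x)        ∎
      where
      open ≡.≡-Reasoning
      -g∈S : S (bar (-I ∙ ⟪ s , a , b ⟫))
      -g∈S = subst S (sym (⊞-identityˡ (a , b))) g∈S
      g≡ : ⟪ Sign.opposite s , a , b ⟫ ≡ -I ∙ ⟪ s , a , b ⟫
      g≡ rewrite ·-zeroˡ a | ⊕-identityˡ a | ⊕-identityˡ b = refl

⊑? : ∀ {i r r′ k k′} (c : Code i r k) (c′ : Code i r′ k′) →
     c ⊑ c′ ⊎ ∃ λ t → ∀ t′ → span c′ t′ ≢ span c t
⊑? c c′ with dec-∃ (λ t → ¬? (image-dec c′ (span c t)))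
... | yes (t , ∉) = inj₂ (t , λ t′ e → ∉ (t′ , sym e))
... | no ∄        = inj₁ λ t → decidable-stable (image-dec c′ (span c t)) (λ ∉ → ∄ (t , ∉))

ω-axis : ∀ {i} y (z : Ē i) → ω (cons false true 𝟘) (cons true y z) ≡ true
ω-axis y (a , b) = cong₂ (λ u v → (true xor u) xor v) (·-zeroˡ a) (cong₂ _xor_ (∧-zeroʳ y) (·-zeroʳ b))

-- Supplies the common T of the two planes at minimal distance.
standardCode : ∀ r k → Code (r ℕ.+ k) r k
standardCode zero    zero    = []
standardCode zero    (suc k) = twist [] (standardCode zero k)
standardCode (suc r) k       = axis (standardCode r k)

module Packing {c ℓ₁ ℓ₂ ℓ₃} (ℝ : RealField c ℓ₁ ℓ₂ ℓ₃) where

  open RealField ℝ using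
    ( Carrier; _≈_; _#_; _+_; _*_; -_; _-_; 0#; 1#; _<_; _≤_; _^_; ½; ½*2≈1; commutativeRing; ring; rawRing
    ; signed; √; √-square; √-nonneg; √-cong; 2^[_-1]/2; tight; #-cotrans; #⇒<; <⇒#; 0<1; *-pos; +-monoˡ-<
    ; <-isStrictPartialOrder )

  module R = CommutativeRing commutativeRing
  module RP = RingProperties ring
  module S = NaturalSolver R.commutativeSemiring
  open import Relation.Binary.Reasoning.Setoid R.setoid
  open IsStrictPartialOrder <-isStrictPartialOrder
    using (<-respˡ-≈; <-respʳ-≈) renaming (trans to <-trans; irrefl to <-irrefl)

  -- Order and finite sums in the field of scalars.

  2# : Carrier
  2# = 1# + 1#

  -- Takes the place of trichotomy. Since `_≤_` is a negation, even its transitivity rests on this.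
  <-cotrans : ∀ {x y} → x < y → ∀ z → x < z ⊎ z < y
  <-cotrans x<y z with #-cotrans (<⇒# x<y) z
  ... | inj₁ x#z with #⇒< x#z
  ...   | inj₁ x<z = inj₁ x<z
  ...   | inj₂ z<x = inj₂ (<-trans z<x x<y)
  <-cotrans x<y z | inj₂ z#y with #⇒< z#y
  ...   | inj₁ z<y = inj₂ z<y
  ...   | inj₂ y<z = inj₁ (<-trans x<y y<z)

  ≤-antisym : ∀ {x y} → x ≤ y → y ≤ x → x ≈ y
  ≤-antisym {x} {y} x≤y y≤x = proj₁ (tight x y) λ x#y → case (#⇒< x#y)
    where
    case : x < y ⊎ y < x → ⊥
    case (inj₁ x<y) = y≤x x<y
    case (inj₂ y<x) = x≤y y<x

  ≤-trans : ∀ {x y z} → x ≤ y → y ≤ z → x ≤ z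
  ≤-trans {y = y} x≤y y≤z z<x with <-cotrans z<x y
  ... | inj₁ z<y = y≤z z<y
  ... | inj₂ y<x = x≤y y<x

  ≤-reflexive : ∀ {x y} → x ≈ y → x ≤ y
  ≤-reflexive x≈y y<x = <-irrefl (R.sym x≈y) y<x

  ≤-respˡ : ∀ {x y z} → x ≈ y → x ≤ z → y ≤ z
  ≤-respˡ x≈y x≤z = ≤-trans (≤-reflexive (R.sym x≈y)) x≤z

  ≤-respʳ : ∀ {x y z} → x ≈ y → z ≤ x → z ≤ y
  ≤-respʳ x≈y z≤x = ≤-trans z≤x (≤-reflexive x≈y)

  x+z-z≈x : ∀ x z → (x + z) + - z ≈ x
  x+z-z≈x x z = R.trans (R.+-assoc x z (- z)) (R.trans (R.+-congˡ (R.-‿inverseʳ z)) (R.+-identityʳ x))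

  +-monoˡ-≤ : ∀ z {x y} → x ≤ y → x + z ≤ y + z
  +-monoˡ-≤ z {x} {y} x≤y lt =
    x≤y (<-respˡ-≈ (x+z-z≈x y z) (<-respʳ-≈ (x+z-z≈x x z) (+-monoˡ-< (- z) lt)))

  +-mono-≤ : ∀ {w x y z} → w ≤ x → y ≤ z → w + y ≤ x + z
  +-mono-≤ {w} {x} {y} {z} w≤x y≤z = ≤-trans (+-monoˡ-≤ y w≤x)
    (≤-respˡ (R.+-comm y x) (≤-respʳ (R.+-comm z x) (+-monoˡ-≤ x y≤z)))

  x≤x+y : ∀ x {y} → 0# ≤ y → x ≤ x + y
  x≤x+y x 0≤y = ≤-respˡ (R.+-identityʳ x) (+-mono-≤ (≤-reflexive R.refl) 0≤y)

  x-y≥0⇒y≤x : ∀ {x y} → 0# ≤ x + - y → y ≤ x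
  x-y≥0⇒y≤x {x} {y} h = ≤-respˡ (R.+-identityˡ y) (≤-respʳ
    (R.trans (R.+-assoc x (- y) y) (R.trans (R.+-congˡ (R.-‿inverseˡ y)) (R.+-identityʳ x)))
    (+-monoˡ-≤ y h))

  x<0⇒0<-x : ∀ {x} → x < 0# → 0# < - x
  x<0⇒0<-x {x} x<0 = <-respˡ-≈ (R.-‿inverseʳ x) (<-respʳ-≈ (R.+-identityˡ (- x)) (+-monoˡ-< (- x) x<0))

  -x*-y≈x*y : ∀ x y → - x * - y ≈ x * y
  -x*-y≈x*y x y = R.trans (R.sym (RP.-‿distribˡ-* x (- y)))
    (R.trans (R.-‿cong (R.sym (RP.-‿distribʳ-* x y))) (RP.-‿involutive (x * y)))

  #0⇒0<square : ∀ {x} → x # 0# → 0# < x * x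
  #0⇒0<square {x} x#0 with #⇒< x#0
  ... | inj₁ x<0 = <-respʳ-≈ (-x*-y≈x*y x x) (*-pos (x<0⇒0<-x x<0) (x<0⇒0<-x x<0))
  ... | inj₂ 0<x = *-pos 0<x 0<x

  square≈0⇒≈0 : ∀ {x} → x * x ≈ 0# → x ≈ 0#
  square≈0⇒≈0 {x} e = proj₁ (tight x 0#) λ x#0 → <-irrefl (R.sym e) (#0⇒0<square x#0)

  -- The sign of x cannot be decided. But if x * x were negative, x could not be apart from 0, so
  -- tightness would give x ≈ 0.
  square-nonneg : ∀ x → 0# ≤ x * x
  square-nonneg x x²<0 = <-irrefl (R.trans (R.*-congʳ x≈0) (R.zeroˡ x)) x²<0
    where
    x≈0 : x ≈ 0#
    x≈0 = proj₁ (tight x 0#) λ x#0 → <-irrefl R.refl (<-trans x²<0 (#0⇒0<square x#0))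

  double-cancel-≤ : ∀ {x y} → x + x ≤ y + y → x ≤ y
  double-cancel-≤ {x} {y} h y<x = h (<-trans (+-monoˡ-< y y<x)
    (<-respˡ-≈ (R.+-comm y x) (+-monoˡ-< x y<x)))

  square-cancel-≤ : ∀ {x y} → 0# ≤ y → x * x ≤ y * y → x ≤ y
  square-cancel-≤ {x} {y} 0≤y x²≤y² y<x = x²≤y² (<-respˡ-≈ (R.+-identityˡ (y * y))
    (<-respʳ-≈ expand (+-monoˡ-< (y * y) (*-pos 0<x-y 0<x+y))))
    where
    0<x-y : 0# < x + - y
    0<x-y = <-respˡ-≈ (R.-‿inverseʳ y) (+-monoˡ-< (- y) y<x)
    0<x : 0# < x
    0<x with <-cotrans y<x 0#
    ... | inj₁ y<0 = ⊥-elim (0≤y y<0)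
    ... | inj₂ 0<x = 0<x
    0<x+y : 0# < x + y
    0<x+y with <-cotrans 0<x (x + y)
    ... | inj₁ lt = lt
    ... | inj₂ lt = ⊥-elim (x≤x+y x 0≤y lt)
    expand : (x + - y) * (x + y) + y * y ≈ x * x
    expand = begin
      (x + - y) * (x + y) + y * y
        ≈⟨ S.solve 3 (λ x y n → (x S.:+ n) S.:* (x S.:+ y) S.:+ y S.:* y
                       S.:= x S.:* x S.:+ (x S.:+ y) S.:* (n S.:+ y)) R.refl x y (- y) ⟩
      x * x + (x + y) * (- y + y)
        ≈⟨ R.+-congˡ (R.trans (R.*-congˡ (R.-‿inverseˡ y)) (R.zeroʳ (x + y))) ⟩
      x * x + 0#
        ≈⟨ R.+-identityʳ (x * x) ⟩
      x * x ∎

  0≤1 : 0# ≤ 1#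
  0≤1 1<0 = <-irrefl R.refl (<-trans 0<1 1<0)

  private
    module Sum = SemiringSum R.semiring

  -- Opaque, so that the length of the vector can be inferred from a sum.
  opaque

    ∑[_] : ∀ {n} → Vector Carrier n → Carrier
    ∑[ f ] = sum ℝ f

    ∑≡sum : ∀ {n} (f : Vector Carrier n) → ∑[ f ] ≡ sum ℝ f
    ∑≡sum f = refl

    ∑-[] : (f : Vector Carrier 0) → ∑[ f ] ≈ 0#
    ∑-[] f = R.refl

    ∑-suc : ∀ {n} (f : Vector Carrier (suc n)) → ∑[ f ] ≈ f zero + ∑[ f ∘ suc ]
    ∑-suc f = R.refl

    ∑-cong : ∀ {n} {f g : Vector Carrier n} → (∀ j → f j ≈ g j) → ∑[ f ] ≈ ∑[ g ]
    ∑-cong = Sum.sum-cong-≋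

    ∑-distrib-+ : ∀ {n} (f g : Vector Carrier n) → ∑[ (λ j → f j + g j) ] ≈ ∑[ f ] + ∑[ g ]
    ∑-distrib-+ = Sum.∑-distrib-+

    ∑-comm : ∀ {m n} (f : Fin m → Fin n → Carrier) →
             ∑[ (λ i → ∑[ (λ j → f i j) ]) ] ≈ ∑[ (λ j → ∑[ (λ i → f i j) ]) ]
    ∑-comm = Sum.∑-comm

    *-distribˡ-sum : ∀ {n} x (f : Vector Carrier n) → x * ∑[ f ] ≈ ∑[ (λ j → x * f j) ]
    *-distribˡ-sum = Sum.*-distribˡ-sum

    *-distribʳ-sum : ∀ {n} x (f : Vector Carrier n) → ∑[ f ] * x ≈ ∑[ (λ j → f j * x) ]
    *-distribʳ-sum = Sum.*-distribʳ-sum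

    ∑-permute : ∀ {m n} (f : Vector Carrier n) (π : Permutation m n) → ∑[ f ] ≈ ∑[ (λ j → f (π ⟨$⟩ʳ j)) ]
    ∑-permute = Sum.∑-permute

    ∑-zero : ∀ {n} {f : Vector Carrier n} → (∀ j → f j ≈ 0#) → ∑[ f ] ≈ 0#
    ∑-zero {n} h = R.trans (∑-cong h) (Sum.sum-replicate-zero n)

  ∑-single : ∀ {n} (f : Vector Carrier n) j → (∀ l → l ≢ j → f l ≈ 0#) → ∑[ f ] ≈ f j
  ∑-single f zero    h = R.trans (∑-suc f) (R.trans (R.+-congˡ (∑-zero (λ l → h (suc l) λ ()))) (R.+-identityʳ _))
  ∑-single f (suc j) h = R.trans (∑-suc f) (R.trans (R.+-cong (h zero λ ())
    (∑-single (f ∘ suc) j λ l l≢j → h (suc l) (l≢j ∘ Fin.suc-injective))) (R.+-identityˡ _))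

  ∑-neg : ∀ {n} (f : Vector Carrier n) → ∑[ (λ j → - f j) ] ≈ - ∑[ f ]
  ∑-neg f = R.trans (∑-cong (λ j → R.sym (RP.-1*x≈-x (f j))))
    (R.trans (R.sym (*-distribˡ-sum (- 1#) f)) (RP.-1*x≈-x _))

  ∑-mono : ∀ {n} {f g : Vector Carrier n} → (∀ j → f j ≤ g j) → ∑[ f ] ≤ ∑[ g ]
  ∑-mono {zero}  {f} {g} h = ≤-reflexive (R.trans (∑-[] f) (R.sym (∑-[] g)))
  ∑-mono {suc n} {f} {g} h =
    ≤-respˡ (R.sym (∑-suc f)) (≤-respʳ (R.sym (∑-suc g)) (+-mono-≤ (h zero) (∑-mono (h ∘ suc))))

  ∑-nonneg : ∀ {n} {f : Vector Carrier n} → (∀ j → 0# ≤ f j) → 0# ≤ ∑[ f ]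
  ∑-nonneg {n} h = ≤-respˡ (∑-zero {n} (λ _ → R.refl)) (∑-mono h)

  ∑-nonneg-≈0 : ∀ {n} {f : Vector Carrier n} → (∀ j → 0# ≤ f j) → ∑[ f ] ≈ 0# → ∀ j → f j ≈ 0#
  ∑-nonneg-≈0 {f = f} h e zero    =
    ≤-antisym (≤-respʳ (R.trans (R.sym (∑-suc f)) e) (x≤x+y _ (∑-nonneg (h ∘ suc)))) (h zero)
  ∑-nonneg-≈0 {f = f} h e (suc j) = ∑-nonneg-≈0 (h ∘ suc) (≤-antisym
    (≤-respʳ (R.trans (R.+-comm _ _) (R.trans (R.sym (∑-suc f)) e)) (x≤x+y _ (h zero))) (∑-nonneg (h ∘ suc))) j

  ∑-++ : ∀ m {n} (f : Vector Carrier (m ℕ.+ n)) →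
         ∑[ f ] ≈ ∑[ (λ j → f (j ↑ˡ n)) ] + ∑[ (λ j → f (m ↑ʳ j)) ]
  ∑-++ zero    f = R.sym (R.trans (R.+-congʳ (∑-[] _)) (R.+-identityˡ _))
  ∑-++ (suc m) f = R.trans (R.trans (∑-suc f) (R.+-congˡ (∑-++ m (f ∘ suc))))
    (R.trans (R.sym (R.+-assoc _ _ _)) (R.+-congʳ (R.sym (∑-suc _))))

  card : ℕ → Carrier
  card n = ∑[ (λ (_ : Fin n) → 1#) ]

  ∑-const : ∀ n x → ∑[ (λ (_ : Fin n) → x) ] ≈ x * card n
  ∑-const n x = R.trans (∑-cong {n} (λ _ → R.sym (R.*-identityʳ x))) (R.sym (*-distribˡ-sum x (λ (_ : Fin n) → 1#)))

  card-2^ : ∀ k → card (2 ℕ.^ k) ≈ 2# ^ k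
  card-2^ zero    = R.trans (∑-suc _) (R.trans (R.+-congˡ (∑-[] _)) (R.+-identityʳ 1#))
  card-2^ (suc k) = begin
    card (2 ℕ.^ k ℕ.+ (2 ℕ.^ k ℕ.+ 0))
      ≈⟨ ∑-++ (2 ℕ.^ k) (λ _ → 1#) ⟩
    card (2 ℕ.^ k) + card (2 ℕ.^ k ℕ.+ 0)
      ≈⟨ R.+-congˡ (R.trans (∑-++ (2 ℕ.^ k) (λ _ → 1#)) (R.trans (R.+-congˡ (∑-[] _)) (R.+-identityʳ _))) ⟩
    card (2 ℕ.^ k) + card (2 ℕ.^ k)
      ≈⟨ R.+-cong (card-2^ k) (card-2^ k) ⟩
    2# ^ k + 2# ^ k
      ≈⟨ S.solve 1 (λ x → x S.:+ x S.:= (S.con 1 S.:+ S.con 1) S.:* x) R.refl (2# ^ k) ⟩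
    2# * 2# ^ k ∎

  2^-+ : ∀ r k → 2# ^ r * 2# ^ k ≈ 2# ^ (r ℕ.+ k)
  2^-+ zero    k = R.*-identityˡ _
  2^-+ (suc r) k = R.trans (R.*-assoc _ _ _) (R.*-congˡ (2^-+ r k))

  2*-cancel : ∀ {x y} → 2# * x ≈ 2# * y → x ≈ y
  2*-cancel {x} {y} e = begin
    x               ≈⟨ half x ⟨
    ½ * (2# * x)    ≈⟨ R.*-congˡ e ⟩
    ½ * (2# * y)    ≈⟨ half y ⟩
    y               ∎
    where
    half : ∀ x → ½ * (2# * x) ≈ x
    half x = R.trans (R.sym (R.*-assoc ½ 2# x)) (R.trans (R.*-congʳ ½*2≈1) (R.*-identityˡ x))

  2^*-cancel : ∀ r {x y} → 2# ^ r * x ≈ 2# ^ r * y → x ≈ y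
  2^*-cancel zero    e = R.trans (R.sym (R.*-identityˡ _)) (R.trans e (R.*-identityˡ _))
  2^*-cancel (suc r) e = 2^*-cancel r (2*-cancel (R.trans (R.sym (R.*-assoc _ _ _)) (R.trans e (R.*-assoc _ _ _))))

  x+x≈0⇒x≈0 : ∀ {x} → x + x ≈ 0# → x ≈ 0#
  x+x≈0⇒x≈0 {x} e = 2*-cancel (R.trans
    (S.solve 1 (λ x → (S.con 1 S.:+ S.con 1) S.:* x S.:= x S.:+ x) R.refl x) (R.trans e (R.sym (R.zeroʳ 2#))))

  x≈-x⇒x≈0 : ∀ {x} → x ≈ - x → x ≈ 0#
  x≈-x⇒x≈0 {x} e = x+x≈0⇒x≈0 (R.trans (R.+-congˡ e) (R.-‿inverseʳ x))

  -- Inner products of vectors.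

  infix 9 _●_
  _●_ : ∀ {m} → Vector Carrier m → Vector Carrier m → Carrier
  v ● w = ∑[ (λ p → v p * w p) ]

  ●≡⟨,⟩ : ∀ {m} (v w : Vector Carrier m) → v ● w ≡ ⟨_,_⟩ ℝ v w
  ●≡⟨,⟩ v w = ∑≡sum _

  ●-cong : ∀ {m} {v v′ w w′ : Vector Carrier m} → (∀ p → v p ≈ v′ p) → (∀ p → w p ≈ w′ p) → v ● w ≈ v′ ● w′
  ●-cong e e′ = ∑-cong (λ p → R.*-cong (e p) (e′ p))

  ●-comm : ∀ {m} (v w : Vector Carrier m) → v ● w ≈ w ● v
  ●-comm v w = ∑-cong (λ p → R.*-comm (v p) (w p))

  ●-+ˡ : ∀ {m} (u v w : Vector Carrier m) → (λ p → u p + v p) ● w ≈ u ● w + v ● w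
  ●-+ˡ u v w = R.trans (∑-cong (λ p → R.distribʳ (w p) (u p) (v p))) (∑-distrib-+ _ _)

  ●-*ˡ : ∀ {m} t (v w : Vector Carrier m) → (λ p → t * v p) ● w ≈ t * v ● w
  ●-*ˡ t v w = R.trans (∑-cong (λ p → R.*-assoc t (v p) (w p))) (R.sym (*-distribˡ-sum t _))

  ●-+ʳ : ∀ {m} (u v w : Vector Carrier m) → u ● (λ p → v p + w p) ≈ u ● v + u ● w
  ●-+ʳ u v w = R.trans (∑-cong (λ p → R.distribˡ (u p) (v p) (w p))) (∑-distrib-+ _ _)

  ●-*ʳ : ∀ {m} t (v w : Vector Carrier m) → v ● (λ p → t * w p) ≈ t * v ● w
  ●-*ʳ t v w = R.trans (●-comm v _) (R.trans (●-*ˡ t w v) (R.*-congˡ (●-comm w v)))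

  ●-∑ˡ : ∀ {m n} (t : Vector Carrier n) (v : Fin n → Vector Carrier m) w →
         (λ p → ∑[ (λ j → t j * v j p) ]) ● w ≈ ∑[ (λ j → t j * v j ● w) ]
  ●-∑ˡ t v w = begin
    ∑[ (λ p → ∑[ (λ j → t j * v j p) ] * w p) ]
      ≈⟨ ∑-cong (λ p → *-distribʳ-sum (w p) _) ⟩
    ∑[ (λ p → ∑[ (λ j → t j * v j p * w p) ]) ]
      ≈⟨ ∑-comm _ ⟩
    ∑[ (λ j → ∑[ (λ p → t j * v j p * w p) ]) ]
      ≈⟨ ∑-cong (λ j → ●-*ˡ (t j) (v j) w) ⟩
    ∑[ (λ j → t j * v j ● w) ] ∎

  ●-self-nonneg : ∀ {m} (v : Vector Carrier m) → 0# ≤ v ● v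
  ●-self-nonneg v = ∑-nonneg (λ p → square-nonneg (v p))

  private
    difference : ∀ {m} (v w : Vector Carrier m) →
      (λ p → v p + - w p) ● (λ p → v p + - w p) ≈ (v ● v + - v ● w) + (- v ● w + w ● w)
    difference v w = begin
      (λ p → v p + - w p) ● (λ p → v p + - w p)
        ≈⟨ ∑-cong (λ p → expand (v p) (w p)) ⟩
      ∑[ (λ p → (v p * v p + - (v p * w p)) + (- (v p * w p) + w p * w p)) ]
        ≈⟨ ∑-distrib-+ (λ p → v p * v p + - (v p * w p)) (λ p → - (v p * w p) + w p * w p) ⟩
      ∑[ (λ p → v p * v p + - (v p * w p)) ] + ∑[ (λ p → - (v p * w p) + w p * w p) ]
        ≈⟨ R.+-cong (∑-distrib-+ (λ p → v p * v p) (λ p → - (v p * w p)))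
                    (∑-distrib-+ (λ p → - (v p * w p)) (λ p → w p * w p)) ⟩
      (v ● v + ∑[ (λ p → - (v p * w p)) ]) + (∑[ (λ p → - (v p * w p)) ] + w ● w)
        ≈⟨ R.+-cong (R.+-congˡ (∑-neg _)) (R.+-congʳ (∑-neg _)) ⟩
      (v ● v + - v ● w) + (- v ● w + w ● w) ∎
      where
      expand : ∀ x y → (x + - y) * (x + - y) ≈ (x * x + - (x * y)) + (- (x * y) + y * y)
      expand x y = begin
        (x + - y) * (x + - y)
          ≈⟨ S.solve 2 (λ x y → (x S.:+ y) S.:* (x S.:+ y) S.:= (x S.:* x S.:+ x S.:* y) S.:+ (x S.:* y S.:+ y S.:* y))
               R.refl x (- y) ⟩
        (x * x + x * - y) + (x * - y + - y * - y)
          ≈⟨ R.+-cong (R.+-congˡ (R.sym (RP.-‿distribʳ-* x y))) (R.+-cong (R.sym (RP.-‿distribʳ-* x y)) (-x*-y≈x*y y y)) ⟩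
        (x * x + - (x * y)) + (- (x * y) + y * y) ∎

  -- The square of the distance from v to the line through the unit vector w
  -- is v ● v - (v ● w)².
  cauchy-schwarz : ∀ {m} (v w : Vector Carrier m) → w ● w ≈ 1# → (v ● w) * (v ● w) ≤ v ● v
  cauchy-schwarz v w unit = x-y≥0⇒y≤x (≤-respʳ (begin
    (λ p → v p + - (a * w p)) ● (λ p → v p + - (a * w p))
      ≈⟨ difference v (λ p → a * w p) ⟩
    (v ● v + - v ● (λ p → a * w p)) + (- v ● (λ p → a * w p) + (λ p → a * w p) ● (λ p → a * w p))
      ≈⟨ R.+-cong (R.+-congˡ (R.-‿cong (●-*ʳ a v w))) (R.+-cong (R.-‿cong (●-*ʳ a v w)) norm) ⟩
    (v ● v + - (a * a)) + (- (a * a) + a * a)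
      ≈⟨ R.trans (R.+-congˡ (R.-‿inverseˡ (a * a))) (R.+-identityʳ _) ⟩
    v ● v + - (a * a) ∎) (●-self-nonneg _))
    where
    a = v ● w
    norm : (λ p → a * w p) ● (λ p → a * w p) ≈ a * a
    norm = R.trans (●-*ˡ a w _) (R.*-congˡ (R.trans (●-*ʳ a w w) (R.trans (R.*-congˡ unit) (R.*-identityʳ a))))

  -- Square matrices with the Hilbert-Schmidt inner product

  Matrix : ℕ → Set c
  Matrix m = Fin m → Fin m → Carrier

  infix 9 _◆_
  _◆_ : ∀ {m} → Matrix m → Matrix m → Carrier
  A ◆ B = ∑[ (λ p → A p ● B p) ]

  ◆-comm : ∀ {m} (A B : Matrix m) → A ◆ B ≈ B ◆ A
  ◆-comm A B = ∑-cong (λ p → ●-comm (A p) (B p))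

  ◆-*ˡ : ∀ {m} t (A B : Matrix m) → (λ p q → t * A p q) ◆ B ≈ t * A ◆ B
  ◆-*ˡ t A B = R.trans (∑-cong (λ p → ●-*ˡ t (A p) (B p))) (R.sym (*-distribˡ-sum t _))

  ◆-∑ˡ : ∀ {m n} (t : Vector Carrier n) (A : Fin n → Matrix m) B →
         (λ p q → ∑[ (λ j → t j * A j p q) ]) ◆ B ≈ ∑[ (λ j → t j * A j ◆ B) ]
  ◆-∑ˡ t A B = begin
    ∑[ (λ p → (λ q → ∑[ (λ j → t j * A j p q) ]) ● B p) ]
      ≈⟨ ∑-cong (λ p → ●-∑ˡ t (λ j → A j p) (B p)) ⟩
    ∑[ (λ p → ∑[ (λ j → t j * A j p ● B p) ]) ]
      ≈⟨ ∑-comm _ ⟩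
    ∑[ (λ j → ∑[ (λ p → t j * A j p ● B p) ]) ]
      ≈⟨ ∑-cong (λ j → R.sym (*-distribˡ-sum (t j) (λ p → A j p ● B p))) ⟩
    ∑[ (λ j → t j * A j ◆ B) ] ∎

  ◆-∑ʳ : ∀ {m n} (t : Vector Carrier n) (A : Fin n → Matrix m) B →
         B ◆ (λ p q → ∑[ (λ j → t j * A j p q) ]) ≈ ∑[ (λ j → t j * B ◆ A j) ]
  ◆-∑ʳ t A B = R.trans (◆-comm B _) (R.trans (◆-∑ˡ t A B) (∑-cong (λ j → R.*-congˡ (◆-comm (A j) B))))

  -- The square norm of A - B is s - s - s + s = 0, and a vanishing sum of squares has vanishing
  -- terms.
  ◆-equal : ∀ {m} (A B : Matrix m) {s} → A ◆ A ≈ s → A ◆ B ≈ s → B ◆ B ≈ s → ∀ p q → A p q ≈ B p q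
  ◆-equal A B {s} aa ab bb p q = begin
    A p q                     ≈⟨ R.+-identityʳ _ ⟨
    A p q + 0#                ≈⟨ R.+-congˡ (R.-‿inverseˡ (B p q)) ⟨
    A p q + (- B p q + B p q) ≈⟨ R.+-assoc _ _ _ ⟨
    A p q + - B p q + B p q   ≈⟨ R.+-congʳ (square≈0⇒≈0 zero²) ⟩
    0# + B p q                ≈⟨ R.+-identityˡ _ ⟩
    B p q                     ∎
    where
    D : Matrix _
    D p q = A p q + - B p q
    total : ∑[ (λ p → D p ● D p) ] ≈ 0#
    total = begin
      ∑[ (λ p → D p ● D p) ]
        ≈⟨ ∑-cong (λ p → difference (A p) (B p)) ⟩
      ∑[ (λ p → (A p ● A p + - A p ● B p) + (- A p ● B p + B p ● B p)) ]
        ≈⟨ R.trans (∑-distrib-+ (λ p → A p ● A p + - A p ● B p) (λ p → - A p ● B p + B p ● B p))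
             (R.+-cong (∑-distrib-+ (λ p → A p ● A p) (λ p → - A p ● B p)) (∑-distrib-+ (λ p → - A p ● B p) (λ p → B p ● B p))) ⟩
      (A ◆ A + ∑[ (λ p → - A p ● B p) ]) + (∑[ (λ p → - A p ● B p) ] + B ◆ B)
        ≈⟨ R.+-cong (R.+-cong aa neg) (R.+-cong neg bb) ⟩
      (s + - s) + (- s + s)
        ≈⟨ R.+-cong (R.-‿inverseʳ s) (R.-‿inverseˡ s) ⟩
      0# + 0#
        ≈⟨ R.+-identityˡ 0# ⟩
      0# ∎
      where
      neg : ∑[ (λ p → - A p ● B p) ] ≈ - s
      neg = R.trans (∑-neg (λ p → A p ● B p)) (R.-‿cong ab)
    zero² : D p q * D p q ≈ 0#
    zero² = ∑-nonneg-≈0 (λ q → square-nonneg (D p q))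
      (∑-nonneg-≈0 (λ p → ●-self-nonneg (D p)) total p) q

  record Orthonormal {m} {I : Set} (p : I → Vector Carrier m) : Set ℓ₁ where
    field
      unit       : ∀ j → p j ● p j ≈ 1#
      orthogonal : ∀ {j l} → j ≢ l → p j ● p l ≈ 0#

  gram : ∀ {m n} → (Fin n → Vector Carrier m) → Matrix m
  gram p x y = ∑[ (λ j → p j x * p j y) ]

  -- For orthonormal p this is the trace of A compressed to their span, so traces can be read off
  -- from Hilbert-Schmidt products.
  gram-◆ : ∀ {m n} (p : Fin n → Vector Carrier m) A →
           gram p ◆ A ≈ ∑[ (λ j → p j ● (λ x → A x ● p j)) ]
  gram-◆ p A = begin
    gram p ◆ A
      ≈⟨ ∑-cong (λ x → ●-∑ˡ (λ j → p j x) p (A x)) ⟩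
    ∑[ (λ x → ∑[ (λ j → p j x * p j ● A x) ]) ]
      ≈⟨ ∑-comm _ ⟩
    ∑[ (λ j → ∑[ (λ x → p j x * p j ● A x) ]) ]
      ≈⟨ ∑-cong (λ j → ∑-cong (λ x → R.*-congˡ (●-comm (p j) (A x)))) ⟩
    ∑[ (λ j → p j ● (λ x → A x ● p j)) ] ∎

  gram-● : ∀ {m n} {p : Fin n → Vector Carrier m} → Orthonormal p → ∀ j x → gram p x ● p j ≈ p j x
  gram-● {p = p} ortho j x = R.trans (●-∑ˡ (λ l → p l x) p (p j)) (R.trans
    (∑-single _ j λ l l≢j → R.trans (R.*-congˡ (orthogonal l≢j)) (R.zeroʳ _))
    (R.trans (R.*-congˡ (unit j)) (R.*-identityʳ _)))
    where open Orthonormal ortho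

  gram-norm : ∀ {m n} {p : Fin n → Vector Carrier m} → Orthonormal p → gram p ◆ gram p ≈ card n
  gram-norm {p = p} ortho = R.trans (gram-◆ p (gram p))
    (∑-cong (λ j → R.trans (●-cong (λ _ → R.refl) (gram-● ortho j)) (Orthonormal.unit ortho j)))

  -- Signs and the operators X(a)Y(b).

  𝕍 : ℕ → Set c
  𝕍 i = Vector Carrier (2 ℕ.^ i)

  infix 4 _≋_
  _≋_ : ∀ {m} → Vector Carrier m → Vector Carrier m → Set ℓ₁
  v ≋ w = ∀ p → v p ≈ w p

  opaque

    -- Signs carry a Boolean exponent, so that composing them is `_xor_` and the solver over 𝔽₂ does
    -- the bookkeeping; opacity keeps the exponents from being unfolded.
    ± : Bool → Carrier → Carrier
    ± e x = signed (-1^ e) x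

  ±1 : Bool → Carrier
  ±1 e = ± e 1#

  opaque
    unfolding ±

    signed-cong : ∀ s {x y} → x ≈ y → signed s x ≈ signed s y
    signed-cong Sign.+ x≈y = x≈y
    signed-cong Sign.- x≈y = R.-‿cong x≈y

    ±-cong : ∀ e {x y} → x ≈ y → ± e x ≈ ± e y
    ±-cong e = signed-cong (-1^ e)

    ±≈ : ∀ e x → ± e x ≈ ±1 e * x
    ±≈ false x = R.sym (R.*-identityˡ x)
    ±≈ true  x = R.sym (RP.-1*x≈-x x)

    ±-± : ∀ e e′ x → ± e (± e′ x) ≈ ± (e xor e′) x
    ±-± false e′    x = R.refl
    ±-± true  false x = R.refl
    ±-± true  true  x = RP.-‿involutive x

    *-± : ∀ e x y → x * ± e y ≈ ± e (x * y)
    *-± false x y = R.refl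
    *-± true  x y = R.sym (RP.-‿distribʳ-* x y)

    ±*± : ∀ e x y → ± e x * ± e y ≈ x * y
    ±*± false x y = R.refl
    ±*± true  x y = -x*-y≈x*y x y

    ±-false : ∀ x → ± false x ≡ x
    ±-false x = refl

    ±-0 : ∀ e → ± e 0# ≈ 0#
    ±-0 false = R.refl
    ±-0 true  = RP.-0#≈0#

    ±-+ : ∀ e x y → ± e (x + y) ≈ ± e x + ± e y
    ±-+ e x y = R.trans (±≈ e (x + y)) (R.trans (R.distribˡ (±1 e) x y) (R.sym (R.+-cong (±≈ e x) (±≈ e y))))

    ±-flip : ∀ e x → ± (not e) x ≈ - ± e x
    ±-flip false x = R.refl
    ±-flip true  x = R.sym (RP.-‿involutive x)

    ∑-± : ∀ {n} e (f : Vector Carrier n) → ∑[ (λ j → ± e (f j)) ] ≈ ± e ∑[ f ]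
    ∑-± false f = R.refl
    ∑-± true  f = ∑-neg f

    ●-±ʳ : ∀ {m} e (v w : Vector Carrier m) → v ● (λ p → ± e (w p)) ≈ ± e (v ● w)
    ●-±ʳ e v w = R.trans (∑-cong (λ p → *-± e (v p) (w p))) (∑-± e _)

    -- op (a , b) is the operator X(a)Y(b).
    op : ∀ {i} → Ē i → 𝕍 i → 𝕍 i
    op (a , b) v p = ± (b · label (shift a p)) (v (shift a p))

    op≡ : ∀ {i} (x : Ē i) (v : 𝕍 i) p →
          op x v p ≡ ± (proj₂ x · label (shift (proj₁ x) p)) (v (shift (proj₁ x) p))
    op≡ x v p = refl

    act≡ : ∀ {i} e (x : Ē i) (v : 𝕍 i) p → act ℝ ⟪ -1^ e , proj₁ x , proj₂ x ⟫ v p ≡ ± e (op x v p)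
    act≡ e x v p = refl

    signed≡ : ∀ e x → signed (-1^ e) x ≡ ± e x
    signed≡ e x = refl

    op-cong : ∀ {i} (x : Ē i) {v w : 𝕍 i} → v ≋ w → op x v ≋ op x w
    op-cong (a , b) e p = ±-cong (b · label (shift a p)) (e (shift a p))

    op-± : ∀ {i} e (x : Ē i) (v : 𝕍 i) → op x (λ p → ± e (v p)) ≋ λ p → ± e (op x v p)
    op-± e (a , b) v p = let β = b · label (shift a p) in
      R.trans (±-± β e _) (R.trans (R.reflexive (cong (λ e → ± e (v (shift a p))) (xor-comm β e))) (R.sym (±-± e β _)))

    op-* : ∀ {i} t (x : Ē i) (v : 𝕍 i) → op x (λ p → t * v p) ≋ λ p → t * op x v p
    op-* t (a , b) v p = R.sym (*-± (b · label (shift a p)) t (v (shift a p)))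

    op-+ : ∀ {i} (x : Ē i) (v w : 𝕍 i) → op x (λ p → v p + w p) ≋ λ p → op x v p + op x w p
    op-+ (a , b) v w p = ±-+ (b · label (shift a p)) (v (shift a p)) (w (shift a p))

    op-0 : ∀ {i} (x : Ē i) → op x (λ _ → 0#) ≋ λ _ → 0#
    op-0 (a , b) p = ±-0 (b · label (shift a p))

    op-𝟘 : ∀ {i} (v : 𝕍 i) → op {i} 𝟘 v ≋ v
    op-𝟘 {i} v p = R.reflexive (≡.trans
      (cong (λ e → ± e (v (shift {i} 𝟎 p))) (·-zeroˡ (label {i} (shift {i} 𝟎 p)))) (cong v (shift-𝟎 i p)))

    op-op : ∀ {i} (x y : Ē i) (v : 𝕍 i) → op x (op y v) ≋ λ p → ± (proj₂ x · proj₁ y) (op (x ⊞ y) v p)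
    op-op (a , b) (a′ , b′) v p = R.trans (R.sym (act-∙ ℝ ⟪ Sign.+ , a , b ⟫ ⟪ Sign.+ , a′ , b′ ⟫ v p))
      (R.reflexive (cong (λ s → signed s (op ((a , b) ⊞ (a′ , b′)) v p)) (Sign.*-identityʳ (-1^ (b · a′)))))

    op-comm : ∀ {i} (x y : Ē i) (v : 𝕍 i) → op x (op y v) ≋ λ p → ± (ω x y) (op y (op x v) p)
    op-comm x@(a , b) y@(a′ , b′) v p = begin
      op x (op y v) p
        ≈⟨ op-op x y v p ⟩
      ± (b · a′) (op (x ⊞ y) v p)
        ≡⟨ cong₂ (λ e z → ± e (op z v p)) (solve 2 (λ s t → s := (s :+ t) :+ t) refl (b · a′) (b′ · a)) (⊞-comm x y) ⟩
      ± (ω x y xor (b′ · a)) (op (y ⊞ x) v p)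
        ≈⟨ ±-± (ω x y) (b′ · a) _ ⟨
      ± (ω x y) (± (b′ · a) (op (y ⊞ x) v p))
        ≈⟨ ±-cong (ω x y) (op-op y x v p) ⟨
      ± (ω x y) (op y (op x v) p) ∎
      where open xor-∧-Solver using (solve; _:=_; _:+_)

    op-isometry : ∀ {i} (x : Ē i) (v w : 𝕍 i) → op x v ● op x w ≈ v ● w
    op-isometry (a , b) v w = R.trans
      (∑-cong (λ p → ±*± (b · label (shift a p)) (v (shift a p)) (w (shift a p))))
      (R.sym (∑-permute (λ p → v p * w p) (shift-permutation a)))

  -- The matrices of the operators and their orthogonality.

  mat : ∀ {i} → Ē i → Matrix (2 ℕ.^ i)
  mat (a , b) p q with q Fin.≟ shift a p
  ... | yes _ = ±1 (b · label q)
  ... | no  _ = 0#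

  mat-yes : ∀ {i} (x : Ē i) p → mat x p (shift (proj₁ x) p) ≡ ±1 (proj₂ x · label (shift (proj₁ x) p))
  mat-yes (a , b) p with shift a p Fin.≟ shift a p
  ... | yes _ = refl
  ... | no ≢  = ⊥-elim (≢ refl)

  mat-no : ∀ {i} (x : Ē i) p q → q ≢ shift (proj₁ x) p → mat x p q ≡ 0#
  mat-no (a , b) p q q≢ with q Fin.≟ shift a p
  ... | yes q≡ = ⊥-elim (q≢ q≡)
  ... | no  _  = refl

  mat-● : ∀ {i} (x : Ē i) p (v : 𝕍 i) → mat x p ● v ≈ op x v p
  mat-● x@(a , b) p v = begin
    mat x p ● v
      ≈⟨ ∑-single _ (shift a p) (λ q q≢ → R.trans (R.*-congʳ (R.reflexive (mat-no x p q q≢))) (R.zeroˡ (v q))) ⟩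
    mat x p (shift a p) * v (shift a p)
      ≈⟨ R.*-congʳ (R.reflexive (mat-yes x p)) ⟩
    ±1 (b · label (shift a p)) * v (shift a p)
      ≈⟨ ±≈ (b · label (shift a p)) _ ⟨
    ± (b · label (shift a p)) (v (shift a p))
      ≡⟨ op≡ x v p ⟨
    op x v p ∎

  -- Translating the labels by some e with d · e = 1 permutes the terms and changes every sign, so
  -- the sum equals its negative.
  character-sum : ∀ {i} (d : U i) → d ≢ 𝟎 → ∑[ (λ p → ±1 (d · label p)) ] ≈ 0#
  character-sum d d≢𝟎 with e , eq ← ≢𝟎⇒∃·≡true d d≢𝟎 = x≈-x⇒x≈0 (begin
    ∑[ (λ p → ±1 (d · label p)) ]
      ≈⟨ ∑-permute _ (shift-permutation e) ⟩
    ∑[ (λ p → ±1 (d · label (shift e p))) ]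
      ≈⟨ ∑-cong (λ p → R.trans (R.reflexive (cong ±1 (≡.trans (cong (d ·_) (label-shift e p))
           (≡.trans (·-distribˡ-⊕ d (label p) e) (≡.trans (cong ((d · label p) xor_) eq) (xor-comm (d · label p) true))))))
           (±-flip (d · label p) 1#)) ⟩
    ∑[ (λ p → - ±1 (d · label p)) ]
      ≈⟨ ∑-neg _ ⟩
    - ∑[ (λ p → ±1 (d · label p)) ] ∎)

  mat-norm : ∀ {i} (x : Ē i) → mat x ◆ mat x ≈ card (2 ℕ.^ i)
  mat-norm x@(a , b) = ∑-cong λ p → R.trans (mat-● x p (mat x p)) (R.trans (R.reflexive (op≡ x (mat x p) p)) (R.trans
    (±-cong (b · label (shift a p)) (R.reflexive (mat-yes x p)))
    (R.trans (±-± (b · label (shift a p)) _ 1#) (R.reflexive (≡.trans (cong ±1 (xor-same (b · label (shift a p)))) (±-false 1#))))))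

  -- For different a the supports are disjoint. For equal a the product is the sum of the nontrivial
  -- character given by b ⊕ b′.
  mat-orthogonal : ∀ {i} (x y : Ē i) → x ≢ y → mat x ◆ mat y ≈ 0#
  mat-orthogonal x@(a , b) y@(a′ , b′) x≢y with a ≟U a′
  ... | no a≢a′ = ∑-zero λ p → R.trans (mat-● x p (mat y p)) (R.trans (R.reflexive (op≡ x (mat y p) p)) (R.trans
    (±-cong (b · label (shift a p)) (R.reflexive (mat-no y p (shift a p) (a≢a′ ∘ shift-injective a a′ p))))
    (±-0 (b · label (shift a p)))))
  ... | yes refl = begin
    mat x ◆ mat y
      ≈⟨ ∑-cong (λ p → R.trans (mat-● x p (mat y p)) (R.trans (R.reflexive (op≡ x (mat y p) p)) (R.trans
           (±-cong (b · label (shift a p)) (R.reflexive (mat-yes y p)))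
           (R.trans (±-± (b · label (shift a p)) (b′ · label (shift a p)) 1#)
             (R.reflexive (cong ±1 (≡.sym (·-distribʳ-⊕ (label (shift a p)) b b′)))))))) ⟩
    ∑[ (λ p → ±1 ((b ⊕ b′) · label (shift a p))) ]
      ≈⟨ ∑-permute (λ p → ±1 ((b ⊕ b′) · label p)) (shift-permutation a) ⟨
    ∑[ (λ p → ±1 ((b ⊕ b′) · label p)) ]
      ≈⟨ character-sum (b ⊕ b′) (λ e → x≢y (cong (a ,_) (⊕≡𝟎⇒≡ b b′ e))) ⟩
    0# ∎

  -- Eigenspaces and their projections.

  -- gen c t acts as op (span c t) up to the sign (-1)^(σ c t), so this is the joint
  -- eigenspace of the gen c t for the eigenvalues (-1)^(f·t).
  Plane : ∀ {i r k} → Code i r k → U r → Subset ℝ (2 ℕ.^ i)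
  Plane c f v = ∀ t → op (span c t) v ≋ λ p → ± (σ c t xor (f · t)) (v p)

  module _ {i r k} (c : Code i r k) (f : U r) where

    private
      eigenvalue : Fin (2 ℕ.^ r) → Bool
      eigenvalue t = σ c (label t) xor (f · label t)

      N : Matrix (2 ℕ.^ i)
      N p q = ∑[ (λ t → ±1 (eigenvalue t) * mat (span c (label t)) p q) ]

    module _ (v : Fin (2 ℕ.^ k) → 𝕍 i) (ortho : Orthonormal v) (v∈ : ∀ j → Plane c f (v j)) where

      private
        gram-mat : ∀ (x : Ē i) → gram v ◆ mat x ≈ ∑[ (λ j → v j ● op x (v j)) ]
        gram-mat x = R.trans (gram-◆ v (mat x)) (∑-cong (λ j → ●-cong (λ _ → R.refl) (λ p → mat-● x p (v j))))

        gram-span : ∀ t → ±1 (eigenvalue t) * gram v ◆ mat (span c (label t)) ≈ card (2 ℕ.^ k)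
        gram-span t = begin
          ±1 e * gram v ◆ mat (span c (label t))
            ≈⟨ R.*-congˡ (R.trans (gram-mat _) (∑-cong (λ j → R.trans
                 (R.trans (●-cong (λ _ → R.refl) ((v∈ j) (label t))) (●-±ʳ e (v j) (v j)))
                 (±-cong e (Orthonormal.unit ortho j))))) ⟩
          ±1 e * ∑[ (λ (_ : Fin (2 ℕ.^ k)) → ±1 e) ]
            ≈⟨ *-distribˡ-sum (±1 e) _ ⟩
          ∑[ (λ (_ : Fin (2 ℕ.^ k)) → ±1 e * ±1 e) ]
            ≈⟨ ∑-cong {2 ℕ.^ k} (λ _ → R.trans (±*± e 1# 1#) (R.*-identityˡ 1#)) ⟩
          card (2 ℕ.^ k) ∎
          where e = eigenvalue t

        C K : Carrier
        C = 2# ^ r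
        K = 2# ^ k

        N-gram : (λ p q → C * gram v p q) ◆ N ≈ C * (K * C)
        N-gram = begin
          (λ p q → C * gram v p q) ◆ N
            ≈⟨ ◆-*ˡ C (gram v) N ⟩
          C * gram v ◆ N
            ≈⟨ R.*-congˡ (◆-∑ʳ (λ t → ±1 (eigenvalue t)) (λ t → mat (span c (label t))) (gram v)) ⟩
          C * ∑[ (λ t → ±1 (eigenvalue t) * gram v ◆ mat (span c (label t))) ]
            ≈⟨ R.*-congˡ (R.trans (∑-cong gram-span) (∑-const (2 ℕ.^ r) (card (2 ℕ.^ k)))) ⟩
          C * (card (2 ℕ.^ k) * card (2 ℕ.^ r))
            ≈⟨ R.*-congˡ (R.*-cong (card-2^ k) (card-2^ r)) ⟩
          C * (K * C) ∎

        N-mat : ∀ t → N ◆ mat (span c (label t)) ≈ ±1 (eigenvalue t) * card (2 ℕ.^ i)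
        N-mat t = R.trans (◆-∑ˡ (λ t → ±1 (eigenvalue t)) (λ t → mat (span c (label t))) _)
          (R.trans (∑-single _ t λ l l≢t → R.trans (R.*-congˡ
            (mat-orthogonal _ _ (l≢t ∘ label-injective ∘ span-injective c))) (R.zeroʳ _))
            (R.*-congˡ (mat-norm (span c (label t)))))

        -- There are 2^r mutually orthogonal summands of square norm 2^i, and 2^i = 2^r 2^k by
        -- `rank+defect`. This is what matches the 2^k vectors of the family.
        N-norm : N ◆ N ≈ C * (K * C)
        N-norm = begin
          N ◆ N
            ≈⟨ ◆-∑ʳ (λ t → ±1 (eigenvalue t)) (λ t → mat (span c (label t))) N ⟩
          ∑[ (λ t → ±1 (eigenvalue t) * N ◆ mat (span c (label t))) ]
            ≈⟨ ∑-cong (λ t → let e = eigenvalue t in R.trans (R.*-congˡ (N-mat t)) (R.trans (R.sym (R.*-assoc _ _ _))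
                 (R.trans (R.*-congʳ (R.trans (±*± e 1# 1#) (R.*-identityˡ 1#))) (R.*-identityˡ _)))) ⟩
          ∑[ (λ (_ : Fin (2 ℕ.^ r)) → card (2 ℕ.^ i)) ]
            ≈⟨ ∑-const (2 ℕ.^ r) (card (2 ℕ.^ i)) ⟩
          card (2 ℕ.^ i) * card (2 ℕ.^ r)
            ≈⟨ R.*-cong (R.trans (card-2^ i) (R.trans (R.reflexive (cong (2# ^_) (rank+defect c))) (R.sym (2^-+ r k)))) (card-2^ r) ⟩
          (C * K) * C
            ≈⟨ R.*-assoc C K C ⟩
          C * (K * C) ∎

        gram-norm′ : (λ p q → C * gram v p q) ◆ (λ p q → C * gram v p q) ≈ C * (K * C)
        gram-norm′ = begin
          (λ p q → C * gram v p q) ◆ (λ p q → C * gram v p q)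
            ≈⟨ ◆-*ˡ C (gram v) _ ⟩
          C * gram v ◆ (λ p q → C * gram v p q)
            ≈⟨ R.*-congˡ (R.trans (◆-comm (gram v) _) (◆-*ˡ C (gram v) (gram v))) ⟩
          C * (C * gram v ◆ gram v)
            ≈⟨ R.*-congˡ (R.trans (R.*-congˡ (R.trans (gram-norm ortho) (card-2^ k))) (R.*-comm C K)) ⟩
          C * (K * C) ∎

      -- Both sides are the projection onto the plane, up to the factor 2^r:
      -- they have the same norm, which is also their Hilbert-Schmidt product.
      gram≈∑mat : ∀ p q → 2# ^ r * gram v p q ≈ ∑[ (λ t → ±1 (eigenvalue t) * mat (span c (label t)) p q) ]
      gram≈∑mat = ◆-equal (λ p q → C * gram v p q) N gram-norm′ N-gram N-norm

      trace≈0 : ∀ (x : Ē i) → (∀ t → span c t ≢ x) → ∑[ (λ j → v j ● op x (v j)) ] ≈ 0#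
      trace≈0 x x∉ = 2^*-cancel r (begin
        C * ∑[ (λ j → v j ● op x (v j)) ]
          ≈⟨ R.*-congˡ (gram-mat x) ⟨
        C * gram v ◆ mat x
          ≈⟨ ◆-*ˡ C (gram v) (mat x) ⟨
        (λ p q → C * gram v p q) ◆ mat x
          ≈⟨ ∑-cong (λ p → ●-cong (gram≈∑mat p) (λ _ → R.refl)) ⟩
        N ◆ mat x
          ≈⟨ ◆-∑ˡ (λ t → ±1 (eigenvalue t)) (λ t → mat (span c (label t))) (mat x) ⟩
        ∑[ (λ t → ±1 (eigenvalue t) * mat (span c (label t)) ◆ mat x) ]
          ≈⟨ ∑-zero (λ t → R.trans (R.*-congˡ (mat-orthogonal _ x (x∉ (label t)))) (R.zeroʳ _)) ⟩
        0#
          ≈⟨ R.zeroʳ C ⟨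
        C * 0# ∎)

      -- Each of the 2^r operators, multiplied by its eigenvalue, fixes x. Their sum therefore maps
      -- x to 2^r x, and it is also 2^r times the Gram matrix.
      expansion : ∀ x → Plane c f x → ∀ p → x p ≈ ∑[ (λ j → v j ● x * v j p) ]
      expansion x x∈ p = 2^*-cancel r (begin
        C * x p
          ≈⟨ R.trans (R.*-comm C (x p)) (R.*-congˡ (R.sym (card-2^ r))) ⟩
        x p * card (2 ℕ.^ r)
          ≈⟨ ∑-const (2 ℕ.^ r) (x p) ⟨
        ∑[ (λ (_ : Fin (2 ℕ.^ r)) → x p) ]
          ≈⟨ ∑-cong (λ t → R.sym (R.trans (R.*-congˡ (x∈ (label t) p))
               (R.trans (±*± (eigenvalue t) 1# (x p)) (R.*-identityˡ (x p))))) ⟩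
        ∑[ (λ t → ±1 (eigenvalue t) * op (span c (label t)) x p) ]
          ≈⟨ ∑-cong (λ t → R.*-congˡ (mat-● (span c (label t)) p x)) ⟨
        ∑[ (λ t → ±1 (eigenvalue t) * mat (span c (label t)) p ● x) ]
          ≈⟨ ●-∑ˡ (λ t → ±1 (eigenvalue t)) (λ t → mat (span c (label t)) p) x ⟨
        N p ● x
          ≈⟨ ●-cong (gram≈∑mat p) (λ _ → R.refl) ⟨
        (λ q → C * gram v p q) ● x
          ≈⟨ ●-*ˡ C (gram v p) x ⟩
        C * gram v p ● x
          ≈⟨ R.*-congˡ (R.trans (●-∑ˡ (λ j → v j p) v x) (∑-cong (λ j → R.*-comm (v j p) (v j ● x)))) ⟩
        C * ∑[ (λ j → v j ● x * v j p) ] ∎)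

  open xor-∧-Solver using (solve; _:=_; _:+_; _:*_; con)

  module _ {i r k} (c : Code i r k) (f : U r) where

    plane-resp : ∀ {v w} → v ≋ w → Plane c f v → Plane c f w
    plane-resp e v∈ = λ t p → R.trans (op-cong (span c t) (R.sym ∘ e) p)
      (R.trans (v∈ t p) (±-cong _ (e p)))

    plane-0 : Plane c f (λ _ → 0#)
    plane-0 = λ t p → R.trans (op-0 (span c t) p) (R.sym (±-0 _))

    plane-+ : ∀ {v w} → Plane c f v → Plane c f w → Plane c f (λ p → v p + w p)
    plane-+ {v} {w} v∈ w∈ = λ t p → R.trans (op-+ (span c t) v w p)
      (R.trans (R.+-cong (v∈ t p) (w∈ t p)) (R.sym (±-+ _ (v p) (w p))))

    plane-* : ∀ a {v} → Plane c f v → Plane c f (λ p → a * v p)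
    plane-* a {v} v∈ = λ t p → R.trans (op-* a (span c t) v p)
      (R.trans (R.*-congˡ (v∈ t p)) (*-± _ a (v p)))

  -- Eigenspaces in the two halves of V.

  private
    at : ∀ {i} → (Bool → 𝕍 i) → U (suc i) → Carrier
    at v (z ∷ u) = v z (index u)

  opaque

    -- V (suc i) is the direct sum of two copies of V i, by the first coordinate
    -- of the label.
    join : ∀ {i} → (Bool → 𝕍 i) → 𝕍 (suc i)
    join {i} v p = at {i} v (label {suc i} p)

    join≡ : ∀ {i} (v : Bool → 𝕍 i) p → join {i} v p ≡ at {i} v (label p)
    join≡ v p = refl

  private
    at-⊕ : ∀ {i} x y (s : Ē i) (v : Bool → 𝕍 i) z u →
      ± ((y ∷ proj₂ s) · ((z ∷ u) ⊕ (x ∷ proj₁ s))) (at v ((z ∷ u) ⊕ (x ∷ proj₁ s)))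
      ≈ ± (y ∧ (z xor x)) (op s (v (z xor x)) (index u))
    at-⊕ x y (a , b) v z u = R.trans (R.sym (±-± (y ∧ (z xor x)) (b · (u ⊕ a)) _))
      (±-cong (y ∧ (z xor x)) (R.reflexive (≡.sym (≡.trans (op≡ (a , b) _ (index u)) (cong₂ (λ u p → ± (b · u) (v (z xor x) p))
        (≡.trans (label-shift a (index u)) (cong (_⊕ a) (label-index u)))
        (cong (λ u → index (u ⊕ a)) (label-index u)))))))

  -- The bit x exchanges the halves and y negates the half labelled `true`. Since Y acts before X,
  -- the sign is read off at the source half z xor x.
  op-join : ∀ {i} x y (s : Ē i) (v : Bool → 𝕍 i) e →
    (∀ z p → ± (y ∧ (z xor x)) (op s (v (z xor x)) p) ≈ ± e (v z p)) →
    op (cons x y s) (join {i} v) ≋ λ p → ± e (join {i} v p)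
  op-join {i} x y (a , b) v e h p = R.trans
    (R.reflexive (≡.trans (op≡ (cons x y (a , b)) (join {i} v) p)
      (≡.trans (cong (± ((y ∷ b) · label (shift (x ∷ a) p))) (join≡ v (shift (x ∷ a) p)))
        (cong (λ u → ± ((y ∷ b) · u) (at v u)) (label-shift (x ∷ a) p)))))
    (R.trans (halves (label p)) (R.reflexive (cong (± e) (≡.sym (join≡ v p)))))
    where
    halves : ∀ u → ± ((y ∷ b) · (u ⊕ (x ∷ a))) (at v (u ⊕ (x ∷ a))) ≈ ± e (at v u)
    halves (z ∷ u) = R.trans (at-⊕ x y (a , b) v z u) (h z (index u))

  axis-plane : ∀ {i r k} (c : Code i r k) φ f (v : Bool → 𝕍 i) →
    Plane c f (v φ) → v (not φ) ≋ (λ _ → 0#) → Plane (axis c) (φ ∷ f) (join {i} v)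
  axis-plane {i} c φ f v v∈ v≈0 = λ { (τ ∷ t) →
    op-join false τ (span c t) v (σ c t xor ((φ ∧ τ) xor (f · t))) (halves φ v v∈ v≈0 τ t) }
    where
    same : ∀ φ (w : 𝕍 i) → Plane c f w → ∀ τ t p →
      ± (τ ∧ φ) (op (span c t) w p) ≈ ± (σ c t xor ((φ ∧ τ) xor (f · t))) (w p)
    same φ w w∈ τ t p = R.trans (±-cong (τ ∧ φ) (w∈ t p)) (R.trans (±-± (τ ∧ φ) _ (w p))
      (R.reflexive (cong (λ e → ± e (w p))
        (solve 4 (λ τ φ s g → τ :* φ :+ (s :+ g) := s :+ (φ :* τ :+ g)) refl τ φ (σ c t) (f · t)))))
    vanish : ∀ (w : 𝕍 i) → w ≋ (λ _ → 0#) → ∀ e e′ t p → ± e (op (span c t) w p) ≈ ± e′ (w p)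
    vanish w w≈0 e e′ t p = R.trans
      (R.trans (±-cong e (R.trans (op-cong (span c t) w≈0 p) (op-0 (span c t) p))) (±-0 e))
      (R.sym (R.trans (±-cong e′ (w≈0 p)) (±-0 e′)))
    halves : ∀ φ (v : Bool → 𝕍 i) → Plane c f (v φ) → v (not φ) ≋ (λ _ → 0#) → ∀ τ t z p →
      ± (τ ∧ (z xor false)) (op (span c t) (v (z xor false)) p) ≈ ± (σ c t xor ((φ ∧ τ) xor (f · t))) (v z p)
    halves false v v∈ v≈0 τ t false p = same false (v false) v∈ τ t p
    halves false v v∈ v≈0 τ t true  p = vanish (v true) v≈0 _ _ t p
    halves true  v v∈ v≈0 τ t false p = vanish (v false) v≈0 _ _ t p
    halves true  v v∈ v≈0 τ t true  p = same true (v true) v∈ τ t p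

  -- On the half labelled `true` the height of `span (twist g c) t` contributes the sign (-1)^(g·t),
  -- which shifts the form there by g.
  twist-plane : ∀ {i r k} (g : U r) (c : Code i r k) f (v : Bool → 𝕍 i) →
    Plane c f (v false) → Plane c (f ⊕ g) (v true) → Plane (twist g c) f (join {i} v)
  twist-plane g c f v v₀∈ v₁∈ = λ t →
    op-join false (g · t) (span c t) v (σ c t xor (f · t)) λ
      { false p → R.trans (±-cong _ (v₀∈ t p)) (R.trans (±-± _ _ (v false p))
          (R.reflexive (cong (λ e → ± e (v false p)) (cong (_xor (σ c t xor (f · t))) (∧-zeroʳ (g · t))))))
      ; true  p → R.trans (±-cong _ (v₁∈ t p)) (R.trans (±-± _ _ (v true p))
          (R.reflexive (cong (λ e → ± e (v true p)) (≡.trans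
            (cong (λ x → ((g · t) ∧ true) xor (σ c t xor x)) (·-distribʳ-⊕ t f g))
            (solve 3 (λ G s F → G :* con true :+ (s :+ (F :+ G)) := s :+ F) refl (g · t) (σ c t) (f · t))))))
      }

  -- The lift of w exchanges the halves, so its eigenvalue ties the second half to the image of the
  -- first under `op w`. Elements of T meet `op w` on the second half, and their heights `ω w s`
  -- cancel the sign from commuting past it.
  tilt-plane : ∀ {i r k} m n (c : Code i r k) φ f (v : Bool → 𝕍 i) → Plane c f (v false) →
    v true ≋ (λ p → ± φ (op (complement c m n) (v false) p)) → Plane (tilt m n c) (φ ∷ f) (join {i} v)
  tilt-plane {i} m n c φ f v v∈ v₁≈ = λ
    { (false ∷ t) → op-join false (ω w (s t)) (s t) v (σ c t xor ((φ ∧ false) xor (f · t))) λ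
      { false p → R.trans (±-cong _ (v∈ t p)) (R.trans (±-± _ _ (v false p)) (R.reflexive
          (cong (λ e → ± e (v false p))
            (solve 4 (λ O S p F → O :* con false :+ (S :+ F) := S :+ (p :* con false :+ F)) refl
              (ω w (s t)) (σ c t) φ (f · t)))))
      ; true  p → begin
          ± (ω w (s t) ∧ true) (op (s t) (v true) p)
            ≈⟨ ±-cong (ω w (s t) ∧ true) (s-v₁ t p) ⟩
          ± (ω w (s t) ∧ true) (± (e t) (op w b p))
            ≈⟨ ±-± (ω w (s t) ∧ true) (e t) _ ⟩
          ± ((ω w (s t) ∧ true) xor e t) (op w b p)
            ≡⟨ cong (λ e → ± e (op w b p)) (solve 4 (λ O S p F → O :* con true :+ (p :+ (O :+ (S :+ F)))
                 := (S :+ (p :* con false :+ F)) :+ p) refl (ω w (s t)) (σ c t) φ (f · t)) ⟩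
          ± ((σ c t xor ((φ ∧ false) xor (f · t))) xor φ) (op w b p)
            ≈⟨ R.trans (±-cong _ (v₁≈ p)) (±-± _ φ (op w b p)) ⟨
          ± (σ c t xor ((φ ∧ false) xor (f · t))) (v true p) ∎
      }
    ; (true ∷ t) → op-join true (y t) (w ⊞ s t) v ((β t xor σ c t) xor ((φ ∧ true) xor (f · t))) λ
      { false p → begin
          ± (y t ∧ true) (op (w ⊞ s t) (v true) p)
            ≈⟨ ±-cong (y t ∧ true) (R.trans (op-⊞ w (s t) (v true) p) (±-cong (β t) (op-cong w (s-v₁ t) p))) ⟩
          ± (y t ∧ true) (± (β t) (op w (λ p → ± (e t) (op w b p)) p))
            ≈⟨ ±-cong (y t ∧ true) (±-cong (β t) (R.trans (op-± (e t) w _ p) (±-cong (e t)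
                 (R.trans (op-op w w b p) (±-cong (q w) (R.trans (R.reflexive (cong (λ z → op z b p) (⊞-self w))) (op-𝟘 b p))))))) ⟩
          ± (y t ∧ true) (± (β t) (± (e t) (± (q w) (b p))))
            ≈⟨ ±-cong (y t ∧ true) (R.trans (±-cong (β t) (±-± (e t) (q w) (b p))) (±-± (β t) _ (b p))) ⟩
          ± (y t ∧ true) (± (β t xor (e t xor q w)) (b p))
            ≈⟨ ±-± (y t ∧ true) _ (b p) ⟩
          ± ((y t ∧ true) xor (β t xor (e t xor q w))) (b p)
            ≡⟨ cong (λ e → ± e (b p)) (solve 6 (λ Q O B S p F →
                 (Q :+ O) :* con true :+ (B :+ ((p :+ (O :+ (S :+ F))) :+ Q)) := (B :+ S) :+ (p :* con true :+ F))
                 refl (q w) (ω w (s t)) (β t) (σ c t) φ (f · t)) ⟩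
          ± ((β t xor σ c t) xor ((φ ∧ true) xor (f · t))) (b p) ∎
      ; true p → begin
          ± (y t ∧ false) (op (w ⊞ s t) b p)
            ≈⟨ ±-cong (y t ∧ false) (R.trans (op-⊞ w (s t) b p) (±-cong (β t)
                 (R.trans (op-cong w (v∈ t) p) (op-± (σ c t xor (f · t)) w b p)))) ⟩
          ± (y t ∧ false) (± (β t) (± (σ c t xor (f · t)) (op w b p)))
            ≈⟨ R.trans (±-cong (y t ∧ false) (±-± (β t) _ _)) (±-± (y t ∧ false) _ _) ⟩
          ± ((y t ∧ false) xor (β t xor (σ c t xor (f · t)))) (op w b p)
            ≡⟨ cong (λ e → ± e (op w b p)) (solve 5 (λ Y B S p F →
                 Y :* con false :+ (B :+ (S :+ F)) := ((B :+ S) :+ (p :* con true :+ F)) :+ p)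
                 refl (y t) (β t) (σ c t) φ (f · t)) ⟩
          ± (((β t xor σ c t) xor ((φ ∧ true) xor (f · t))) xor φ) (op w b p)
            ≈⟨ R.trans (±-cong _ (v₁≈ p)) (±-± _ φ (op w b p)) ⟨
          ± ((β t xor σ c t) xor ((φ ∧ true) xor (f · t))) (v true p) ∎
      }
    }
    where
    w : Ē i
    w = complement c m n
    b : 𝕍 i
    b = v false
    s : U _ → Ē i
    s = span c
    y e β : U _ → Bool
    y t = q w xor ω w (s t)
    e t = φ xor (ω w (s t) xor (σ c t xor (f · t)))
    β t = proj₂ w · proj₁ (s t)
    op-⊞ : ∀ (x y : Ē i) u → op (x ⊞ y) u ≋ λ p → ± (proj₂ x · proj₁ y) (op x (op y u) p)
    op-⊞ x y u p = R.sym (R.trans (±-cong _ (op-op x y u p)) (R.trans (±-± _ _ _)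
      (R.reflexive (≡.trans (cong (λ e → ± e (op (x ⊞ y) u p)) (xor-same (proj₂ x · proj₁ y))) (±-false _)))))
    s-v₁ : ∀ t → op (s t) (v true) ≋ λ p → ± (e t) (op w b p)
    s-v₁ t p = begin
      op (s t) (v true) p
        ≈⟨ R.trans (op-cong (s t) v₁≈ p) (op-± φ (s t) (op w b) p) ⟩
      ± φ (op (s t) (op w b) p)
        ≈⟨ ±-cong φ (op-comm (s t) w b p) ⟩
      ± φ (± (ω (s t) w) (op w (op (s t) b) p))
        ≡⟨ cong (λ x → ± φ (± x (op w (op (s t) b) p))) (ω-comm (s t) w) ⟩
      ± φ (± (ω w (s t)) (op w (op (s t) b) p))
        ≈⟨ ±-cong φ (±-cong (ω w (s t)) (R.trans (op-cong w (v∈ t) p) (op-± _ w b p))) ⟩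
      ± φ (± (ω w (s t)) (± (σ c t xor (f · t)) (op w b p)))
        ≈⟨ R.trans (±-cong φ (±-± (ω w (s t)) _ _)) (±-± φ _ _) ⟩
      ± (e t) (op w b p) ∎

  -- Orthonormal bases of the planes.

  ∑-halves : ∀ i (g : 𝕍 (suc i)) →
    ∑[ g ] ≈ ∑[ (λ p → g (index (false ∷ label {i} p))) ] + ∑[ (λ p → g (index (true ∷ label {i} p))) ]
  ∑-halves i g = R.trans (∑-++ (2 ℕ.^ i) g) (R.+-cong
    (∑-cong (λ p → R.reflexive (cong (λ j → g (j ↑ˡ _)) (≡.sym (index-label i p)))))
    -- The exponent unfolds to 2^i + (2^i + 0), so an empty tail has to be split off as well.
    (R.trans (∑-++ (2 ℕ.^ i) {0} _) (R.trans (R.+-congˡ (∑-[] _)) (R.trans (R.+-identityʳ _)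
      (∑-cong (λ p → R.reflexive (cong (λ j → g (2 ℕ.^ i ↑ʳ (j ↑ˡ 0))) (≡.sym (index-label i p)))))))))

  join-● : ∀ {i} (v w : Bool → 𝕍 i) → join {i} v ● join {i} w ≈ v false ● w false + v true ● w true
  join-● {i} v w = R.trans (∑-halves i _) (R.+-cong (half false) (half true))
    where
    half : ∀ z → ∑[ (λ p → join {i} v (index (z ∷ label {i} p)) * join {i} w (index (z ∷ label {i} p))) ] ≈ v z ● w z
    half z = ∑-cong λ p → R.reflexive (≡.trans (cong₂ _*_ (join≡ {i} v (index (z ∷ label {i} p))) (join≡ {i} w (index (z ∷ label {i} p)))) (≡.trans
      (cong (λ u → at {i} v u * at {i} w u) (label-index (z ∷ label {i} p)))
      (cong (λ p → v z p * w z p) (index-label i p))))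

  select : ∀ {i} → Bool → 𝕍 i → Bool → 𝕍 i
  select false b false = b
  select false b true  = λ _ → 0#
  select true  b false = λ _ → 0#
  select true  b true  = b

  0-● : ∀ {m} (v : Vector Carrier m) → (λ _ → 0#) ● v ≈ 0#
  0-● v = ∑-zero (λ p → R.zeroˡ (v p))

  ●-0 : ∀ {m} (v : Vector Carrier m) → v ● (λ _ → 0#) ≈ 0#
  ●-0 v = ∑-zero (λ p → R.zeroʳ (v p))

  select-● : ∀ {i} z (b b′ : 𝕍 i) → join {i} (select {i} z b) ● join {i} (select {i} z b′) ≈ b ● b′
  select-● {i} false b b′ = R.trans (join-● {i} (select {i} false b) (select {i} false b′)) (R.trans (R.+-congˡ (0-● _)) (R.+-identityʳ _))
  select-● {i} true  b b′ = R.trans (join-● {i} (select {i} true b) (select {i} true b′)) (R.trans (R.+-congʳ (0-● _)) (R.+-identityˡ _))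

  select-orthogonal : ∀ {i z z′} (b b′ : 𝕍 i) → z ≢ z′ → join {i} (select {i} z b) ● join {i} (select {i} z′ b′) ≈ 0#
  select-orthogonal {i} {z = false} {false} b b′ z≢z′ = ⊥-elim (z≢z′ refl)
  select-orthogonal {i} {z = false} {true}  b b′ _    =
    R.trans (join-● {i} (select {i} false b) (select {i} true b′)) (R.trans (R.+-cong (●-0 b) (0-● b′)) (R.+-identityˡ 0#))
  select-orthogonal {i} {z = true}  {false} b b′ _    =
    R.trans (join-● {i} (select {i} true b) (select {i} false b′)) (R.trans (R.+-cong (0-● b′) (●-0 b)) (R.+-identityˡ 0#))
  select-orthogonal {i} {z = true}  {true}  b b′ z≢z′ = ⊥-elim (z≢z′ refl)

  0≤½ : 0# ≤ ½
  0≤½ = double-cancel-≤ (≤-respˡ (R.sym (R.+-identityˡ 0#)) (≤-respʳ (R.sym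
    (R.trans (S.solve 1 (λ h → h S.:+ h S.:= h S.:* (S.con 1 S.:+ S.con 1)) R.refl ½) ½*2≈1)) 0≤1))

  √½ : Carrier
  √½ = √ ½

  √½²≈½ : √½ * √½ ≈ ½
  √½²≈½ = √-square ½ 0≤½

  ½x+½x≈x : ∀ x → ½ * (x + x) ≈ x
  ½x+½x≈x x = R.trans (S.solve 2 (λ h x → h S.:* (x S.:+ x) S.:= (h S.:* (S.con 1 S.:+ S.con 1)) S.:* x) R.refl ½ x)
    (R.trans (R.*-congʳ ½*2≈1) (R.*-identityˡ x))

  graph : ∀ {i} → Bool → Ē i → 𝕍 i → Bool → 𝕍 i
  graph φ w b false = b
  graph φ w b true  = λ p → ± φ (op w b p)

  -- The first bit of the index in a `twist` chooses the half. In a `tilt` both halves have equal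
  -- norm since `op w` is an isometry, hence the factor √½.
  basis : ∀ {i r k} → Code i r k → U r → U k → 𝕍 i
  basis []           f       j       = λ _ → 1#
  basis (axis {i} c) (φ ∷ f) j       = join {i} (select {i} φ (basis c f j))
  basis (twist {i} g c) f    (z ∷ j) = join {i} (select {i} z (basis c (if z then f ⊕ g else f) j))
  basis (tilt {i} m n c) (φ ∷ f) j   = λ p → √½ * join {i} (graph φ (complement c m n) (basis c f j)) p

  graph-● : ∀ {i} φ (w : Ē i) (b b′ : 𝕍 i) →
    (λ p → √½ * join {i} (graph φ w b) p) ● (λ p → √½ * join {i} (graph φ w b′) p) ≈ b ● b′
  graph-● {i} φ w b b′ = begin
    (λ p → √½ * join {i} (graph φ w b) p) ● (λ p → √½ * join {i} (graph φ w b′) p)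
      ≈⟨ R.trans (●-*ˡ √½ _ _) (R.trans (R.*-congˡ (●-*ʳ √½ _ _)) (R.sym (R.*-assoc _ _ _))) ⟩
    (√½ * √½) * join {i} (graph φ w b) ● join {i} (graph φ w b′)
      ≈⟨ R.*-cong √½²≈½ (join-● (graph φ w b) (graph φ w b′)) ⟩
    ½ * (b ● b′ + graph φ w b true ● graph φ w b′ true)
      ≈⟨ R.*-congˡ (R.+-congˡ (R.trans (∑-cong (λ p → ±*± φ (op w b p) (op w b′ p))) (op-isometry w b b′))) ⟩
    ½ * (b ● b′ + b ● b′)
      ≈⟨ ½x+½x≈x _ ⟩
    b ● b′ ∎

  basis-unit : ∀ {i r k} (c : Code i r k) f j → basis c f j ● basis c f j ≈ 1#
  basis-unit []           f       j       = R.trans (∑-suc _) (R.trans (R.+-cong (R.*-identityˡ 1#) (∑-[] _)) (R.+-identityʳ 1#))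
  basis-unit (axis c)     (φ ∷ f) j       = R.trans (select-● φ (basis c f j) (basis c f j)) (basis-unit c f j)
  basis-unit (twist g c)  f       (z ∷ j) = R.trans (select-● z (basis c (if z then f ⊕ g else f) j) (basis c (if z then f ⊕ g else f) j)) (basis-unit c _ j)
  basis-unit (tilt m n c) (φ ∷ f) j       = R.trans (graph-● φ (complement c m n) (basis c f j) (basis c f j)) (basis-unit c f j)

  basis-orthogonal : ∀ {i r k} (c : Code i r k) f {j l} → j ≢ l → basis c f j ● basis c f l ≈ 0#
  basis-orthogonal []           f       {[]}    {[]}     j≢l = ⊥-elim (j≢l refl)
  basis-orthogonal (axis c)     (φ ∷ f) {j} {l} j≢l = R.trans (select-● φ (basis c f j) (basis c f l)) (basis-orthogonal c f j≢l)
  basis-orthogonal (twist g c)  f       {z ∷ j} {z′ ∷ l} j≢l with z ≟ᵇ z′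
  ... | yes refl = R.trans (select-● z (basis c (if z then f ⊕ g else f) j) (basis c (if z then f ⊕ g else f) l))
                     (basis-orthogonal c _ (j≢l ∘ cong (z ∷_)))
  ... | no z≢z′  = select-orthogonal (basis c _ j) (basis c _ l) z≢z′
  basis-orthogonal (tilt m n c) (φ ∷ f) {j} {l} j≢l = R.trans (graph-● φ (complement c m n) (basis c f j) (basis c f l)) (basis-orthogonal c f j≢l)

  basis∈plane : ∀ {i r k} (c : Code i r k) f j → Plane c f (basis c f j)
  basis∈plane []           []      []      = λ { [] p → R.trans (op-𝟘 _ p) (R.reflexive (≡.sym (±-false 1#))) }
  basis∈plane (axis {i} c)     (false ∷ f) j   = axis-plane c false f (select {i} false (basis c f j)) (basis∈plane c f j) (λ _ → R.refl)
  basis∈plane (axis {i} c)     (true ∷ f)  j   = axis-plane c true f (select {i} true (basis c f j)) (basis∈plane c f j) (λ _ → R.refl)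
  basis∈plane (twist {i} g c)  f (false ∷ j)   = twist-plane g c f (select {i} false (basis c f j)) (basis∈plane c f j) (plane-0 c (f ⊕ g))
  basis∈plane (twist {i} g c)  f (true ∷ j)    = twist-plane g c f (select {i} true (basis c (f ⊕ g) j)) (plane-0 c f) (basis∈plane c (f ⊕ g) j)
  basis∈plane (tilt m n c) (φ ∷ f) j       =
    plane-* (tilt m n c) (φ ∷ f) √½
      (tilt-plane m n c φ f (graph φ (complement c m n) (basis c f j)) (basis∈plane c f j) (λ _ → R.refl))

  basis-orthonormal : ∀ {i r k} (c : Code i r k) f → Orthonormal (λ (j : Fin (2 ℕ.^ k)) → basis c f (label j))
  basis-orthonormal c f = record
    { unit       = λ j → basis-unit c f (label j)
    ; orthogonal = λ j≢l → basis-orthogonal c f (j≢l ∘ label-injective)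
    }

  -- Planes of codes as the invariant subspaces.

  plane⇒signed : ∀ {i r k} (c : Code i r k) f {v} → v ∈ Plane c f → ∀ s t p →
    act ℝ ⟪ s , proj₁ (span c t) , proj₂ (span c t) ⟫ v p ≈ signed (s Sign.* -1^ (σ c t xor (f · t))) (v p)
  plane⇒signed c f {v} v∈ s t p rewrite s≡-1^exponent s = begin
    act ℝ ⟪ -1^ x , proj₁ (span c t) , proj₂ (span c t) ⟫ v p    ≡⟨ act≡ x (span c t) v p ⟩
    ± x (op (span c t) v p)                                     ≈⟨ ±-cong x (v∈ t p) ⟩
    ± x (± e (v p))                                             ≈⟨ ±-± x e (v p) ⟩
    ± (x xor e) (v p)                                           ≡⟨ signed≡ (x xor e) (v p) ⟨
    signed (-1^ (x xor e)) (v p)                                ≡⟨ cong (λ s → signed s (v p)) (-1^-xor x e) ⟩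
    signed (-1^ x Sign.* -1^ e) (v p)                           ∎
    where
    x = exponent s
    e = σ c t xor (f · t)

  signed⇒plane : ∀ {i r k} (c : Code i r k) f {v : 𝕍 i} →
    (∀ t p → act ℝ (gen c t) v p ≈ signed (-1^ (f · t)) (v p)) → v ∈ Plane c f
  signed⇒plane c f {v} h t p = begin
    op (span c t) v p
      ≡⟨ ±-false _ ⟨
    ± false (op (span c t) v p)
      ≡⟨ cong (λ e → ± e (op (span c t) v p)) (xor-same (σ c t)) ⟨
    ± (σ c t xor σ c t) (op (span c t) v p)
      ≈⟨ ±-± (σ c t) (σ c t) _ ⟨
    ± (σ c t) (± (σ c t) (op (span c t) v p))
      ≡⟨ cong (± (σ c t)) (act≡ (σ c t) (span c t) v p) ⟨
    ± (σ c t) (act ℝ (gen c t) v p)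
      ≈⟨ ±-cong (σ c t) (R.trans (h t p) (R.reflexive (signed≡ (f · t) (v p)))) ⟩
    ± (σ c t) (± (f · t) (v p))
      ≈⟨ ±-± (σ c t) (f · t) (v p) ⟩
    ± (σ c t xor (f · t)) (v p) ∎

  private
    signs-cancel : ∀ s x → -1^ s Sign.* -1^ (s xor x) ≡ -1^ x
    signs-cancel s x = trans (sym (-1^-xor s (s xor x)))
      (cong -1^_ (solve 2 (λ s x → s :+ (s :+ x) := x) refl s x))
      where open xor-∧-Solver using (solve; _:=_; _:+_)

  plane-invariant : ∀ {i r k} (c : Code i r k) f → Plane c f ∈ InvariantSubspace ℝ i r
  plane-invariant c f =
    Image c , image-isSubspace c , image-hasDimension c , image-totallySingular c , image-character c f ,
    (λ { v∈ ⟪ s , a , b ⟫ (t , refl) p → plane⇒signed c f v∈ s t p }) ,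
    (λ {v} v∈ → signed⇒plane c f λ t p → R.trans (v∈ (gen c t) (t , refl) p)
      (R.reflexive (cong (λ s → signed s (v p)) (signs-cancel (σ c t) (f · t)))))

  invariant⇒plane : ∀ {i} r k → i ≡ r ℕ.+ k → ∀ {W} → W ∈ InvariantSubspace ℝ i r →
    ∃₂ λ (c : Code i r k) f → W ≐ Plane c f
  invariant⇒plane {i} r k i≡ {W} (S , sub , dim , singular , χ , W⊆ , W⊇) = find (encode iso) (rank≡ sub dim (encode iso))
    where
    iso = isotropic sub dim singular
    find : (e : Encoding S) → Encoding.rank e ≡ r → ∃₂ λ (c : Code i r k) f → W ≐ Plane c f
    find (encoding {defect = k′} c sound complete) refl
      -- Rank and defect add up to i, so the defect is determined once the rank is.
      with refl ← ℕ.+-cancelˡ-≡ r k′ k (trans (sym (rank+defect c)) i≡) = c , f ,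
      (λ {v} v∈ → signed⇒plane c f λ t p → R.trans (W⊆ v∈ (gen c t) (sound t) p)
        (R.reflexive (cong (λ s → signed s (v p))
          (trans (character≡ c sound complete χ (-1^ σ c t) t (sound t)) (signs-cancel (σ c t) (f · t)))))) ,
      (λ {v} v∈ → W⊇ λ { ⟪ s , a , b ⟫ g∈S p → at-element v v∈ s (a , b) g∈S (complete g∈S) p })
      where
      f = characterForm c sound complete χ
      at-element : ∀ v → v ∈ Plane c f → ∀ s x (x∈S : S x) → Image c x → ∀ p →
        act ℝ ⟪ s , proj₁ x , proj₂ x ⟫ v p ≈ signed (Character.χ χ ⟪ s , proj₁ x , proj₂ x ⟫ x∈S) (v p)
      at-element v v∈ s x x∈S (t , refl) p = R.trans (plane⇒signed c f v∈ s t p)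
        (R.reflexive (cong (λ s → signed s (v p)) (sym (character≡ c sound complete χ s t x∈S))))

  -- The planes in the Grassmannian and their enumeration.

  module Coords m = Linear rawRing (Coordinates ℝ m)

  lincomb≈∑ : ∀ {m n} (t : Vector Carrier n) (b : Vector (Vector Carrier m) n) →
              Coords.lincomb m t b ≋ λ p → ∑[ (λ j → t j * b j p) ]
  lincomb≈∑ {n = zero}  t b p = R.sym (∑-[] _)
  lincomb≈∑ {n = suc n} t b p = R.trans (R.+-congˡ (lincomb≈∑ (t ∘ suc) (b ∘ suc) p)) (R.sym (∑-suc _))

  plane∈G : ∀ {i r k} (c : Code i r k) f {W} → W ≐ Plane c f → W ∈ G ℝ (2 ℕ.^ i) (2 ℕ.^ k)
  plane∈G {i} {r} {k} c f (W⊆ , W⊇) =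
    record
      { respects = λ e v∈ → W⊇ (plane-resp c f e (W⊆ v∈))
      ; 0-closed = W⊇ (plane-0 c f)
      ; +-closed = λ v∈ w∈ → W⊇ (plane-+ c f (W⊆ v∈) (W⊆ w∈))
      ; *-closed = λ a v∈ → W⊇ (plane-* c f a (W⊆ v∈))
      } ,
    b , record
      { members     = λ j → W⊇ (basis∈plane c f (label j))
      ; independent = λ t e j → begin
          t j                                        ≈⟨ R.*-identityʳ (t j) ⟨
          t j * 1#                                   ≈⟨ R.*-congˡ (unit j) ⟨
          t j * b j ● b j                            ≈⟨ ∑-single (λ l → t l * b l ● b j) j
                                                          (λ l l≢j → R.trans (R.*-congˡ (orthogonal l≢j)) (R.zeroʳ (t l))) ⟨
          ∑[ (λ l → t l * b l ● b j) ]               ≈⟨ ●-∑ˡ t b (b j) ⟨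
          (λ p → ∑[ (λ l → t l * b l p) ]) ● b j     ≈⟨ ●-cong (λ p → R.trans (R.sym (lincomb≈∑ t b p)) (e p)) (λ _ → R.refl) ⟩
          (λ _ → 0#) ● b j                           ≈⟨ 0-● (b j) ⟩
          0#                                         ∎
      ; spanning    = λ x x∈ → (λ j → b j ● x) , λ p → R.trans
          (expansion c f b (basis-orthonormal c f) (basis∈plane c f ∘ label) x (W⊆ x∈) p)
          (R.sym (lincomb≈∑ (λ j → b j ● x) b p))
      }
    where
    open Orthonormal (basis-orthonormal c f)
    b : Fin (2 ℕ.^ k) → 𝕍 i
    b j = basis c f (label j)

  1≉0 : ¬ 1# ≈ 0#
  1≉0 e = IsStrictPartialOrder.irrefl <-isStrictPartialOrder (R.sym e) 0<1

  ±≈±⇒≈0 : ∀ e e′ {x} → e xor e′ ≡ true → ± e x ≈ ± e′ x → x ≈ 0#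
  ±≈±⇒≈0 e e′ {x} e≢e′ h = x≈-x⇒x≈0 (R.sym (begin
    - x                            ≈⟨ R.-‿cong (R.reflexive (±-false x)) ⟨
    - ± false x                    ≈⟨ ±-flip false x ⟨
    ± true x                       ≡⟨ cong (λ e → ± e x) e≢e′ ⟨
    ± (e xor e′) x                 ≈⟨ ±-± e e′ x ⟨
    ± e (± e′ x)                   ≈⟨ ±-cong e h ⟨
    ± e (± e x)                    ≈⟨ ±-± e e x ⟩
    ± (e xor e) x                  ≡⟨ cong (λ e → ± e x) (xor-same e) ⟩
    ± false x                      ≡⟨ ±-false x ⟩
    x                              ∎))

  private
    polarity : ∀ {i r k} (c : Code i r k) (f f′ : U r) t → (f ⊕ f′) · t ≡ true →
               (σ c t xor (f · t)) xor (σ c t xor (f′ · t)) ≡ true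
    polarity c f f′ t e = trans
      (solve 3 (λ s x y → (s :+ x) :+ (s :+ y) := x :+ y) refl (σ c t) (f · t) (f′ · t))
      (trans (sym (·-distribʳ-⊕ t f f′)) e)
      where open xor-∧-Solver using (solve; _:=_; _:+_)

  -- An element of the second span acts on the common plane as a scalar ±1, so its trace there is
  -- ±2^k. Outside the first span this trace would be 0 by `trace≈0`.
  trace-plane : ∀ {i r r′ k} (c : Code i r k) f (c′ : Code i r′ k) f′ → Plane c f ≐ Plane c′ f′ → c′ ⊑ c
  trace-plane {i} {k = k} c f c′ f′ (P⊆ , _) with ⊑? c′ c
  ... | inj₁ l = l
  ... | inj₂ (t , ∉) = ⊥-elim (1≉0 (2^*-cancel k (R.trans (R.*-identityʳ _) (R.trans card≈0 (R.sym (R.zeroʳ _))))))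
    where
    e = σ c′ t xor (f′ · t)
    b : Fin (2 ℕ.^ k) → 𝕍 i
    b j = basis c f (label j)
    card≈0 : 2# ^ k ≈ 0#
    card≈0 = begin
      2# ^ k                                     ≈⟨ card-2^ k ⟨
      card (2 ℕ.^ k)                             ≈⟨ R.reflexive (trans (cong (λ e → ± e (card (2 ℕ.^ k))) (xor-same e)) (±-false _)) ⟨
      ± (e xor e) (card (2 ℕ.^ k))               ≈⟨ ±-± e e _ ⟨
      ± e (± e (card (2 ℕ.^ k)))                 ≈⟨ ±-cong e (∑-± {2 ℕ.^ k} e (λ _ → 1#)) ⟨
      ± e ∑[ (λ (_ : Fin (2 ℕ.^ k)) → ± e 1#) ]  ≈⟨ ±-cong e (∑-cong λ j → R.trans (●-cong (λ _ → R.refl) (P⊆ (basis∈plane c f (label j)) t))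
                                                      (R.trans (●-±ʳ e (b j) (b j)) (±-cong e (basis-unit c f (label j))))) ⟨
      ± e ∑[ (λ j → b j ● op (span c′ t) (b j)) ] ≈⟨ ±-cong e (trace≈0 c f b (basis-orthonormal c f) (basis∈plane c f ∘ label) (span c′ t) ∉) ⟩
      ± e 0#                                     ≈⟨ ±-0 e ⟩
      0#                                         ∎

  plane-injective : ∀ {i r k} (c c′ : Code i r k) f f′ → Plane c f ≐ Plane c′ f′ → c ≡ c′ × f ≡ f′
  plane-injective c c′ f f′ P≐P′@(P⊆ , P⊇)
    with refl ← code-unique c c′ (trace-plane c′ f′ c f (P⊇ , P⊆)) (trace-plane c f c′ f′ P≐P′)
    with f ≟U f′
  ... | yes e = refl , e
  -- Different forms give opposite eigenvalues at some t, and a unit vector having both would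
  -- vanish.
  ... | no f≢f′ with t , ft≢ ← ≢𝟎⇒∃·≡true (f ⊕ f′) (f≢f′ ∘ ⊕≡𝟎⇒≡ f f′) =
    ⊥-elim (1≉0 (R.trans (R.sym (basis-unit c f 𝟎)) (∑-zero λ p → R.trans (R.*-congʳ
      (±≈±⇒≈0 _ _ (polarity c f f′ t ft≢)
        (R.trans (R.sym (basis∈plane c f 𝟎 t p)) (P⊆ (basis∈plane c f 𝟎) t p)))) (R.zeroˡ _))))

  packing : ∀ r k → IsPacking ℝ (2 ℕ.^ (r ℕ.+ k)) (2 ℕ.^ k) (packingSize (r ℕ.+ k) k) (InvariantSubspace ℝ (r ℕ.+ k) r)
  packing r k = record
    { planes     = λ W W∈ → let c , f , W≐ = invariant⇒plane r k refl W∈ in plane∈G c f W≐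
    ; enum       = λ a → let f , c = Inverse.to enumeration a in Plane c f
    ; enum∈𝒫     = λ a → let f , c = Inverse.to enumeration a in plane-invariant c f
    ; distinct   = λ a b e →
        let c≡ , f≡ = plane-injective (proj₂ (Inverse.to enumeration a)) (proj₂ (Inverse.to enumeration b)) _ _ e
        in trans (sym (Inverse.strictlyInverseʳ enumeration a))
             (trans (cong (Inverse.from enumeration) (cong₂ _,_ f≡ c≡)) (Inverse.strictlyInverseʳ enumeration b))
    ; exhaustive = λ W W∈ → let c , f , W≐ = invariant⇒plane r k refl W∈ in
        Inverse.from enumeration (f , c) ,
        subst (λ fc → W ≐ Plane (proj₂ fc) (proj₁ fc)) (sym (Inverse.strictlyInverseˡ enumeration (f , c))) W≐
    }
    where
    enumeration : Fin (packingSize (r ℕ.+ k) k) ↔ (U r × Code (r ℕ.+ k) r k)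
    enumeration = subst (λ N → Fin N ↔ (U r × Code (r ℕ.+ k) r k)) (sym (packingSize≡ r k))
      (↔-trans *↔× (↔-sym (U↔Fin r) ×-↔ Fin↔Code (r ℕ.+ k) r k))

  -- The lower bound for distances.

  ●-±ˡ : ∀ {m} e (v w : Vector Carrier m) → (λ p → ± e (v p)) ● w ≈ ± e (v ● w)
  ●-±ˡ e v w = R.trans (●-comm _ w) (R.trans (●-±ʳ e w v) (±-cong e (●-comm w v)))

  ±-involutive : ∀ e x → ± e (± e x) ≈ x
  ±-involutive e x = R.trans (±-± e e x) (R.reflexive (trans (cong (λ e → ± e x) (xor-same e)) (±-false x)))

  eigenvectors-orthogonal : ∀ {i} (g : Ē i) e e′ {x y : 𝕍 i} →
    op g x ≋ (λ p → ± e (x p)) → op g y ≋ (λ p → ± e′ (y p)) → e xor e′ ≡ true → x ● y ≈ 0#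
  eigenvectors-orthogonal g e e′ {x} {y} gx gy e≢e′ = ±≈±⇒≈0 e e′ e≢e′ (begin
    ± e (x ● y)                                    ≈⟨ ±-cong e (op-isometry g x y) ⟨
    ± e (op g x ● op g y)                          ≈⟨ ±-cong e (●-cong gx gy) ⟩
    ± e ((λ p → ± e (x p)) ● (λ p → ± e′ (y p)))   ≈⟨ ±-cong e (R.trans (●-±ˡ e x _) (±-cong e (●-±ʳ e′ x y))) ⟩
    ± e (± e (± e′ (x ● y)))                       ≈⟨ ±-involutive e _ ⟩
    ± e′ (x ● y)                                   ∎)

  -- Apply the isometry `op h` to both arguments: the two signs e cancel, and moving it past `op g`
  -- leaves a minus sign, so the product equals its negative.
  anticommuting-expectation : ∀ {i} (g h : Ē i) e {x : 𝕍 i} →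
    op h x ≋ (λ p → ± e (x p)) → ω h g ≡ true → x ● op g x ≈ 0#
  anticommuting-expectation g h e {x} hx ω≡ = ±≈±⇒≈0 true false refl (R.sym (begin
    ± false (x ● op g x)                                             ≡⟨ ±-false _ ⟩
    x ● op g x                                                       ≈⟨ op-isometry h x (op g x) ⟨
    op h x ● op h (op g x)                                           ≈⟨ ●-cong hx hgx ⟩
    (λ p → ± e (x p)) ● (λ p → ± true (± e (op g x p)))              ≈⟨ ●-±ʳ true _ _ ⟩
    ± true ((λ p → ± e (x p)) ● (λ p → ± e (op g x p)))              ≈⟨ ±-cong true (∑-cong (λ p → ±*± e (x p) (op g x p))) ⟩
    ± true (x ● op g x)                                              ∎))
    where
    hgx : op h (op g x) ≋ λ p → ± true (± e (op g x p))
    hgx p = R.trans (op-comm h g x p) (R.trans (R.reflexive (cong (λ s → ± s (op g (op h x) p)) ω≡))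
      (±-cong true (R.trans (op-cong g hx p) (op-± e g x p))))

  -- The projection of x onto the eigenspace of op g is (x ± op g x) / 2, and
  -- y lies in that eigenspace.
  eigenvector-bound : ∀ {i} (g : Ē i) e (x y : 𝕍 i) → x ● x ≈ 1# → y ● y ≈ 1# →
    op g y ≋ (λ p → ± e (y p)) → x ● y * x ● y + x ● y * x ● y ≤ 1# + ± e (x ● op g x)
  eigenvector-bound {i} g e x y x-unit y-unit gy = double-cancel-≤ (≤-respˡ squared (≤-respʳ norm (cauchy-schwarz u y y-unit)))
    where
    a T : Carrier
    a = x ● y
    T = ± e (x ● op g x)
    w u : 𝕍 i
    w p = ± e (op g x p)
    u p = x p + w p
    w●y : w ● y ≈ a
    w●y = begin
      w ● y                                           ≈⟨ ●-±ˡ e (op g x) y ⟩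
      ± e (op g x ● y)                                ≈⟨ ●-±ʳ e (op g x) y ⟨
      op g x ● (λ p → ± e (y p))                      ≈⟨ ●-cong (λ _ → R.refl) gy ⟨
      op g x ● op g y                                 ≈⟨ op-isometry g x y ⟩
      x ● y                                           ∎
    u●y : u ● y ≈ a + a
    u●y = R.trans (●-+ˡ x w y) (R.+-congˡ w●y)
    squared : (u ● y) * (u ● y) ≈ (a * a + a * a) + (a * a + a * a)
    squared = R.trans (R.*-cong u●y u●y) (S.solve 1 (λ a →
      (a S.:+ a) S.:* (a S.:+ a) S.:= (a S.:* a S.:+ a S.:* a) S.:+ (a S.:* a S.:+ a S.:* a)) R.refl a)
    norm : u ● u ≈ (1# + T) + (1# + T)
    norm = begin
      u ● u
        ≈⟨ R.trans (●-+ˡ x w u) (R.+-cong (●-+ʳ x x w) (●-+ʳ w x w)) ⟩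
      (x ● x + x ● w) + (w ● x + w ● w)
        ≈⟨ R.+-cong (R.+-cong x-unit (●-±ʳ e x (op g x)))
             (R.+-cong (R.trans (●-comm w x) (●-±ʳ e x (op g x)))
               (R.trans (∑-cong (λ p → ±*± e (op g x p) (op g x p))) (R.trans (op-isometry g x x) x-unit))) ⟩
      (1# + T) + (T + 1#)
        ≈⟨ R.+-congˡ (R.+-comm T 1#) ⟩
      (1# + T) + (1# + T) ∎

  module _ {i r k : ℕ} where

    private
      Family : Set c
      Family = Fin (2 ℕ.^ k) → 𝕍 i

      -- Twice the sum of the squared cosines, which makes the bound simply 2^k.
      cosines : Family → Family → Carrier
      cosines p q = ∑[ (λ j → p j ● q j * p j ● q j + p j ● q j * p j ● q j) ]

      cosines-comm : ∀ p q → cosines p q ≈ cosines q p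
      cosines-comm p q = ∑-cong λ j → let e = R.*-cong (●-comm (p j) (q j)) (●-comm (p j) (q j)) in R.+-cong e e

    cosines-bound : ∀ (c c′ : Code i r k) f f′ {p q} → Orthonormal p → Orthonormal q →
      (∀ j → Plane c f (p j)) → (∀ j → Plane c′ f′ (q j)) →
      (∃ λ t → ∀ t′ → span c t′ ≢ span c′ t) → cosines p q ≤ card (2 ℕ.^ k)
    cosines-bound c c′ f f′ {p} {q} p-ortho q-ortho p∈ q∈ (t , ∉) = ≤-trans
      (∑-mono λ j → eigenvector-bound g e (p j) (q j) (Orthonormal.unit p-ortho j) (Orthonormal.unit q-ortho j) (q∈ j t))
      (≤-reflexive (begin
        ∑[ (λ j → 1# + ± e (p j ● op g (p j))) ]
          ≈⟨ ∑-distrib-+ (λ _ → 1#) _ ⟩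
        card (2 ℕ.^ k) + ∑[ (λ j → ± e (p j ● op g (p j))) ]
          ≈⟨ R.+-congˡ (R.trans (∑-± e _) (R.trans (±-cong e (trace≈0 c f p p-ortho p∈ g ∉)) (±-0 e))) ⟩
        card (2 ℕ.^ k) + 0#
          ≈⟨ R.+-identityʳ _ ⟩
        card (2 ℕ.^ k) ∎))
      where
      g = span c′ t
      e = σ c′ t xor (f′ · t)

    -- If the codes differ, one of the spans has an element outside the other, and the bound is
    -- symmetric in the two families. If only the forms differ, some t has opposite eigenvalues and
    -- all cosines vanish.
    distinct⇒cosines : ∀ (c c′ : Code i r k) f f′ {p q} → Orthonormal p → Orthonormal q →
      (∀ j → Plane c f (p j)) → (∀ j → Plane c′ f′ (q j)) → ¬ (c ≡ c′ × f ≡ f′) → cosines p q ≤ card (2 ℕ.^ k)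
    distinct⇒cosines c c′ f f′ {p} {q} p-ortho q-ortho p∈ q∈ ≢ with ⊑? c′ c | ⊑? c c′
    ... | inj₂ ∉ | _      = cosines-bound c c′ f f′ p-ortho q-ortho p∈ q∈ ∉
    ... | inj₁ _ | inj₂ ∉ = ≤-respˡ (cosines-comm q p) (cosines-bound c′ c f′ f q-ortho p-ortho q∈ p∈ ∉)
    ... | inj₁ l | inj₁ l′ with refl ← code-unique c c′ l′ l with f ≟U f′
    ...   | yes f≡f′ = ⊥-elim (≢ (refl , f≡f′))
    ...   | no f≢f′ with t , ft≢ ← ≢𝟎⇒∃·≡true (f ⊕ f′) (f≢f′ ∘ ⊕≡𝟎⇒≡ f f′) =
      ≤-respˡ (R.sym (∑-zero λ j → R.trans (R.+-cong (vanish j) (vanish j)) (R.+-identityˡ 0#))) (∑-nonneg (λ _ → 0≤1))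
      where
      vanish : ∀ j → p j ● q j * p j ● q j ≈ 0#
      vanish j = R.trans (R.*-congʳ (eigenvectors-orthogonal (span c t) _ _ (p∈ j t) (q∈ j t) (polarity c f f′ t ft≢)))
        (R.zeroˡ _)

    cosines⇒distance : ∀ {p q : Family} → cosines p q ≤ card (2 ℕ.^ k) →
      ½ * 2# ^ k ≤ ∑[ (λ j → 1# - p j ● q j * p j ● q j) ]
    cosines⇒distance {p} {q} bound = double-cancel-≤ (≤-respˡ (R.trans (card-2^ k) (R.sym (halves _)))
      (+-cancelʳ-≤ (card (2 ℕ.^ k)) (≤-respˡ total (+-mono-≤ (≤-reflexive R.refl) bound))))
      where
      s d : Fin (2 ℕ.^ k) → Carrier
      s j = p j ● q j * p j ● q j
      d j = 1# - s j
      halves : ∀ x → ½ * x + ½ * x ≈ x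
      halves x = R.trans (R.sym (R.distribˡ ½ x x)) (½x+½x≈x x)
      +-cancelʳ-≤ : ∀ z {x y} → x + z ≤ y + z → x ≤ y
      +-cancelʳ-≤ z {x} {y} h = ≤-respˡ (x+z-z≈x x z) (≤-respʳ (x+z-z≈x y z) (+-monoˡ-≤ (- z) h))
      total : (∑[ d ] + ∑[ d ]) + cosines p q ≈ card (2 ℕ.^ k) + card (2 ℕ.^ k)
      total = begin
        (∑[ d ] + ∑[ d ]) + cosines p q
          ≈⟨ R.trans (∑-distrib-+ _ _) (R.+-congʳ (∑-distrib-+ d d)) ⟨
        ∑[ (λ j → (d j + d j) + (s j + s j)) ]
          ≈⟨ ∑-cong (λ j → R.trans
               (S.solve 2 (λ n s → ((S.con 1 S.:+ n) S.:+ (S.con 1 S.:+ n)) S.:+ (s S.:+ s)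
                 S.:= (S.con 1 S.:+ S.con 1) S.:+ ((n S.:+ s) S.:+ (n S.:+ s))) R.refl (- s j) (s j))
               (R.trans (R.+-congˡ (R.trans (R.+-cong (R.-‿inverseˡ (s j)) (R.-‿inverseˡ (s j))) (R.+-identityˡ 0#)))
                 (R.+-identityʳ _))) ⟩
        ∑[ (λ (_ : Fin (2 ℕ.^ k)) → 1# + 1#) ]
          ≈⟨ ∑-distrib-+ {2 ℕ.^ k} (λ _ → 1#) (λ _ → 1#) ⟩
        card (2 ℕ.^ k) + card (2 ℕ.^ k) ∎

    ½*2^-nonneg : 0# ≤ ½ * 2# ^ k
    ½*2^-nonneg = double-cancel-≤ (≤-respˡ (R.sym (R.+-identityˡ 0#)) (≤-respʳ
      (R.trans (card-2^ k) (R.trans (R.sym (½x+½x≈x _)) (R.distribˡ ½ _ _))) (∑-nonneg {2 ℕ.^ k} (λ _ → 0≤1))))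

  principal⇒orthonormal : ∀ {m n} {P Q : Subset ℝ m} {p q : Fin n → Vector Carrier m} →
    ArePrincipalVectors ℝ P Q p q → Orthonormal p × Orthonormal q
  principal⇒orthonormal {p = p} {q} pv =
    record { unit       = λ j → R.trans (R.reflexive (●≡⟨,⟩ (p j) (p j))) (Admissible.x-unit (admissible j))
           ; orthogonal = λ {j} {l} → by-order p (λ j l l<j → R.trans (R.reflexive (●≡⟨,⟩ (p j) (p l))) (Admissible.x-ortho (admissible j) l l<j)) j l } ,
    record { unit       = λ j → R.trans (R.reflexive (●≡⟨,⟩ (q j) (q j))) (Admissible.y-unit (admissible j))
           ; orthogonal = λ {j} {l} → by-order q (λ j l l<j → R.trans (R.reflexive (●≡⟨,⟩ (q j) (q l))) (Admissible.y-ortho (admissible j) l l<j)) j l }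
    where
    open ArePrincipalVectors pv using (admissible)
    by-order : ∀ (v : Fin _ → Vector Carrier _) → (∀ j l → l <ᶠ j → v j ● v l ≈ 0#) →
               ∀ j l → j ≢ l → v j ● v l ≈ 0#
    by-order v h j l j≢l with Fin.<-cmp l j
    ... | tri< l<j _ _ = h j l l<j
    ... | tri≈ _ l≡j _ = ⊥-elim (j≢l (sym l≡j))
    ... | tri> _ _ j<l = R.trans (●-comm (v j) (v l)) (h l j j<l)

  lower-bound : ∀ {i} r k → i ≡ r ℕ.+ k → ∀ P Q → P ∈ InvariantSubspace ℝ i r → Q ∈ InvariantSubspace ℝ i r →
    ¬ P ≐ Q → ∀ δ → IsDistance ℝ (2 ℕ.^ k) P Q δ → 2^[ k -1]/2 ≤ δ
  lower-bound {i} r k i≡ P Q P∈ Q∈ P≢Q δ (p , q , pv , δ≈)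
    with c , f , P⊆ , P⊇ ← invariant⇒plane r k i≡ P∈ | c′ , f′ , Q⊆ , Q⊇ ← invariant⇒plane r k i≡ Q∈ =
    -- The two roots are compared through their squares; the nonnegativity of D that `√-square` asks
    -- for comes from the bound itself.
    ≤-respʳ (R.sym δ≈) (square-cancel-≤ (√-nonneg D)
      (≤-respˡ (R.sym (√-square _ (½*2^-nonneg {i} {r} {k}))) (≤-respʳ (R.sym (√-square D (≤-trans (½*2^-nonneg {i} {r} {k}) bound))) bound)))
    where
    open ArePrincipalVectors pv using (admissible)
    D : Carrier
    D = sum ℝ (λ j → 1# - ⟨_,_⟩ ℝ (p j) (q j) * ⟨_,_⟩ ℝ (p j) (q j))
    different : ¬ (c ≡ c′ × f ≡ f′)
    different (refl , refl) = P≢Q ((Q⊇ ∘ P⊆) , (P⊇ ∘ Q⊆))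
    bound : ½ * 2# ^ k ≤ D
    bound = ≤-respʳ
      (R.trans (∑-cong (λ j → R.+-congˡ (R.-‿cong (R.*-cong (R.reflexive (●≡⟨,⟩ (p j) (q j))) (R.reflexive (●≡⟨,⟩ (p j) (q j)))))))
        (R.reflexive (∑≡sum _)))
      (cosines⇒distance {i} {r} {k} (distinct⇒cosines c c′ f f′ (proj₁ (principal⇒orthonormal pv)) (proj₂ (principal⇒orthonormal pv))
        (λ j → P⊆ (Admissible.x∈P (admissible j))) (λ j → Q⊆ (Admissible.y∈Q (admissible j))) different))

  -- Two planes at minimal distance.

  module _ (r k : ℕ) where

    private
      i : ℕ
      i = r ℕ.+ k

      c₀ : Code i r k
      c₀ = standardCode r k

      -- Both lie over the same T, but e belongs to the span of `d`, while the span of `d′` contains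
      -- a vector outside e⊥. These two elements anticommute.
      d d′ : Code (suc i) (suc r) k
      d  = axis c₀
      d′ = tilt 𝟎 𝟎 c₀

      p q′ : Fin (2 ℕ.^ k) → 𝕍 (suc i)
      p j  = basis d 𝟎 (label j)
      q′ j = basis d′ 𝟎 (label j)

      -- The vector q′ j is √½ times the sum of p j and a vector supported on the other half.
      p●q : ∀ j → p j ● q′ j ≈ √½
      p●q j = begin
        p j ● q′ j
          ≈⟨ ●-*ʳ √½ (p j) _ ⟩
        √½ * join {i} (select {i} false b) ● join {i} (graph {i} false w b)
          ≈⟨ R.*-congˡ (join-● {i} (select {i} false b) (graph {i} false w b)) ⟩
        √½ * (b ● b + (λ _ → 0#) ● graph {i} false w b true)
          ≈⟨ R.*-congˡ (R.+-cong (basis-unit c₀ 𝟎 (label j)) (0-● (graph {i} false w b true))) ⟩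
        √½ * (1# + 0#)
          ≈⟨ R.trans (R.*-congˡ (R.+-identityʳ 1#)) (R.*-identityʳ √½) ⟩
        √½ ∎
        where
        b : 𝕍 i
        b = basis c₀ 𝟎 (label j)
        w = complement c₀ 𝟎 𝟎

      -- The vector x is an eigenvector of an operator that anticommutes with `op g`, so the
      -- expectation in `eigenvector-bound` is zero and 2 (x ● y)² is at most 1. As this holds for
      -- all unit vectors of the two planes, the pairs p j, q′ j are maximal at every stage.
      maximum : ∀ x y → Plane d 𝟎 x → Plane d′ 𝟎 y → x ● x ≈ 1# → y ● y ≈ 1# → x ● y ≤ √½
      maximum x y x∈ y∈ x-unit y-unit = square-cancel-≤ (√-nonneg ½) (double-cancel-≤ (≤-respʳ (begin
        1# + ± _ (x ● op g x)
          ≈⟨ R.+-congˡ (R.trans (±-cong _ (anticommuting-expectation g h _ (x∈ (true ∷ 𝟎)) anticommute)) (±-0 _)) ⟩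
        1# + 0#
          ≈⟨ R.+-identityʳ 1# ⟩
        1#
          ≈⟨ R.trans (R.+-cong √½²≈½ √½²≈½) (R.trans (S.solve 1 (λ h → h S.:+ h S.:= h S.:* (S.con 1 S.:+ S.con 1)) R.refl ½) ½*2≈1) ⟨
        √½ * √½ + √½ * √½ ∎)
        (eigenvector-bound g _ x y x-unit y-unit (y∈ (true ∷ 𝟎)))))
        where
        g h : Ē (suc i)
        g = span d′ (true ∷ 𝟎)
        h = span d (true ∷ 𝟎)
        anticommute : ω h g ≡ true
        anticommute = trans (cong (λ z → ω (cons false true z) g) (span-𝟎 c₀)) (ω-axis (q (complement c₀ 𝟎 𝟎) xor ω (complement c₀ 𝟎 𝟎) (span c₀ 𝟎)) (complement c₀ 𝟎 𝟎 ⊞ span c₀ 𝟎))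

    attained : ∃₂ λ P Q → P ∈ InvariantSubspace ℝ (suc i) (suc r) × Q ∈ InvariantSubspace ℝ (suc i) (suc r) ×
      ¬ P ≐ Q × IsDistance ℝ (2 ℕ.^ k) P Q 2^[ k -1]/2
    attained = Plane d 𝟎 , Plane d′ 𝟎 , plane-invariant d 𝟎 , plane-invariant d′ 𝟎 ,
      (λ P≐Q → case proj₁ (plane-injective d d′ 𝟎 𝟎 P≐Q) of λ ()) ,
      p , q′ , record
        { admissible = λ j → record
          { x∈P     = basis∈plane d 𝟎 (label j)
          ; y∈Q     = basis∈plane d′ 𝟎 (label j)
          ; x-unit  = R.trans (R.reflexive (sym (●≡⟨,⟩ (p j) (p j)))) (Orthonormal.unit (basis-orthonormal d 𝟎) j)
          ; y-unit  = R.trans (R.reflexive (sym (●≡⟨,⟩ (q′ j) (q′ j)))) (Orthonormal.unit (basis-orthonormal d′ 𝟎) j)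
          ; x-ortho = λ l l<j → R.trans (R.reflexive (sym (●≡⟨,⟩ (p j) (p l))))
              (Orthonormal.orthogonal (basis-orthonormal d 𝟎) (Fin.<⇒≢ l<j ∘ sym))
          ; y-ortho = λ l l<j → R.trans (R.reflexive (sym (●≡⟨,⟩ (q′ j) (q′ l))))
              (Orthonormal.orthogonal (basis-orthonormal d′ 𝟎) (Fin.<⇒≢ l<j ∘ sym))
          }
        ; maximal = λ j x y adm → ≤-respˡ (R.reflexive (●≡⟨,⟩ x y))
            (≤-respʳ (R.trans (R.sym (p●q j)) (R.reflexive (●≡⟨,⟩ (p j) (q′ j))))
              (maximum x y (Admissible.x∈P adm) (Admissible.y∈Q adm)
                (R.trans (R.reflexive (●≡⟨,⟩ x x)) (Admissible.x-unit adm))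
                (R.trans (R.reflexive (●≡⟨,⟩ y y)) (Admissible.y-unit adm))))
        } ,
      √-cong (begin
        ½ * 2# ^ k
          ≈⟨ R.*-congˡ (card-2^ k) ⟨
        ½ * card (2 ℕ.^ k)
          ≈⟨ ∑-const (2 ℕ.^ k) ½ ⟨
        ∑[ (λ (_ : Fin (2 ℕ.^ k)) → ½) ]
          ≈⟨ ∑-cong (λ j → R.trans (R.+-congˡ (R.-‿cong (R.trans
               (R.*-cong (R.trans (R.reflexive (sym (●≡⟨,⟩ (p j) (q′ j)))) (p●q j)) (R.trans (R.reflexive (sym (●≡⟨,⟩ (p j) (q′ j)))) (p●q j)))
               √½²≈½))) 1-½≈½) ⟨
        ∑[ (λ j → 1# - ⟨_,_⟩ ℝ (p j) (q′ j) * ⟨_,_⟩ ℝ (p j) (q′ j)) ]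
          ≡⟨ ∑≡sum _ ⟩
        sum ℝ (λ j → 1# - ⟨_,_⟩ ℝ (p j) (q′ j) * ⟨_,_⟩ ℝ (p j) (q′ j)) ∎)
      where
      1-½≈½ : 1# - ½ ≈ ½
      1-½≈½ = R.trans (R.+-congʳ (R.trans (R.sym ½*2≈1)
        (S.solve 1 (λ h → h S.:* (S.con 1 S.:+ S.con 1) S.:= h S.:+ h) R.refl ½))) (x+z-z≈x ½ ½)

-- The equation i ≡ r + k replaces truncated subtraction. A positive rank makes both `axis` and
-- `tilt` available; for r = 0 the only plane is V itself, and there is no pair to attain a
-- distance.
packing-theorem : ∀ {c ℓ₁ ℓ₂ ℓ₃} (ℝ : RealField c ℓ₁ ℓ₂ ℓ₃) i r k → i ≡ r ℕ.+ k → r ≢ 0 →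
  IsPacking ℝ (2 ℕ.^ i) (2 ℕ.^ k) (packingSize i k) (InvariantSubspace ℝ i r) ×
  HasMinimalDistance ℝ (2 ℕ.^ i) (2 ℕ.^ k) (InvariantSubspace ℝ i r) (RealField.2^[_-1]/2 ℝ k)
packing-theorem ℝ i zero    k i≡   r≢0 = ⊥-elim (r≢0 refl)
packing-theorem ℝ _ (suc r) k refl r≢0 = packing (suc r) k , record
  { lowerBound = lower-bound (suc r) k refl ; attained = attained r k }
  where
  open Packing ℝ

open import Data.Nat using (ℕ; _<_; _^_; _∸_)
open import Data.Product using (_×_)

theorem1 : ∀ {c ℓ₁ ℓ₂ ℓ₃} (ℝ : RealField c ℓ₁ ℓ₂ ℓ₃) (i k : ℕ) → k < i →
    IsPacking ℝ (2 ^ i) (2 ^ k) (packingSize i k) (InvariantSubspace ℝ i (i ∸ k)) ×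
    HasMinimalDistance ℝ (2 ^ i) (2 ^ k) (InvariantSubspace ℝ i (i ∸ k)) (RealField.2^[_-1]/2 ℝ k)
theorem1 ℝ i k k<i = packing-theorem ℝ i (i ∸ k) k (sym (ℕ.m∸n+n≡m (ℕ.<⇒≤ k<i))) (ℕ.m>n⇒m∸n≢0 k<i)
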